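{- Let $\lambda$ and $\mu$ be partitions. Then $$\Delta\left(\mathrm{BD}^{\lambda\,\varnothing}\cdot \mathrm{BD}^{\varnothing\,\mu}\right)=\mathrm{BD}^{\lambda\,\mu}\qquad\text{and}\qquad \mathbf{\Delta}\left(\mathbf{BD}^{\lambda\,\varnothing}\cdot \mathbf{BD}^{\varnothing\,\mu}\right)=\mathbf{BD}^{\lambda\,\mu}.$$
   Context: A partition is a finite weakly decreasing sequence of non-negative integers; $|\lambda|$ is the sum of its parts and $\varnothing$ is the trivial partition (of $0$). For a partition $\lambda$ of $m$, $\chi^\lambda$ is the irreducible character of the symmetric group $S_m$ indexed by $\lambda$ (in the standard way). For a permutation $\pi$ and $k\ge 1$, $\pi(k)$ denotes the number of $k$-cycles of $\pi$ (not the image of $k$). Let $p_1,p_2,\dots,\tilde p_1,\tilde p_2,\dots$ be independent commuting variables and $V=\mathbb{Q}[[p_1,p_2,\dots,\tilde p_1,\tilde p_2,\dots]]$. For $\lambda$ a partition of $m$ and $\mu$ a partition of $p$, the polynomial $\mathrm{BD}^{\lambda\,\mu}\in V$ is $$\mathrm{BD}^{\lambda\,\mu}=\frac1{m!}\sum_{\pi\in S_m}\frac1{p!}\sum_{\rho\in S_p}\chi^\lambda(\pi)\chi^\mu(\rho)\prod_{k>0}F_k(\pi,\rho),$$ where $$F_k(\pi,\rho)=\begin{cases}k^{\rho(k)}\rho(k)!\,L^{(\pi(k)-\rho(k))}_{\rho(k)}\left(-\frac{p_k\tilde p_k}{k}\right)p_k^{\pi(k)-\rho(k)}&\text{if }\pi(k)\ge\rho(k),\\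 k^{\pi(k)}\pi(k)!\,L^{(\rho(k)-\pi(k))}_{\pi(k)}\left(-\frac{p_k\tilde p_k}{k}\right)\tilde p_k^{\rho(k)-\pi(k)}&\text{if }\rho(k)\ge\pi(k),\end{cases}$$ and $L_n^{(\alpha)}(t)=\sum_{k=0}^n\binom{n+\alpha}{n-k}\frac{(-t)^k}{k!}$ is the Laguerre polynomial. Let $\mathbf{\Lambda}(\overline X)$, $\mathbf{\Lambda}(\overline Y)$ be the algebras of symmetric functions over $\mathbb{Q}$ in the countable variable sets $\overline X=\{x_1,x_2,\dots\}$ and $\overline Y=\{y_1,y_2,\dots\}$, let $\mathbf{p}_k$ and $\tilde{\mathbf{p}}_k$ be the respective power sums, and let $\mathbf{\Lambda}(\overline X,\overline Y)=\mathbf{\Lambda}(\overline X)\otimes_{\mathbb{Q}}\mathbf{\Lambda}(\overline Y)$, which is the polynomial algebra over $\mathbb{Q}$ in the $\mathbf{p}_k,\tilde{\mathbf{p}}_k$, $k\ge1$. The element $\mathbf{BD}^{\lambda\,\mu}\in\mathbf{\Lambda}(\overline X,\overline Y)$ is defined by the same formulas as $\mathrm{BD}^{\lambda\,\mu}$ with $p_k,\tilde p_k$ replaced by $\mathbf{p}_k,\tilde{\mathbf{p}}_k$. The operator $\Delta$ is $$\Delta=\exp\left(\sum_{k>0}k\,\partial_{p_k}\partial_{\tilde p_k}\right)=\prod_{k>0}\sum_{i\ge0}\frac{k^i}{i!}(\partial_{p_k}\partial_{\tilde p_k})^i,$$ where powers denote composition; on a polynomial in the $p_k,\tilde p_k$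 only finitely many terms contribute. The operator $\mathbf{\Delta}$ on $\mathbf{\Lambda}(\overline X,\overline Y)$ is defined by the same formula with $\partial_{p_k},\partial_{\tilde p_k}$ replaced by $\partial_{\mathbf{p}_k},\partial_{\tilde{\mathbf{p}}_k}$. -}

module Defs where

open import Level using (0ℓ)
open import Algebra.Bundles using (AbelianGroup; CommutativeRing)
import Algebra.Definitions.RawSemiring as RawSemiringDefinitions
import Algebra.Morphism.RingMonomorphism as RingMonomorphism
open import Algebra.Morphism.Structures using (module RingMorphisms)
import Algebra.Properties.AbelianGroup as AbelianGroupProperties
import Algebra.Properties.CommutativeMonoid.Mult as CommutativeMonoidMult
import Algebra.Properties.CommutativeMonoid.Sum as CommutativeMonoidSum
import Algebra.Properties.CommutativeSemigroup as CommutativeSemigroupProperties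
import Algebra.Properties.Group as GroupProperties
import Algebra.Properties.Monoid.Mult as MonoidMult
import Algebra.Properties.Ring as RingProperties
import Algebra.Properties.Semiring.Exp as SemiringExp
import Algebra.Properties.Semiring.Mult as SemiringMult
import Algebra.Properties.Semiring.Sum as SemiringSum
open import Data.Bool.Base using (true; false; T; if_then_else_)
open import Data.Fin.Base as Fin using (Fin; zero; suc; toℕ; remQuot; combine; punchIn)
open import Data.Fin.Permutation as Perm using (Permutation′; _⟨$⟩ʳ_; _⟨$⟩ˡ_; _∘ₚ_; insert; remove; insert-remove)
open import Data.Fin.Properties as Fin using (all?; ¬∀⟶∃¬; remQuot-combine; combine-remQuot; punchIn-injective)
open import Data.Integer.Base using (+_)
open import Data.List.Base as List using (List; []; _∷_; _∷ʳ_)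
open import Data.List.Relation.Binary.Permutation.Propositional as ↭ using (_↭_)
open import Data.List.Relation.Binary.Permutation.Propositional.Properties using (∷↭∷ʳ)
open import Data.List.Relation.Unary.Linked using (Linked; [])
open import Data.Nat.Base as ℕ using (ℕ; zero; suc; _<_; _≤_; _≥_; _∸_; _!)
open import Data.Nat.Combinatorics using (_C_)
open import Data.Nat.GeneralisedArithmetic using (iterate)
open import Data.Nat.Induction using (<-rec)
open import Data.Nat.ListAction using (sum)
import Data.Nat.Properties as ℕ
open import Data.Product.Base using (∃; _×_; _,_; proj₁; proj₂)
open import Data.Rational.Base as ℚ using (ℚ; 0ℚ; 1ℚ)
import Data.Rational.Properties as ℚ
open import Data.Rational.Solver using (module +-*-Solver)
open import Data.Sum.Base using (_⊎_; inj₁; inj₂)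
open import Data.Unit.Base using (tt)
open import Data.Vec.Base as Vec using (Vec; []; _∷_)
open import Data.Vec.Functional using (Vector; head; tail)
import Data.Vec.Properties as Vec
open import Function.Base using (_∘_; id)
import Relation.Binary.Reasoning.Setoid as SetoidReasoning
open import Relation.Binary.PropositionalEquality as ≡ using (_≡_; _≢_)
open import Relation.Nullary using (Dec; yes; no; does; contradiction)
open import Relation.Nullary.Decidable using (_×-dec_)

ℚ-ring : CommutativeRing 0ℓ 0ℓ
ℚ-ring = ℚ.+-*-commutativeRing

-- The elements of the symmetric group, enumerated by Fin (n !).
perm : ∀ n → Fin (n !) → Permutation′ n
perm zero    _ = Perm.id
perm (suc n) x = let i , y = remQuot {suc n} (n !) x in insert zero i (perm n y)

perm-surjective : ∀ n (π : Permutation′ n) → ∃ λ x → perm n x Perm.≈ π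
perm-surjective zero    π = zero , λ ()
perm-surjective (suc n) π with perm-surjective n (remove zero π)
... | y , eq = combine (π ⟨$⟩ʳ zero) y , λ i → ≡.trans (split (remQuot-combine (π ⟨$⟩ʳ zero) y) i) (insert-remove zero π i)
  where
  split : ∀ {p} → p ≡ (π ⟨$⟩ʳ zero , y) →
          insert zero (proj₁ p) (perm n (proj₂ p)) Perm.≈ insert zero (π ⟨$⟩ʳ zero) (remove zero π)
  split ≡.refl zero    = ≡.refl
  split ≡.refl (suc i) = ≡.cong (punchIn (π ⟨$⟩ʳ zero)) (eq i)

perm-injective : ∀ n {x y} → perm n x Perm.≈ perm n y → x ≡ y
perm-injective zero    {zero} {zero} _ = ≡.refl
perm-injective (suc n) {x} {y} eq = begin
  x                                                  ≡⟨ combine-remQuot {suc n} (n !) x ⟨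
  combine (proj₁ (remQuot {suc n} (n !) x)) (proj₂ (remQuot {suc n} (n !) x))
    ≡⟨ ≡.cong₂ combine (eq zero) (perm-injective n (λ i → punchIn-injective _ _ _ (≡.trans (eq (suc i)) (≡.cong (λ j → punchIn j _) (≡.sym (eq zero)))))) ⟩
  combine (proj₁ (remQuot {suc n} (n !) y)) (proj₂ (remQuot {suc n} (n !) y)) ≡⟨ combine-remQuot {suc n} (n !) y ⟩
  y                                                  ∎
  where open ≡.≡-Reasoning

-- The ℚ-vector space of functions on the finite set of points: functions on X
-- that agree at all points are identified.
module LinearAlgebra {X : Set} {N : ℕ} (point : Fin N → X) where

  open SemiringSum (CommutativeRing.semiring ℚ-ring) using (sum-syntax; sum-cong-≗; ∑-distrib-+; *-distribˡ-sum)

  V : Set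
  V = X → ℚ

  infix 4 _≐_
  _≐_ : V → V → Set
  v ≐ w = ∀ n → v (point n) ≡ w (point n)

  combination : ∀ {d} → (Fin d → ℚ) → Vector V d → V
  combination {d} c vs x = ∑[ i < d ] (c i ℚ.* vs i x)

  data Span {r} (vs : Vector V r) : V → Set where
    generator : ∀ i → Span vs (vs i)
    zero      : Span vs (λ _ → 0ℚ)
    add       : ∀ {v w} → Span vs v → Span vs w → Span vs (λ x → v x ℚ.+ w x)
    scale     : ∀ {v} c → Span vs v → Span vs (λ x → c ℚ.* v x)
    respects  : ∀ {v w} → v ≐ w → Span vs v → Span vs w

  -- The functionals coord i extend the dual basis, so a linear map T that
  -- preserves the span has trace ∑ᵢ coord i (T (vec i)) on it.
  record Basis {r} (vs : Vector V r) : Set where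
    field
      dim          : ℕ
      vec          : Vector V dim
      coord        : Fin dim → V → ℚ
      vec∈span     : ∀ i → Span vs (vec i)
      coord-expand : ∀ {v} → Span vs v → v ≐ combination (λ i → coord i v) vec
      coord-unique : ∀ c i → coord i (combination c vec) ≡ c i

  δ : ∀ {d} → Fin d → Fin d → ℚ
  δ i j = if does (i Fin.≟ j) then 1ℚ else 0ℚ

  record EchelonBasis {r} (vs : Vector V r) : Set where
    field
      dim      : ℕ
      vec      : Vector V dim
      pivot    : Fin dim → Fin N
      vec∈span : ∀ i → Span vs (vec i)
      dual     : ∀ i j → vec i (point (pivot j)) ≡ δ i j

    coord : Fin dim → V → ℚ
    coord i v = v (point (pivot i))

    expansion : V → V
    expansion v = combination (λ i → coord i v) vec

    field
      expand : ∀ i → vs i ≐ expansion (vs i)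

  open +-*-Solver using (solve; con; _:=_; _:+_; _:*_; :-_; _:-_)

  ∑-0 : ∀ {d} (c : Fin d → ℚ) → ∑[ i < d ] (c i ℚ.* 0ℚ) ≡ 0ℚ
  ∑-0 {zero}  c = ≡.refl
  ∑-0 {suc d} c = ≡.cong₂ ℚ._+_ (ℚ.*-zeroʳ (c zero)) (∑-0 (tail c))

  ∑-δ : ∀ {d} (c : Fin d → ℚ) j → ∑[ i < d ] (c i ℚ.* δ i j) ≡ c j
  ∑-δ {suc d} c zero    = ≡.trans (≡.cong₂ ℚ._+_ (ℚ.*-identityʳ (c zero)) (∑-0 (tail c))) (ℚ.+-identityʳ (c zero))
  ∑-δ {suc d} c (suc j) = ≡.trans (≡.cong₂ ℚ._+_ (ℚ.*-zeroʳ (c zero)) (∑-δ (tail c) j)) (ℚ.+-identityˡ (c (suc j)))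

  ∑-shift : ∀ {d} (c a b : Fin d → ℚ) u →
            ∑[ i < d ] (c i ℚ.* (a i ℚ.- b i ℚ.* u)) ≡ ∑[ i < d ] (c i ℚ.* a i) ℚ.- ∑[ i < d ] (c i ℚ.* b i) ℚ.* u
  ∑-shift {zero}  c a b u = solve 1 (λ u → con 0ℚ := con 0ℚ :- con 0ℚ :* u) ≡.refl u
  ∑-shift {suc d} c a b u =
    ≡.trans (≡.cong (head c ℚ.* (head a ℚ.- head b ℚ.* u) ℚ.+_) (∑-shift (tail c) (tail a) (tail b) u))
          (solve 6 (λ c a b u s t → c :* (a :- b :* u) :+ (s :- t :* u) := (c :* a :+ s) :- (c :* b :+ t) :* u)
             ≡.refl (head c) (head a) (head b) u (∑[ i < d ] (tail c i ℚ.* tail a i)) (∑[ i < d ] (tail c i ℚ.* tail b i)))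

  span-⊆ : ∀ {r} {vs : Vector V (suc r)} {v} → Span (tail vs) v → Span vs v
  span-⊆ (generator i)  = generator (suc i)
  span-⊆ zero           = zero
  span-⊆ (add p q)      = add (span-⊆ p) (span-⊆ q)
  span-⊆ (scale c p)    = scale c (span-⊆ p)
  span-⊆ (respects e p) = respects e (span-⊆ p)

  span-combination : ∀ {r d} {vs : Vector V r} c (ws : Vector V d) → (∀ i → Span vs (ws i)) → Span vs (combination c ws)
  span-combination {d = zero}  c ws p = zero
  span-combination {d = suc d} c ws p = add (scale (head c) (p zero)) (span-combination (tail c) (tail ws) (p ∘ suc))

  span-subtract : ∀ {r} {vs : Vector V r} {v w} c → Span vs v → Span vs w → Span vs (λ x → v x ℚ.- c ℚ.* w x)
  span-subtract {v = v} {w} c p q =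
    respects (λ n → solve 3 (λ v c w → v :+ (:- c) :* w := v :- c :* w) ≡.refl (v (point n)) c (w (point n)))
             (add p (scale (ℚ.- c) q))

  -- One step of Gauss–Jordan elimination.
  extend : ∀ {r} (vs : Vector V (suc r)) → EchelonBasis (tail vs) → EchelonBasis vs
  extend vs E with all? (λ n → rest (point n) ℚ.≟ 0ℚ)
    where
    open EchelonBasis E
    rest : V
    rest x = head vs x ℚ.- expansion (head vs) x
  ... | yes rest≡0 = record
    { dim      = dim
    ; vec      = vec
    ; pivot    = pivot
    ; vec∈span = λ i → span-⊆ (vec∈span i)
    ; dual     = dual
    ; expand   = λ { zero n    → ℚ-equal (head vs (point n)) (expansion (head vs) (point n)) (rest≡0 n)
                   ; (suc i) n → expand i n }
    }
    where
    open EchelonBasis E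
    ℚ-equal : ∀ a b → a ℚ.- b ≡ 0ℚ → a ≡ b
    ℚ-equal a b eq = ≡.trans (solve 2 (λ a b → a := (a :- b) :+ b) ≡.refl a b) (≡.trans (≡.cong (ℚ._+ b) eq) (ℚ.+-identityˡ b))
  ... | no rest≢0 = record
    { dim      = suc dim
    ; vec      = λ { zero → unit ; (suc i) → reduced i }
    ; pivot    = λ { zero → n₀ ; (suc i) → pivot i }
    ; vec∈span = λ { zero → unit∈span ; (suc i) → span-subtract (vec i (point n₀)) (span-⊆ (vec∈span i)) unit∈span }
    ; dual     = λ { zero zero       → unit-n₀
                   ; zero (suc j)    → unit-pivot j
                   ; (suc i) zero    → ≡.trans (≡.cong (λ u → vec i (point n₀) ℚ.- vec i (point n₀) ℚ.* u) unit-n₀)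
                                             (solve 1 (λ a → a :- a :* con 1ℚ := con 0ℚ) ≡.refl (vec i (point n₀)))
                   ; (suc i) (suc j) → ≡.trans (≡.cong₂ (λ a u → a ℚ.- vec i (point n₀) ℚ.* u) (dual i j) (unit-pivot j))
                                             (solve 2 (λ a b → a :- b :* con 0ℚ := a) ≡.refl (δ i j) (vec i (point n₀)))
                   }
    ; expand   = λ { zero n    → ≡.trans (≡.sym (rest+expansion n)) (≡.sym (re-expand (head vs) n))
                   ; (suc i) n → ≡.trans (expand i n) (≡.trans (old i n) (≡.sym (re-expand (vs (suc i)) n))) }
    }
    where
    open EchelonBasis E
    rest : V
    rest x = head vs x ℚ.- expansion (head vs) x

    nonzero : ∃ λ n → rest (point n) ≢ 0ℚ
    nonzero = ¬∀⟶∃¬ _ _ (λ n → rest (point n) ℚ.≟ 0ℚ) rest≢0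

    n₀ : Fin N
    n₀ = proj₁ nonzero

    instance
      rest-n₀ : ℚ.NonZero (rest (point n₀))
      rest-n₀ = ℚ.≢-nonZero (proj₂ nonzero)

    unit : V
    unit x = ℚ.1/ rest (point n₀) ℚ.* rest x

    reduced : Vector V dim
    reduced i x = vec i x ℚ.- vec i (point n₀) ℚ.* unit x

    unit∈span : Span vs unit
    unit∈span = scale (ℚ.1/ rest (point n₀)) (respects (λ n → solve 2 (λ a b → a :- con 1ℚ :* b := a :- b) ≡.refl (head vs (point n)) (expansion (head vs) (point n)))
      (span-subtract 1ℚ (generator zero) (span-combination (λ i → coord i (head vs)) vec (λ i → span-⊆ (vec∈span i)))))

    unit-n₀ : unit (point n₀) ≡ 1ℚ
    unit-n₀ = ℚ.*-inverseˡ (rest (point n₀))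

    unit-pivot : ∀ j → unit (point (pivot j)) ≡ 0ℚ
    unit-pivot j = ≡.trans (≡.cong (ℚ.1/ rest (point n₀) ℚ.*_) rest-pivot) (ℚ.*-zeroʳ (ℚ.1/ rest (point n₀)))
      where
      rest-pivot : rest (point (pivot j)) ≡ 0ℚ
      rest-pivot = ≡.trans (≡.cong (λ e → coord j (head vs) ℚ.- e)
                           (≡.trans (sum-cong-≗ (λ i → ≡.cong (coord i (head vs) ℚ.*_) (dual i j))) (∑-δ (λ i → coord i (head vs)) j)))
                         (ℚ.+-inverseʳ (coord j (head vs)))

    re-expand : ∀ (g : V) n →
      g (point n₀) ℚ.* unit (point n) ℚ.+ ∑[ i < dim ] (coord i g ℚ.* reduced i (point n)) ≡
      expansion g (point n) ℚ.+ (g (point n₀) ℚ.- expansion g (point n₀)) ℚ.* unit (point n)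
    re-expand g n = ≡.trans
      (≡.cong (g (point n₀) ℚ.* unit (point n) ℚ.+_)
        (∑-shift (λ i → coord i g) (λ i → vec i (point n)) (λ i → vec i (point n₀)) (unit (point n))))
      (solve 4 (λ a u s t → a :* u :+ (s :- t :* u) := s :+ (a :- t) :* u) ≡.refl
        (g (point n₀)) (unit (point n)) (expansion g (point n)) (expansion g (point n₀)))

    rest+expansion : ∀ n → expansion (head vs) (point n) ℚ.+ rest (point n₀) ℚ.* unit (point n) ≡ head vs (point n)
    rest+expansion n = begin
      s ℚ.+ r ℚ.* (ℚ.1/ r ℚ.* w)     ≡⟨ ≡.cong (s ℚ.+_) (≡.sym (ℚ.*-assoc r (ℚ.1/ r) w)) ⟩
      s ℚ.+ (r ℚ.* ℚ.1/ r) ℚ.* w     ≡⟨ ≡.cong (λ z → s ℚ.+ z ℚ.* w) (ℚ.*-inverseʳ r) ⟩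
      s ℚ.+ 1ℚ ℚ.* (a ℚ.- s)         ≡⟨ solve 2 (λ s a → s :+ con 1ℚ :* (a :- s) := a) ≡.refl s a ⟩
      a                              ∎
      where
      open ≡.≡-Reasoning
      a = head vs (point n)
      s = expansion (head vs) (point n)
      r = rest (point n₀)
      w = rest (point n)

    old : ∀ i n → expansion (vs (suc i)) (point n) ≡
      expansion (vs (suc i)) (point n) ℚ.+ (vs (suc i) (point n₀) ℚ.- expansion (vs (suc i)) (point n₀)) ℚ.* unit (point n)
    old i n = ≡.sym (begin
      s ℚ.+ (g ℚ.- t) ℚ.* u ≡⟨ ≡.cong (λ z → s ℚ.+ (z ℚ.- t) ℚ.* u) (expand i n₀) ⟩
      s ℚ.+ (t ℚ.- t) ℚ.* u ≡⟨ solve 3 (λ s t u → s :+ (t :- t) :* u := s) ≡.refl s t u ⟩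
      s                     ∎)
      where
      open ≡.≡-Reasoning
      g = vs (suc i) (point n₀)
      t = expansion (vs (suc i)) (point n₀)
      s = expansion (vs (suc i)) (point n)
      u = unit (point n)

  echelonBasis : ∀ {r} (vs : Vector V r) → EchelonBasis vs
  echelonBasis {zero}  vs = record
    { dim = 0 ; vec = λ () ; pivot = λ () ; vec∈span = λ () ; dual = λ () ; expand = λ () }
  echelonBasis {suc r} vs = extend vs (echelonBasis (tail vs))

  basis : ∀ {r} (vs : Vector V r) → Basis vs
  basis vs = record
    { dim          = dim
    ; vec          = vec
    ; coord        = coord
    ; vec∈span     = vec∈span
    ; coord-expand = expand-span
    ; coord-unique = λ c i → ≡.trans (sum-cong-≗ (λ j → ≡.cong (c j ℚ.*_) (dual j i))) (∑-δ c i)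
    }
    where
    open EchelonBasis (echelonBasis vs)

    ∑-+ : ∀ {d} (c e a : Fin d → ℚ) →
      ∑[ i < d ] ((c i ℚ.+ e i) ℚ.* a i) ≡ ∑[ i < d ] (c i ℚ.* a i) ℚ.+ ∑[ i < d ] (e i ℚ.* a i)
    ∑-+ c e a = ≡.trans (sum-cong-≗ (λ i → ℚ.*-distribʳ-+ (a i) (c i) (e i))) (∑-distrib-+ (λ i → c i ℚ.* a i) (λ i → e i ℚ.* a i))

    ∑-* : ∀ {d} c (e a : Fin d → ℚ) → ∑[ i < d ] ((c ℚ.* e i) ℚ.* a i) ≡ c ℚ.* ∑[ i < d ] (e i ℚ.* a i)
    ∑-* c e a = ≡.trans (sum-cong-≗ (λ i → ℚ.*-assoc c (e i) (a i))) (≡.sym (*-distribˡ-sum c (λ i → e i ℚ.* a i)))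

    expand-span : ∀ {v} → Span vs v → v ≐ expansion v
    expand-span (generator i)  n = expand i n
    expand-span zero           n = ≡.sym (≡.trans (∑-* {dim} 0ℚ (λ _ → 0ℚ) (λ i → vec i (point n))) (ℚ.*-zeroˡ (∑[ i < dim ] (0ℚ ℚ.* vec i (point n)))))
    expand-span (add {v} {w} p q) n = ≡.trans (≡.cong₂ ℚ._+_ (expand-span p n) (expand-span q n))
      (≡.sym (∑-+ (λ i → coord i v) (λ i → coord i w) (λ i → vec i (point n))))
    expand-span (scale {v} c p)    n = ≡.trans (≡.cong (c ℚ.*_) (expand-span p n))
      (≡.sym (∑-* c (λ i → coord i v) (λ i → vec i (point n))))
    expand-span (respects {v} {w} e p) n = ≡.trans (≡.sym (e n)) (≡.trans (expand-span p n)
      (sum-cong-≗ (λ i → ≡.cong (ℚ._* vec i (point n)) (e (pivot i)))))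

record Partition : Set where
  constructor partition
  field
    parts      : List ℕ
    decreasing : Linked _≥_ parts

open Partition public

∅ : Partition
∅ = partition [] []

∣_∣ : Partition → ℕ
∣ λ′ ∣ = sum (parts λ′)

-- The cells of the Young diagram are numbered row by row.
rows : (ls : List ℕ) → Vec ℕ (sum ls)
rows []       = []
rows (l ∷ ls) = Vec.replicate l 0 Vec.++ Vec.map suc (rows ls)

columns : (ls : List ℕ) → Vec ℕ (sum ls)
columns []       = []
columns (l ∷ ls) = Vec.tabulate {n = l} toℕ Vec.++ columns ls

inversions : ∀ {m} → Permutation′ m → ℕ
inversions {m} σ = List.length (List.filter (λ (i , j) → (i Fin.<? j) ×-dec ((σ ⟨$⟩ʳ j) Fin.<? (σ ⟨$⟩ʳ i)))
                                            (List.cartesianProduct (List.allFin m) (List.allFin m)))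

sgn : ∀ {m} → Permutation′ m → ℚ
sgn σ = (ℚ.- 1ℚ) ^ inversions σ
  where open RawSemiringDefinitions ℚ.+-*-rawSemiring using (_^_)

-- The Specht module, spanned by the polytabloids.  A tableau is a permutation
-- taking (the number of) each cell to its entry.
module Specht (λ′ : Partition) where

  m : ℕ
  m = ∣ λ′ ∣

  row column : Fin m → ℕ
  row    = Vec.lookup (rows (parts λ′))
  column = Vec.lookup (columns (parts λ′))

  -- A tabloid is recorded by the row of each entry.
  Tabloid : Set
  Tabloid = Vec ℕ m

  tabloid : Permutation′ m → Tabloid
  tabloid τ = Vec.tabulate (λ a → row (τ ⟨$⟩ˡ a))

  open SemiringSum (CommutativeRing.semiring ℚ-ring) using (sum-syntax)
  open LinearAlgebra {Tabloid} (λ x → tabloid (perm m x))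

  -- (πv)(w) = v(π⁻¹w), where the tabloid π⁻¹w has entry a in the row in
  -- which w has π(a).
  infixr 7 _•_
  _•_ : Permutation′ m → V → V
  (π • v) w = v (Vec.tabulate (λ a → Vec.lookup w (π ⟨$⟩ʳ a)))

  columnStabiliser? : (σ : Permutation′ m) → Dec (∀ c → column (σ ⟨$⟩ʳ c) ≡ column c)
  columnStabiliser? σ = all? (λ c → column (σ ⟨$⟩ʳ c) ℕ.≟ column c)

  -- e_τ = ∑ sgn σ {τσ}, over the σ preserving the columns.
  polytabloid : Permutation′ m → V
  polytabloid τ w = ∑[ x < m ! ]
    (if does (columnStabiliser? (perm m x)) then
       (if does (Vec.≡-dec ℕ._≟_ w (tabloid (perm m x ∘ₚ τ))) then sgn (perm m x) else 0ℚ)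
     else 0ℚ)

  spechtBasis : Basis (λ x → polytabloid (perm m x))
  spechtBasis = basis (λ x → polytabloid (perm m x))

  -- The trace of π on the Specht module.
  character : Permutation′ m → ℚ
  character π = ∑[ i < Basis.dim spechtBasis ] Basis.coord spechtBasis i (π • Basis.vec spechtBasis i)

χ : (λ′ : Partition) → Permutation′ ∣ λ′ ∣ → ℚ
χ = Specht.character

-- The number of k-cycles, for k ≥ 1, with each cycle counted at its least element.
cycles : ∀ {m} → Permutation′ m → ℕ → ℕ
cycles {m} π k = List.length (List.filter leastInCycle? (List.allFin m))
  where
  leastInCycle? : (i : Fin m) →
    Dec (iterate (π ⟨$⟩ʳ_) i k ≡ i × (∀ (l : Fin (ℕ.pred k)) → i Fin.< iterate (π ⟨$⟩ʳ_) i (suc (toℕ l))))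
  leastInCycle? i = (iterate (π ⟨$⟩ʳ_) i k Fin.≟ i) ×-dec all? (λ l → i Fin.<? iterate (π ⟨$⟩ʳ_) i (suc (toℕ l)))

record ℚ-Algebra : Set₁ where
  field
    commutativeRing : CommutativeRing 0ℓ 0ℓ

  open CommutativeRing commutativeRing public

  field
    ι      : ℚ → Carrier
    ι-homo : RingMorphisms.IsRingHomomorphism (CommutativeRing.rawRing ℚ-ring) rawRing ι

  open RingMorphisms.IsRingHomomorphism ι-homo public using ()
    renaming (+-homo to ι-+; *-homo to ι-*; -‿homo to ι-neg; 0#-homo to ι-0; 1#-homo to ι-1)

  infixr 7 _·_
  _·_ : ℚ → Carrier → Carrier
  q · x = ι q * x

  open SemiringSum semiring public using (sum-syntax; sum⁺-syntax)
  open SemiringExp semiring public using (_^_)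

  infixl 10 product-syntax
  product-syntax : ∀ n → (Fin n → Carrier) → Carrier
  product-syntax _ = CommutativeMonoidSum.sum *-commutativeMonoid
  syntax product-syntax n (λ i → x) = ∏[ i < n ] x

ringHomomorphism : (R S : CommutativeRing 0ℓ 0ℓ) →
  let module R = CommutativeRing R; module S = CommutativeRing S in
  (f : R.Carrier → S.Carrier) →
  (∀ {x y} → x R.≈ y → f x S.≈ f y) →
  (∀ x y → f (x R.+ y) S.≈ f x S.+ f y) →
  (∀ x y → f (x R.* y) S.≈ f x S.* f y) →
  f R.1# S.≈ S.1# →
  RingMorphisms.IsRingHomomorphism R.rawRing S.rawRing f
ringHomomorphism R S f f-cong f-+ f-* f-1 = record
  { isSemiringHomomorphism = record
    { isNearSemiringHomomorphism = record
      { +-isMonoidHomomorphism = record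
        { isMagmaHomomorphism = record { isRelHomomorphism = record { cong = f-cong } ; homo = f-+ }
        ; ε-homo = f-0
        }
      ; *-homo = f-*
      }
    ; 1#-homo = f-1
    }
  ; -‿homo = λ x → inverseˡ-unique _ _ (S.trans (S.sym (f-+ (R.- x) x)) (S.trans (f-cong (R.-‿inverseˡ x)) f-0))
  }
  where
  module R = CommutativeRing R
  module S = CommutativeRing S
  open GroupProperties S.+-group using (identityʳ-unique; inverseˡ-unique)
  f-0 : f R.0# S.≈ S.0#
  f-0 = identityʳ-unique (f R.0#) (f R.0#) (S.trans (S.sym (f-+ R.0# R.0#)) (f-cong (R.+-identityˡ R.0#)))

rationals : ℚ-Algebra
rationals = record
  { commutativeRing = ℚ-ring
  ; ι               = id
  ; ι-homo          = ringHomomorphism ℚ-ring ℚ-ring id id (λ _ _ → ≡.refl) (λ _ _ → ≡.refl) ≡.refl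
  }

module Antidiagonal (R : CommutativeRing 0ℓ 0ℓ) where

  open CommutativeRing R hiding (zero)
  open CommutativeSemigroupProperties +-commutativeSemigroup using (interchange)
  open SetoidReasoning setoid

  -- antidiagonal n h is the sum of h a b over all a + b = n.
  antidiagonal : ℕ → (ℕ → ℕ → Carrier) → Carrier
  antidiagonal zero    h = h 0 0
  antidiagonal (suc n) h = h 0 (suc n) + antidiagonal n (λ a b → h (suc a) b)

  antidiagonal-cong : ∀ n {h k} → (∀ a b → a ℕ.+ b ≡ n → h a b ≈ k a b) → antidiagonal n h ≈ antidiagonal n k
  antidiagonal-cong zero    h≈k = h≈k 0 0 ≡.refl
  antidiagonal-cong (suc n) h≈k =
    +-cong (h≈k 0 (suc n) ≡.refl) (antidiagonal-cong n (λ a b eq → h≈k (suc a) b (≡.cong suc eq)))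

  antidiagonal-0 : ∀ n → antidiagonal n (λ _ _ → 0#) ≈ 0#
  antidiagonal-0 zero    = refl
  antidiagonal-0 (suc n) = trans (+-identityˡ _) (antidiagonal-0 n)

  antidiagonal-+ : ∀ n h k → antidiagonal n (λ a b → h a b + k a b) ≈ antidiagonal n h + antidiagonal n k
  antidiagonal-+ zero    h k = refl
  antidiagonal-+ (suc n) h k = trans (+-congˡ (antidiagonal-+ n _ _)) (interchange _ _ _ _)

  antidiagonal-*ˡ : ∀ n x h → x * antidiagonal n h ≈ antidiagonal n (λ a b → x * h a b)
  antidiagonal-*ˡ zero    x h = refl
  antidiagonal-*ˡ (suc n) x h = trans (distribˡ x _ _) (+-congˡ (antidiagonal-*ˡ n x _))

  antidiagonal-last : ∀ n h → antidiagonal (suc n) h ≈ antidiagonal n (λ a b → h a (suc b)) + h (suc n) 0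
  antidiagonal-last zero    h = refl
  antidiagonal-last (suc n) h = trans (+-congˡ (antidiagonal-last n (λ a b → h (suc a) b))) (sym (+-assoc _ _ _))

  antidiagonal-flip : ∀ n h → antidiagonal n h ≈ antidiagonal n (λ a b → h b a)
  antidiagonal-flip zero    h = refl
  antidiagonal-flip (suc n) h = begin
    h 0 (suc n) + antidiagonal n (λ a b → h (suc a) b) ≈⟨ +-congˡ (antidiagonal-flip n _) ⟩
    h 0 (suc n) + antidiagonal n (λ a b → h (suc b) a) ≈⟨ +-comm _ _ ⟩
    antidiagonal n (λ a b → h (suc b) a) + h 0 (suc n) ≈⟨ antidiagonal-last n (λ a b → h b a) ⟨
    antidiagonal (suc n) (λ a b → h b a)               ∎

  antidiagonal-assoc : ∀ n (h : ℕ → ℕ → ℕ → Carrier) →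
    antidiagonal n (λ a b → antidiagonal a (λ c d → h c d b)) ≈
    antidiagonal n (λ a b → antidiagonal b (λ c d → h a c d))
  antidiagonal-assoc zero    h = refl
  antidiagonal-assoc (suc n) h = begin
    h 0 0 (suc n) + antidiagonal n (λ a b → h 0 (suc a) b + antidiagonal a (λ c d → h (suc c) d b))
      ≈⟨ +-congˡ (antidiagonal-+ n _ _) ⟩
    h 0 0 (suc n) + (antidiagonal n (λ a b → h 0 (suc a) b)
      + antidiagonal n (λ a b → antidiagonal a (λ c d → h (suc c) d b)))
      ≈⟨ +-assoc _ _ _ ⟨
    antidiagonal (suc n) (h 0) + antidiagonal n (λ a b → antidiagonal a (λ c d → h (suc c) d b))
      ≈⟨ +-congˡ (antidiagonal-assoc n (λ a → h (suc a))) ⟩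
    antidiagonal (suc n) (h 0) + antidiagonal n (λ a b → antidiagonal b (λ c d → h (suc a) c d)) ∎

  antidiagonal-comm : ∀ m n (h : ℕ → ℕ → ℕ → ℕ → Carrier) →
    antidiagonal m (λ a b → antidiagonal n (h a b)) ≈
    antidiagonal n (λ c d → antidiagonal m (λ a b → h a b c d))
  antidiagonal-comm zero    n h = refl
  antidiagonal-comm (suc m) n h =
    trans (+-congˡ (antidiagonal-comm m n _)) (sym (antidiagonal-+ n _ _))

  antidiagonal-head : ∀ n h → (∀ a b → h (suc a) b ≈ 0#) → antidiagonal n h ≈ h 0 n
  antidiagonal-head zero    h h≈0 = refl
  antidiagonal-head (suc n) h h≈0 = begin
    h 0 (suc n) + antidiagonal n (λ a b → h (suc a) b) ≈⟨ +-congˡ (antidiagonal-cong n (λ a b _ → h≈0 a b)) ⟩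
    h 0 (suc n) + antidiagonal n (λ _ _ → 0#)          ≈⟨ +-congˡ (antidiagonal-0 n) ⟩
    h 0 (suc n) + 0#                                   ≈⟨ +-identityʳ _ ⟩
    h 0 (suc n)                                        ∎

module PowerSeries (R : CommutativeRing 0ℓ 0ℓ) where

  open CommutativeRing R hiding (zero)
  open Antidiagonal R
  open MonoidMult +-monoid using () renaming (_×_ to infixr 8 _·_; ×-congʳ to ·-congʳ)
  module ≈ = SetoidReasoning setoid

  Coefficients : Set
  Coefficients = List ℕ → Carrier

  -- The formal power series over R in countably many variables
  -- x₀, x₁, ….  The monomial x₀^e₀ x₁^e₁ ⋯ is the list of its exponents,
  -- which may be padded with zeros.
  record Series : Set where
    constructor series
    field
      coeff : Coefficients
      pad   : ∀ es → coeff (es ∷ʳ 0) ≈ coeff es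

  open Series public

  infix 4 _≋_
  _≋_ : Series → Series → Set
  f ≋ g = ∀ es → coeff f es ≈ coeff g es

  addC : Coefficients → Coefficients → Coefficients
  addC f g es = f es + g es

  mulC : Coefficients → Coefficients → Coefficients
  mulC f g []       = f [] * g []
  mulC f g (e ∷ es) = antidiagonal e (λ a b → mulC (λ as → f (a ∷ as)) (λ bs → g (b ∷ bs)) es)

  constC : Carrier → Coefficients
  constC c []           = c
  constC c (zero  ∷ es) = constC c es
  constC c (suc _ ∷ es) = 0#

  varC : ℕ → Coefficients
  varC _       []                 = 0#
  varC zero    (zero ∷ es)        = 0#
  varC zero    (suc zero ∷ es)    = constC 1# es
  varC zero    (suc (suc _) ∷ es) = 0#
  varC (suc j) (zero ∷ es)        = varC j es
  varC (suc j) (suc _ ∷ es)       = 0#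

  mulC-cong : ∀ {f f′ g g′} → (∀ es → f es ≈ f′ es) → (∀ es → g es ≈ g′ es) → ∀ es → mulC f g es ≈ mulC f′ g′ es
  mulC-cong f≈ g≈ []       = *-cong (f≈ []) (g≈ [])
  mulC-cong f≈ g≈ (e ∷ es) =
    antidiagonal-cong e (λ a b _ → mulC-cong (λ as → f≈ (a ∷ as)) (λ bs → g≈ (b ∷ bs)) es)

  mulC-comm : ∀ f g es → mulC f g es ≈ mulC g f es
  mulC-comm f g []       = *-comm _ _
  mulC-comm f g (e ∷ es) =
    trans (antidiagonal-cong e (λ a b _ → mulC-comm _ _ es)) (antidiagonal-flip e _)

  mulC-0ˡ : ∀ g es → mulC (λ _ → 0#) g es ≈ 0#
  mulC-0ˡ g []       = zeroˡ _
  mulC-0ˡ g (e ∷ es) = trans (antidiagonal-cong e (λ a b _ → mulC-0ˡ _ es)) (antidiagonal-0 e)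

  mulC-+ˡ : ∀ f f′ g es → mulC (addC f f′) g es ≈ mulC f g es + mulC f′ g es
  mulC-+ˡ f f′ g []       = distribʳ _ _ _
  mulC-+ˡ f f′ g (e ∷ es) =
    trans (antidiagonal-cong e (λ a b _ → mulC-+ˡ _ _ _ es)) (antidiagonal-+ e _ _)

  mulC-+ʳ : ∀ f g g′ es → mulC f (addC g g′) es ≈ mulC f g es + mulC f g′ es
  mulC-+ʳ f g g′ []       = distribˡ _ _ _
  mulC-+ʳ f g g′ (e ∷ es) =
    trans (antidiagonal-cong e (λ a b _ → mulC-+ʳ _ _ _ es)) (antidiagonal-+ e _ _)

  mulC-antidiagonalˡ : ∀ n (h : ℕ → ℕ → Coefficients) g es →
    mulC (λ as → antidiagonal n (λ c d → h c d as)) g es ≈ antidiagonal n (λ c d → mulC (h c d) g es)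
  mulC-antidiagonalˡ zero    h g es = refl
  mulC-antidiagonalˡ (suc n) h g es =
    trans (mulC-+ˡ _ _ g es) (+-congˡ (mulC-antidiagonalˡ n (λ c → h (suc c)) g es))

  mulC-antidiagonalʳ : ∀ n f (h : ℕ → ℕ → Coefficients) es →
    mulC f (λ as → antidiagonal n (λ c d → h c d as)) es ≈ antidiagonal n (λ c d → mulC f (h c d) es)
  mulC-antidiagonalʳ zero    f h es = refl
  mulC-antidiagonalʳ (suc n) f h es =
    trans (mulC-+ʳ f _ _ es) (+-congˡ (mulC-antidiagonalʳ n f (λ c → h (suc c)) es))

  mulC-assoc : ∀ f g h es → mulC (mulC f g) h es ≈ mulC f (mulC g h) es
  mulC-assoc f g h []       = *-assoc _ _ _
  mulC-assoc f g h (e ∷ es) = ≈.begin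
    antidiagonal e (λ a b → mulC (λ as → mulC f g (a ∷ as)) (λ bs → h (b ∷ bs)) es)
      ≈.≈⟨ antidiagonal-cong e (λ a b _ → mulC-antidiagonalˡ a _ _ es) ⟩
    antidiagonal e (λ a b → antidiagonal a (λ c d → mulC (mulC (λ cs → f (c ∷ cs)) (λ ds → g (d ∷ ds))) (λ bs → h (b ∷ bs)) es))
      ≈.≈⟨ antidiagonal-cong e (λ a b _ → antidiagonal-cong a (λ c d _ → mulC-assoc _ _ _ es)) ⟩
    antidiagonal e (λ a b → antidiagonal a (λ c d → mulC (λ cs → f (c ∷ cs)) (mulC (λ ds → g (d ∷ ds)) (λ bs → h (b ∷ bs))) es))
      ≈.≈⟨ antidiagonal-assoc e _ ⟩
    antidiagonal e (λ a b → antidiagonal b (λ c d → mulC (λ cs → f (a ∷ cs)) (mulC (λ ds → g (c ∷ ds)) (λ bs → h (d ∷ bs))) es))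
      ≈.≈⟨ antidiagonal-cong e (λ a b _ → mulC-antidiagonalʳ b _ _ es) ⟨
    antidiagonal e (λ a b → mulC (λ cs → f (a ∷ cs)) (λ bs → mulC g h (b ∷ bs)) es) ≈.∎

  mulC-constˡ : ∀ c g es → mulC (constC c) g es ≈ c * g es
  mulC-constˡ c g []       = refl
  mulC-constˡ c g (e ∷ es) =
    trans (antidiagonal-head e _ (λ a b → mulC-0ˡ _ es)) (mulC-constˡ c _ es)

  mulC-pad : ∀ f g es → (∀ es → f (es ∷ʳ 0) ≈ f es) → (∀ es → g (es ∷ʳ 0) ≈ g es) →
             mulC f g (es ∷ʳ 0) ≈ mulC f g es
  mulC-pad f g []       pf pg = *-cong (pf []) (pg [])
  mulC-pad f g (e ∷ es) pf pg =
    antidiagonal-cong e (λ a b _ → mulC-pad _ _ es (λ as → pf (a ∷ as)) (λ bs → pg (b ∷ bs)))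

  constC-pad : ∀ c es → constC c (es ∷ʳ 0) ≈ constC c es
  constC-pad c []           = refl
  constC-pad c (zero  ∷ es) = constC-pad c es
  constC-pad c (suc _ ∷ es) = refl

  constC-cong : ∀ {c d} → c ≈ d → ∀ es → constC c es ≈ constC d es
  constC-cong c≈d []           = c≈d
  constC-cong c≈d (zero  ∷ es) = constC-cong c≈d es
  constC-cong c≈d (suc _ ∷ es) = refl

  constC-0 : ∀ es → constC 0# es ≈ 0#
  constC-0 []           = refl
  constC-0 (zero  ∷ es) = constC-0 es
  constC-0 (suc _ ∷ es) = refl

  constC-+ : ∀ c d es → constC (c + d) es ≈ constC c es + constC d es
  constC-+ c d []           = refl
  constC-+ c d (zero  ∷ es) = constC-+ c d es
  constC-+ c d (suc _ ∷ es) = sym (+-identityˡ _)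

  constC-* : ∀ c d es → constC (c * d) es ≈ c * constC d es
  constC-* c d []           = refl
  constC-* c d (zero  ∷ es) = constC-* c d es
  constC-* c d (suc _ ∷ es) = sym (zeroʳ _)

  constC-neg : ∀ c es → constC (- c) es ≈ - constC c es
  constC-neg c []           = refl
  constC-neg c (zero  ∷ es) = constC-neg c es
  constC-neg c (suc _ ∷ es) = sym (RingProperties.-0#≈0# ring)

  varC-pad : ∀ j es → varC j (es ∷ʳ 0) ≈ varC j es
  varC-pad zero    []                 = refl
  varC-pad (suc j) []                 = refl
  varC-pad zero    (zero ∷ es)        = refl
  varC-pad zero    (suc zero ∷ es)    = constC-pad 1# es
  varC-pad zero    (suc (suc _) ∷ es) = refl
  varC-pad (suc j) (zero ∷ es)        = varC-pad j es
  varC-pad (suc j) (suc _ ∷ es)       = refl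

  const : Carrier → Series
  const c = series (constC c) (constC-pad c)

  var : ℕ → Series
  var j = series (varC j) (varC-pad j)

  powerSeriesRing : CommutativeRing 0ℓ 0ℓ
  powerSeriesRing = record
    { Carrier = Series
    ; _≈_     = _≋_
    ; _+_     = λ f g → series (addC (coeff f) (coeff g)) (λ es → +-cong (pad f es) (pad g es))
    ; _*_     = λ f g → series (mulC (coeff f) (coeff g)) (λ es → mulC-pad (coeff f) (coeff g) es (pad f) (pad g))
    ; -_      = λ f → series (λ es → - coeff f es) (λ es → -‿cong (pad f es))
    ; 0#      = series (λ _ → 0#) (λ _ → refl)
    ; 1#      = const 1#
    ; isCommutativeRing = record
      { isRing = record
        { +-isAbelianGroup = record
          { isGroup = record
            { isMonoid = record
              { isSemigroup = record
                { isMagma = record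
                  { isEquivalence = record
                    { refl  = λ _ → refl
                    ; sym   = λ p es → sym (p es)
                    ; trans = λ p q es → trans (p es) (q es)
                    }
                  ; ∙-cong = λ p q es → +-cong (p es) (q es)
                  }
                ; assoc = λ _ _ _ _ → +-assoc _ _ _
                }
              ; identity = (λ _ _ → +-identityˡ _) , (λ _ _ → +-identityʳ _)
              }
            ; inverse = (λ _ _ → -‿inverseˡ _) , (λ _ _ → -‿inverseʳ _)
            ; ⁻¹-cong = λ p es → -‿cong (p es)
            }
          ; comm = λ _ _ _ → +-comm _ _
          }
        ; *-cong     = mulC-cong
        ; *-assoc    = λ f g h → mulC-assoc (coeff f) (coeff g) (coeff h)
        ; *-identity = (λ f es → trans (mulC-constˡ _ _ es) (*-identityˡ _))
                     , (λ f es → trans (mulC-comm _ _ es) (trans (mulC-constˡ _ _ es) (*-identityˡ _)))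
        ; distrib    = (λ f g h → mulC-+ʳ (coeff f) (coeff g) (coeff h))
                     , (λ f g h → mulC-+ˡ (coeff g) (coeff h) (coeff f))
        }
      ; *-comm = λ f g → mulC-comm (coeff f) (coeff g)
      }
    }

  -- The exponents of x_j times a monomial.
  raise : ℕ → List ℕ → List ℕ
  raise zero    []       = 1 ∷ []
  raise zero    (e ∷ es) = suc e ∷ es
  raise (suc j) []       = 0 ∷ raise j []
  raise (suc j) (e ∷ es) = e ∷ raise j es

  exponent : ℕ → List ℕ → ℕ
  exponent _       []       = 0
  exponent zero    (e ∷ es) = e
  exponent (suc j) (e ∷ es) = exponent j es

  exponent-pad : ∀ j es → exponent j (es ∷ʳ 0) ≡ exponent j es
  exponent-pad zero    []       = ≡.refl
  exponent-pad (suc j) []       = ≡.refl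
  exponent-pad zero    (e ∷ es) = ≡.refl
  exponent-pad (suc j) (e ∷ es) = exponent-pad j es

  raise-pad : ∀ j es → raise j (es ∷ʳ 0) ≡ raise j es ⊎ raise j (es ∷ʳ 0) ≡ raise j es ∷ʳ 0
  raise-pad zero    []       = inj₁ ≡.refl
  raise-pad (suc j) []       = inj₁ ≡.refl
  raise-pad zero    (e ∷ es) = inj₂ ≡.refl
  raise-pad (suc j) (e ∷ es) with raise-pad j es
  ... | inj₁ eq = inj₁ (≡.cong (e ∷_) eq)
  ... | inj₂ eq = inj₂ (≡.cong (e ∷_) eq)

  ∂var : ℕ → Series → Series
  ∂var j f = series (λ es → suc (exponent j es) · coeff f (raise j es)) ∂-pad
    where
    raised : ∀ es → coeff f (raise j (es ∷ʳ 0)) ≈ coeff f (raise j es)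
    raised es with raise j (es ∷ʳ 0) | raise-pad j es
    ... | _ | inj₁ ≡.refl = refl
    ... | _ | inj₂ ≡.refl = pad f (raise j es)

    ∂-pad : ∀ es → suc (exponent j (es ∷ʳ 0)) · coeff f (raise j (es ∷ʳ 0)) ≈ suc (exponent j es) · coeff f (raise j es)
    ∂-pad es rewrite exponent-pad j es = ·-congʳ (suc (exponent j es)) (raised es)

  ∂var-cong : ∀ j f g → f ≋ g → ∂var j f ≋ ∂var j g
  ∂var-cong j f g f≋g es = ·-congʳ (suc (exponent j es)) (f≋g (raise j es))

module SymmetricFunctions (R : CommutativeRing 0ℓ 0ℓ) where

  open CommutativeRing R hiding (zero)
  open Antidiagonal R
  open PowerSeries R

  record SymmetricFunction : Set where
    field
      toSeries      : Series
      symmetric     : ∀ {es es′} → es ↭ es′ → coeff toSeries es ≈ coeff toSeries es′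
      boundedDegree : ∃ λ d → ∀ es → d < sum es → coeff toSeries es ≈ 0#

  open SymmetricFunction public

  mulC-symmetric : ∀ {f g} →
    (∀ {es es′} → es ↭ es′ → f es ≈ f es′) → (∀ {es es′} → es ↭ es′ → g es ≈ g es′) →
    ∀ {es es′} → es ↭ es′ → mulC f g es ≈ mulC f g es′
  mulC-symmetric fs gs ↭.refl         = refl
  mulC-symmetric fs gs (↭.prep e p)   =
    antidiagonal-cong e (λ a b _ → mulC-symmetric (λ q → fs (↭.prep a q)) (λ q → gs (↭.prep b q)) p)
  mulC-symmetric {f} {g} fs gs (↭.swap {xs = xs} d e p) =
    trans (antidiagonal-comm d e _)
      (antidiagonal-cong e (λ a b _ → antidiagonal-cong d (λ a′ b′ _ →
        trans (mulC-cong {f = λ as → f (a′ ∷ a ∷ as)} {g = λ bs → g (b′ ∷ b ∷ bs)}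
                 (λ _ → fs (↭.swap a′ a ↭.refl)) (λ _ → gs (↭.swap b′ b ↭.refl)) xs)
              (mulC-symmetric (λ q → fs (↭.prep a (↭.prep a′ q))) (λ q → gs (↭.prep b (↭.prep b′ q))) p))))
  mulC-symmetric fs gs (↭.trans p q)  = trans (mulC-symmetric fs gs p) (mulC-symmetric fs gs q)

  constC-symmetric : ∀ c {es es′} → es ↭ es′ → constC c es ≈ constC c es′
  constC-symmetric c ↭.refl                     = refl
  constC-symmetric c (↭.prep zero p)            = constC-symmetric c p
  constC-symmetric c (↭.prep (suc _) p)         = refl
  constC-symmetric c (↭.swap zero zero p)       = constC-symmetric c p
  constC-symmetric c (↭.swap zero (suc _) p)    = refl
  constC-symmetric c (↭.swap (suc _) zero p)    = refl
  constC-symmetric c (↭.swap (suc _) (suc _) p) = refl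
  constC-symmetric c (↭.trans p q)              = trans (constC-symmetric c p) (constC-symmetric c q)

  +-split-< : ∀ {d₁ d₂ i j} → d₁ ℕ.+ d₂ < i ℕ.+ j → d₁ < i ⊎ d₂ < j
  +-split-< {d₁} {d₂} {i} {j} p with d₁ ℕ.<? i | d₂ ℕ.<? j
  ... | yes q | _     = inj₁ q
  ... | no  _ | yes q = inj₂ q
  ... | no ¬q | no ¬r = contradiction p (ℕ.≤⇒≯ (ℕ.+-mono-≤ (ℕ.≮⇒≥ ¬q) (ℕ.≮⇒≥ ¬r)))

  mulC-bounded : ∀ {d₁ d₂} i j f g es →
    (∀ as → d₁ < i ℕ.+ sum as → f as ≈ 0#) → (∀ bs → d₂ < j ℕ.+ sum bs → g bs ≈ 0#) →
    d₁ ℕ.+ d₂ < (i ℕ.+ j) ℕ.+ sum es → mulC f g es ≈ 0#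
  mulC-bounded {d₁} {d₂} i j f g [] fb gb p
    with +-split-< {d₁} {d₂} {i} {j} (≡.subst (d₁ ℕ.+ d₂ <_) (ℕ.+-identityʳ (i ℕ.+ j)) p)
  ... | inj₁ q = trans (*-congʳ (fb [] (≡.subst (d₁ <_) (≡.sym (ℕ.+-identityʳ i)) q))) (zeroˡ _)
  ... | inj₂ q = trans (*-congˡ (gb [] (≡.subst (d₂ <_) (≡.sym (ℕ.+-identityʳ j)) q))) (zeroʳ _)
  mulC-bounded {d₁} {d₂} i j f g (e ∷ es) fb gb p =
    trans (antidiagonal-cong e (λ a b a+b≡e →
        mulC-bounded (i ℕ.+ a) (j ℕ.+ b) _ _ es
          (λ as q → fb (a ∷ as) (≡.subst (d₁ <_) (ℕ.+-assoc i a (sum as)) q))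
          (λ bs q → gb (b ∷ bs) (≡.subst (d₂ <_) (ℕ.+-assoc j b (sum bs)) q))
          (≡.subst (d₁ ℕ.+ d₂ <_) (regroup a b a+b≡e) p)))
      (antidiagonal-0 e)
    where
    open CommutativeSemigroupProperties ℕ.+-commutativeSemigroup using (interchange)
    regroup : ∀ a b → a ℕ.+ b ≡ e → (i ℕ.+ j) ℕ.+ (e ℕ.+ sum es) ≡ ((i ℕ.+ a) ℕ.+ (j ℕ.+ b)) ℕ.+ sum es
    regroup a b ≡.refl = ≡.trans (≡.sym (ℕ.+-assoc (i ℕ.+ j) (a ℕ.+ b) (sum es)))
                                 (≡.cong (ℕ._+ sum es) (interchange i j a b))

  constC-bounded : ∀ c es → 0 < sum es → constC c es ≈ 0#
  constC-bounded c (zero  ∷ es) p = constC-bounded c es p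
  constC-bounded c (suc _ ∷ es) p = refl

  open CommutativeRing powerSeriesRing using ()
    renaming (_+_ to _+ˢ_; _*_ to _*ˢ_; -_ to -ˢ_; 0# to 0ˢ; isCommutativeRing to isCommutativeRingˢ; refl to ≋-refl; trans to ≋-trans; sym to ≋-sym; rawRing to rawRingˢ)

  constant : Carrier → SymmetricFunction
  constant c = record
    { toSeries      = const c
    ; symmetric     = constC-symmetric c
    ; boundedDegree = 0 , constC-bounded c
    }

  symmetricFunctionRing : CommutativeRing 0ℓ 0ℓ
  symmetricFunctionRing = record
    { Carrier = SymmetricFunction
    ; _≈_     = λ f g → toSeries f ≋ toSeries g
    ; _+_     = λ f g → record
      { toSeries      = toSeries f +ˢ toSeries g
      ; symmetric     = λ p → +-cong (symmetric f p) (symmetric g p)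
      ; boundedDegree = let d₁ , fb = boundedDegree f ; d₂ , gb = boundedDegree g in
          d₁ ℕ.⊔ d₂ , λ es p → trans (+-cong (fb es (ℕ.≤-<-trans (ℕ.m≤m⊔n d₁ d₂) p)) (gb es (ℕ.≤-<-trans (ℕ.m≤n⊔m d₁ d₂) p)))
                                     (+-identityˡ 0#)
      }
    ; _*_     = λ f g → record
      { toSeries      = toSeries f *ˢ toSeries g
      ; symmetric     = mulC-symmetric (symmetric f) (symmetric g)
      ; boundedDegree = let d₁ , fb = boundedDegree f ; d₂ , gb = boundedDegree g in
          d₁ ℕ.+ d₂ , λ es p → mulC-bounded 0 0 _ _ es fb gb p
      }
    ; -_      = λ f → record
      { toSeries      = -ˢ toSeries f
      ; symmetric     = λ p → -‿cong (symmetric f p)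
      ; boundedDegree = let d , fb = boundedDegree f in
          d , λ es p → trans (-‿cong (fb es p)) (RingProperties.-0#≈0# ring)
      }
    ; 0#      = record { toSeries = 0ˢ ; symmetric = λ _ → refl ; boundedDegree = 0 , λ _ _ → refl }
    ; 1#      = constant 1#
    ; isCommutativeRing = RingMonomorphism.isCommutativeRing monomorphism isCommutativeRingˢ
    }
    where
    monomorphism : RingMorphisms.IsRingMonomorphism _ rawRingˢ toSeries
    monomorphism = record
      { isRingHomomorphism = record
        { isSemiringHomomorphism = record
          { isNearSemiringHomomorphism = record
            { +-isMonoidHomomorphism = record
              { isMagmaHomomorphism = record
                { isRelHomomorphism = record { cong = id }
                ; homo = λ _ _ _ → refl
                }
              ; ε-homo = λ _ → refl
              }
            ; *-homo = λ _ _ _ → refl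
            }
          ; 1#-homo = λ _ → refl
          }
        ; -‿homo = λ _ _ → refl
        }
      ; injective = id
      }

  -- With k = j + 1: p_k(x₀, x₁, …) = x₀^k + p_k(x₁, x₂, …).
  powerSumC : ℕ → Coefficients
  powerSumC j []           = 0#
  powerSumC j (zero  ∷ es) = powerSumC j es
  powerSumC j (suc e ∷ es) = if e ℕ.≡ᵇ j then constC 1# es else 0#

  powerSumC-pad : ∀ j es → powerSumC j (es ∷ʳ 0) ≈ powerSumC j es
  powerSumC-pad j []           = refl
  powerSumC-pad j (zero  ∷ es) = powerSumC-pad j es
  powerSumC-pad j (suc e ∷ es) with e ℕ.≡ᵇ j
  ... | true  = constC-pad 1# es
  ... | false = refl

  powerSumC-symmetric : ∀ j {es es′} → es ↭ es′ → powerSumC j es ≈ powerSumC j es′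
  powerSumC-symmetric j ↭.refl             = refl
  powerSumC-symmetric j (↭.prep zero p)    = powerSumC-symmetric j p
  powerSumC-symmetric j (↭.prep (suc e) p) with e ℕ.≡ᵇ j
  ... | true  = constC-symmetric 1# p
  ... | false = refl
  powerSumC-symmetric j (↭.swap zero zero p)    = powerSumC-symmetric j p
  powerSumC-symmetric j (↭.swap zero (suc e) p) with e ℕ.≡ᵇ j
  ... | true  = constC-symmetric 1# p
  ... | false = refl
  powerSumC-symmetric j (↭.swap (suc d) zero p) with d ℕ.≡ᵇ j
  ... | true  = constC-symmetric 1# p
  ... | false = refl
  powerSumC-symmetric j (↭.swap (suc d) (suc e) p) with d ℕ.≡ᵇ j | e ℕ.≡ᵇ j
  ... | true  | true  = refl
  ... | true  | false = refl
  ... | false | true  = refl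
  ... | false | false = refl
  powerSumC-symmetric j (↭.trans p q)      = trans (powerSumC-symmetric j p) (powerSumC-symmetric j q)

  powerSumC-bounded : ∀ j es → suc j < sum es → powerSumC j es ≈ 0#
  powerSumC-bounded j (zero  ∷ es) p = powerSumC-bounded j es p
  powerSumC-bounded j (suc e ∷ es) p with e ℕ.≡ᵇ j in eq
  ... | false = refl
  ... | true  with ℕ.≡ᵇ⇒≡ e j (≡.subst T (≡.sym eq) tt)
  ...   | ≡.refl = constC-bounded 1# es
          (ℕ.+-cancelˡ-< (suc e) 0 (sum es) (≡.subst (_< suc e ℕ.+ sum es) (≡.sym (ℕ.+-identityʳ (suc e))) p))

  powerSum : ℕ → SymmetricFunction
  powerSum j = record
    { toSeries      = series (powerSumC j) (powerSumC-pad j)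
    ; symmetric     = powerSumC-symmetric j
    ; boundedDegree = suc j , powerSumC-bounded j
    }

  open CommutativeRing symmetricFunctionRing using () renaming (Carrier to Λ)
  module ΛA = Antidiagonal symmetricFunctionRing
  module Λ = CommutativeRing symmetricFunctionRing

  slice : ℕ → Λ → Λ
  slice n f = record
    { toSeries      = series (λ es → coeff (toSeries f) (n ∷ es)) (λ es → pad (toSeries f) (n ∷ es))
    ; symmetric     = λ p → symmetric f (↭.prep n p)
    ; boundedDegree = let d , fb = boundedDegree f in d , λ es p → fb (n ∷ es) (ℕ.≤-trans p (ℕ.m≤n+m (sum es) n))
    }

  slice-0 : ∀ f → slice 0 f Λ.≈ f
  slice-0 f es = trans (symmetric f (∷↭∷ʳ 0 es)) (pad (toSeries f) es)

  coeff-antidiagonal : ∀ n (h : ℕ → ℕ → Λ) es →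
    coeff (toSeries (ΛA.antidiagonal n h)) es ≈ antidiagonal n (λ a b → coeff (toSeries (h a b)) es)
  coeff-antidiagonal zero    h es = refl
  coeff-antidiagonal (suc n) h es = +-congˡ (coeff-antidiagonal n _ es)

  slice-* : ∀ n f g → slice n (f Λ.* g) Λ.≈ ΛA.antidiagonal n (λ a b → slice a f Λ.* slice b g)
  slice-* n f g es = sym (coeff-antidiagonal n (λ a b → slice a f Λ.* slice b g) es)

-- Given the operators s n = hₙ^⊥, the operators D n = p_{n+1}^⊥ obtained
-- from Newton's identities are derivations.
module Newton (L : CommutativeRing 0ℓ 0ℓ) where

  open CommutativeRing L hiding (zero)
  open Antidiagonal L

  module Operators
    (s : ℕ → Carrier → Carrier)
    (s-cong : ∀ n {f g} → f ≈ g → s n f ≈ s n g)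
    (s-+ : ∀ n f g → s n (f + g) ≈ s n f + s n g)
    (s-0 : ∀ f → s 0 f ≈ f)
    (s-* : ∀ n f g → s n (f * g) ≈ antidiagonal n (λ a b → s a f * s b g))
    where

    open SetoidReasoning setoid
    open SemiringMult semiring using (×-homo-+; ×-congʳ; ×-assoc-*; ×-comm-*) renaming (_×_ to infixr 8 _⋆_)
    open CommutativeMonoidMult +-commutativeMonoid using (×-distrib-+)
    open CommutativeSemigroupProperties +-commutativeSemigroup using (interchange)
    open AbelianGroupProperties +-abelianGroup using (⁻¹-∙-comm)
    open GroupProperties +-group using (∙-cancelˡ; identityʳ-unique)

    D : ℕ → Carrier → Carrier
    P : ℕ → ℕ → Carrier → Carrier

    D n f = suc n ⋆ s (suc n) f - P n 1 f

    P zero    r f = 0#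
    P (suc n) r f = P n (suc r) f + D n (s r f)

    D-cong : ∀ n {f g} → f ≈ g → D n f ≈ D n g
    P-cong : ∀ n r {f g} → f ≈ g → P n r f ≈ P n r g
    D-cong n eq = +-cong (×-congʳ (suc n) (s-cong (suc n) eq)) (-‿cong (P-cong n 1 eq))
    P-cong zero    r eq = refl
    P-cong (suc n) r eq = +-cong (P-cong n (suc r) eq) (D-cong n (s-cong r eq))

    D-+ : ∀ n f g → D n (f + g) ≈ D n f + D n g
    P-+ : ∀ n r f g → P n r (f + g) ≈ P n r f + P n r g
    D-+ n f g = begin
      suc n ⋆ s (suc n) (f + g) - P n 1 (f + g)
        ≈⟨ +-cong (trans (×-congʳ (suc n) (s-+ (suc n) f g)) (×-distrib-+ _ _ (suc n)))
                  (trans (-‿cong (P-+ n 1 f g)) (sym (⁻¹-∙-comm _ _))) ⟩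
      (suc n ⋆ s (suc n) f + suc n ⋆ s (suc n) g) + (- P n 1 f + - P n 1 g)
        ≈⟨ interchange _ _ _ _ ⟩
      D n f + D n g ∎
    P-+ zero    r f g = sym (+-identityˡ 0#)
    P-+ (suc n) r f g = trans
      (+-cong (P-+ n (suc r) f g) (trans (D-cong n (s-+ r f g)) (D-+ n _ _)))
      (interchange _ _ _ _)

    D-0 : ∀ n → D n 0# ≈ 0#
    D-0 n = identityʳ-unique (D n 0#) (D n 0#) (trans (sym (D-+ n 0# 0#)) (D-cong n (+-identityˡ 0#)))

    D-antidiagonal : ∀ n m h → D n (antidiagonal m h) ≈ antidiagonal m (λ a b → D n (h a b))
    D-antidiagonal n zero    h = refl
    D-antidiagonal n (suc m) h = trans (D-+ n _ _) (+-congˡ (D-antidiagonal n m _))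

    P-antidiagonal : ∀ n r f → P (suc n) r f ≈ antidiagonal n (λ i a → D i (s (r ℕ.+ a) f))
    P-antidiagonal zero    r f = trans (+-identityˡ _) (reflexive (≡.cong (λ a → D 0 (s a f)) (≡.sym (ℕ.+-identityʳ r))))
    P-antidiagonal (suc n) r f = begin
      P (suc n) (suc r) f + D (suc n) (s r f)
        ≈⟨ +-cong (P-antidiagonal n (suc r) f) (reflexive (≡.cong (λ a → D (suc n) (s a f)) (≡.sym (ℕ.+-identityʳ r)))) ⟩
      antidiagonal n (λ i a → D i (s (suc r ℕ.+ a) f)) + D (suc n) (s (r ℕ.+ 0) f)
        ≈⟨ +-congʳ (antidiagonal-cong n (λ i a _ → reflexive (≡.cong (λ b → D i (s b f)) (≡.sym (ℕ.+-suc r a))))) ⟩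
      antidiagonal n (λ i a → D i (s (r ℕ.+ suc a) f)) + D (suc n) (s (r ℕ.+ 0) f)
        ≈⟨ antidiagonal-last n (λ i a → D i (s (r ℕ.+ a) f)) ⟨
      antidiagonal (suc n) (λ i a → D i (s (r ℕ.+ a) f)) ∎

    newton : ∀ n f → antidiagonal n (λ i a → D i (s a f)) ≈ suc n ⋆ s (suc n) f
    newton n f = begin
      antidiagonal n (λ i a → D i (s a f))       ≈⟨ P-antidiagonal n 0 f ⟨
      P n 1 f + D n (s 0 f)                      ≈⟨ +-congˡ (D-cong n (s-0 f)) ⟩
      P n 1 f + (suc n ⋆ s (suc n) f - P n 1 f)  ≈⟨ +-comm _ _ ⟩
      (suc n ⋆ s (suc n) f - P n 1 f) + P n 1 f  ≈⟨ +-assoc _ _ _ ⟩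
      suc n ⋆ s (suc n) f + (- P n 1 f + P n 1 f) ≈⟨ +-congˡ (-‿inverseˡ _) ⟩
      suc n ⋆ s (suc n) f + 0#                   ≈⟨ +-identityʳ _ ⟩
      suc n ⋆ s (suc n) f                        ∎

    weighted : ∀ n (h : ℕ → ℕ → Carrier) →
      antidiagonal n (λ a b → suc a ⋆ h (suc a) b) + antidiagonal n (λ a b → suc b ⋆ h a (suc b)) ≈
      suc n ⋆ antidiagonal (suc n) h
    weighted n h = begin
      antidiagonal n (λ a b → suc a ⋆ h (suc a) b) + antidiagonal n (λ a b → suc b ⋆ h a (suc b))
        ≈⟨ +-cong (+-identityˡ _) (+-identityʳ _) ⟨
      antidiagonal (suc n) (λ a b → a ⋆ h a b) + (antidiagonal n (λ a b → suc b ⋆ h a (suc b)) + 0#)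
        ≈⟨ +-congˡ (antidiagonal-last n (λ a b → b ⋆ h a b)) ⟨
      antidiagonal (suc n) (λ a b → a ⋆ h a b) + antidiagonal (suc n) (λ a b → b ⋆ h a b)
        ≈⟨ antidiagonal-+ (suc n) (λ a b → a ⋆ h a b) (λ a b → b ⋆ h a b) ⟨
      antidiagonal (suc n) (λ a b → a ⋆ h a b + b ⋆ h a b)
        ≈⟨ antidiagonal-cong (suc n) (λ a b eq → trans (sym (×-homo-+ (h a b) a b)) (reflexive (≡.cong (_⋆ h a b) eq))) ⟩
      antidiagonal (suc n) (λ a b → suc n ⋆ h a b)
        ≈⟨ antidiagonal-× (suc n) (suc n) h ⟨
      suc n ⋆ antidiagonal (suc n) h ∎
      where
      antidiagonal-× : ∀ m k h → k ⋆ antidiagonal m h ≈ antidiagonal m (λ a b → k ⋆ h a b)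
      antidiagonal-× zero    k h = refl
      antidiagonal-× (suc m) k h = trans (×-distrib-+ _ _ k) (+-congˡ (antidiagonal-× m k _))

    Leibniz : ℕ → Carrier → Carrier → Carrier
    Leibniz n f g = D n f * g + f * D n g

    newton-Leibniz : ∀ n f g →
      antidiagonal n (λ i a → antidiagonal a (λ c d → Leibniz i (s c f) (s d g))) ≈ suc n ⋆ s (suc n) (f * g)
    newton-Leibniz n f g = begin
      antidiagonal n (λ i a → antidiagonal a (λ c d → Leibniz i (s c f) (s d g)))
        ≈⟨ antidiagonal-cong n (λ i a _ → antidiagonal-+ a _ _) ⟩
      antidiagonal n (λ i a → antidiagonal a (λ c d → D i (s c f) * s d g) + antidiagonal a (λ c d → s c f * D i (s d g)))
        ≈⟨ antidiagonal-+ n _ _ ⟩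
      antidiagonal n (λ i a → antidiagonal a (λ c d → D i (s c f) * s d g)) +
      antidiagonal n (λ i a → antidiagonal a (λ c d → s c f * D i (s d g)))
        ≈⟨ +-cong left right ⟩
      antidiagonal n (λ a b → suc a ⋆ (s (suc a) f * s b g)) + antidiagonal n (λ a b → suc b ⋆ (s a f * s (suc b) g))
        ≈⟨ weighted n (λ a b → s a f * s b g) ⟩
      suc n ⋆ antidiagonal (suc n) (λ a b → s a f * s b g)
        ≈⟨ ×-congʳ (suc n) (s-* (suc n) f g) ⟨
      suc n ⋆ s (suc n) (f * g) ∎
      where
      antidiagonal-*ʳ : ∀ n h x → antidiagonal n h * x ≈ antidiagonal n (λ a b → h a b * x)
      antidiagonal-*ʳ n h x = trans (*-comm _ x) (trans (antidiagonal-*ˡ n x h) (antidiagonal-cong n (λ _ _ _ → *-comm x _)))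

      left : antidiagonal n (λ i a → antidiagonal a (λ c d → D i (s c f) * s d g)) ≈
             antidiagonal n (λ a b → suc a ⋆ (s (suc a) f * s b g))
      left = begin
        antidiagonal n (λ i a → antidiagonal a (λ c d → D i (s c f) * s d g))
          ≈⟨ antidiagonal-assoc n (λ i c d → D i (s c f) * s d g) ⟨
        antidiagonal n (λ a d → antidiagonal a (λ i c → D i (s c f) * s d g))
          ≈⟨ antidiagonal-cong n (λ a d _ → antidiagonal-*ʳ a (λ i c → D i (s c f)) (s d g)) ⟨
        antidiagonal n (λ a d → antidiagonal a (λ i c → D i (s c f)) * s d g)
          ≈⟨ antidiagonal-cong n (λ a d _ → trans (*-congʳ (newton a f)) (×-assoc-* (suc a) _ _)) ⟩
        antidiagonal n (λ a b → suc a ⋆ (s (suc a) f * s b g)) ∎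

      right : antidiagonal n (λ i a → antidiagonal a (λ c d → s c f * D i (s d g))) ≈
              antidiagonal n (λ a b → suc b ⋆ (s a f * s (suc b) g))
      right = begin
        antidiagonal n (λ i a → antidiagonal a (λ c d → s c f * D i (s d g)))
          ≈⟨ antidiagonal-cong n (λ i a _ → antidiagonal-flip a _) ⟩
        antidiagonal n (λ i a → antidiagonal a (λ d c → s c f * D i (s d g)))
          ≈⟨ antidiagonal-assoc n (λ i d c → s c f * D i (s d g)) ⟨
        antidiagonal n (λ b c → antidiagonal b (λ i d → s c f * D i (s d g)))
          ≈⟨ antidiagonal-cong n (λ b c _ → antidiagonal-*ˡ b (s c f) (λ i d → D i (s d g))) ⟨
        antidiagonal n (λ b c → s c f * antidiagonal b (λ i d → D i (s d g)))
          ≈⟨ antidiagonal-cong n (λ b c _ → trans (*-congˡ (newton b g)) (×-comm-* (suc b) _ _)) ⟩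
        antidiagonal n (λ b c → suc b ⋆ (s c f * s (suc b) g))
          ≈⟨ antidiagonal-flip n _ ⟩
        antidiagonal n (λ a b → suc b ⋆ (s a f * s (suc b) g)) ∎

    Leibniz-cong : ∀ n {f f′ g g′} → f ≈ f′ → g ≈ g′ → Leibniz n f g ≈ Leibniz n f′ g′
    Leibniz-cong n p q = +-cong (*-cong (D-cong n p) q) (*-cong p (D-cong n q))

    leibniz : ∀ n f g → D n (f * g) ≈ Leibniz n f g
    leibniz = <-rec _ λ n rec f g → trans (D-cong n (sym (s-0 (f * g)))) (trans (step n rec f g) (Leibniz-cong n (s-0 f) (s-0 g)))
      where
      step : ∀ n → (∀ {i} → i < n → ∀ f g → D i (f * g) ≈ Leibniz i f g) →
             ∀ f g → D n (s 0 (f * g)) ≈ Leibniz n (s 0 f) (s 0 g)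
      step zero    rec f g = trans (newton 0 (f * g)) (sym (newton-Leibniz 0 f g))
      step (suc n) rec f g = ∙-cancelˡ (antidiagonal n (λ i a → D i (s (suc a) (f * g)))) _ _ (begin
        antidiagonal n (λ i a → D i (s (suc a) (f * g))) + D (suc n) (s 0 (f * g))
          ≈⟨ antidiagonal-last n (λ i a → D i (s a (f * g))) ⟨
        antidiagonal (suc n) (λ i a → D i (s a (f * g)))
          ≈⟨ trans (newton (suc n) (f * g)) (sym (newton-Leibniz (suc n) f g)) ⟩
        antidiagonal (suc n) (λ i a → antidiagonal a (λ c d → Leibniz i (s c f) (s d g)))
          ≈⟨ antidiagonal-last n (λ i a → antidiagonal a (λ c d → Leibniz i (s c f) (s d g))) ⟩
        antidiagonal n (λ i a → antidiagonal (suc a) (λ c d → Leibniz i (s c f) (s d g))) + Leibniz (suc n) (s 0 f) (s 0 g)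
          ≈⟨ +-congʳ (antidiagonal-cong n (λ i a eq → trans (D-cong i (s-* (suc a) f g))
               (trans (D-antidiagonal i (suc a) (λ c d → s c f * s d g))
                 (antidiagonal-cong (suc a) (λ c d _ → rec (≡.subst (i <_) (≡.cong suc eq) (ℕ.s≤s (ℕ.m≤m+n i a))) (s c f) (s d g)))))) ⟨
        antidiagonal n (λ i a → D i (s (suc a) (f * g))) + Leibniz (suc n) (s 0 f) (s 0 g) ∎)

    D-leading : ∀ f → (∀ i a → D i (s (suc a) f) ≈ 0#) → ∀ n → D n f ≈ suc n ⋆ s (suc n) f
    D-leading f Ds≈0 n = begin
      suc n ⋆ s (suc n) f - P n 1 f ≈⟨ +-congˡ (-‿cong (P-0 n 0)) ⟩
      suc n ⋆ s (suc n) f - 0#      ≈⟨ +-congˡ (RingProperties.-0#≈0# ring) ⟩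
      suc n ⋆ s (suc n) f + 0#      ≈⟨ +-identityʳ _ ⟩
      suc n ⋆ s (suc n) f           ∎
      where
      P-0 : ∀ n r → P n (suc r) f ≈ 0#
      P-0 zero    r = refl
      P-0 (suc n) r = trans (+-cong (P-0 n (suc r)) (Ds≈0 n r)) (+-identityˡ 0#)

powerSeries : ℚ-Algebra → ℚ-Algebra
powerSeries A = record
  { commutativeRing = powerSeriesRing
  ; ι               = λ q → const (A.ι q)
  ; ι-homo          = ringHomomorphism ℚ-ring powerSeriesRing (λ q → const (A.ι q))
      (λ { ≡.refl es → A.refl })
      (λ p q es → A.trans (constC-cong (A.ι-+ p q) es) (constC-+ (A.ι p) (A.ι q) es))
      (λ p q es → A.trans (constC-cong (A.ι-* p q) es)
        (A.trans (constC-* (A.ι p) (A.ι q) es) (A.sym (mulC-constˡ (A.ι p) _ es))))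
      (constC-cong A.ι-1)
  }
  where
  module A = ℚ-Algebra A
  open PowerSeries A.commutativeRing

open SymmetricFunctions ℚ-ring using (symmetricFunctionRing; constant; powerSum; slice; slice-0; slice-*; toSeries)
open PowerSeries ℚ-ring using (coeff)

symmetricFunctions : ℚ-Algebra
symmetricFunctions = record
  { commutativeRing = symmetricFunctionRing
  ; ι               = constant
  ; ι-homo          = ringHomomorphism ℚ-ring symmetricFunctionRing constant
      (λ { ≡.refl es → ≡.refl }) ι-+ ι-* ι-1
  }
  where open ℚ-Algebra (powerSeries rationals) using (ι-+; ι-*; ι-1)

module TensorProduct (A B : ℚ-Algebra) where

  module A = ℚ-Algebra A
  module B = ℚ-Algebra B

  infix  4 _∼_
  infixl 6 _⊕_
  infixl 7 _⊛_
  infix  8 _⊗_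
  infix  8 ⊖_

  data Tensor : Set where
    _⊗_ : A.Carrier → B.Carrier → Tensor
    𝟘   : Tensor
    _⊕_ : Tensor → Tensor → Tensor
    ⊖_  : Tensor → Tensor

  data _∼_ : Tensor → Tensor → Set where
    ∼-refl      : ∀ {x} → x ∼ x
    ∼-sym       : ∀ {x y} → x ∼ y → y ∼ x
    ∼-trans     : ∀ {x y z} → x ∼ y → y ∼ z → x ∼ z
    ⊗-cong      : ∀ {a a′ b b′} → a A.≈ a′ → b B.≈ b′ → a ⊗ b ∼ a′ ⊗ b′
    ⊕-cong      : ∀ {x x′ y y′} → x ∼ x′ → y ∼ y′ → x ⊕ y ∼ x′ ⊕ y′
    ⊖-cong      : ∀ {x x′} → x ∼ x′ → ⊖ x ∼ ⊖ x′
    ⊕-assoc     : ∀ x y z → (x ⊕ y) ⊕ z ∼ x ⊕ (y ⊕ z)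
    ⊕-comm      : ∀ x y → x ⊕ y ∼ y ⊕ x
    ⊕-identityˡ : ∀ x → 𝟘 ⊕ x ∼ x
    ⊖-inverseˡ  : ∀ x → ⊖ x ⊕ x ∼ 𝟘
    ⊗-+ˡ        : ∀ a a′ b → (a A.+ a′) ⊗ b ∼ a ⊗ b ⊕ a′ ⊗ b
    ⊗-+ʳ        : ∀ a b b′ → a ⊗ (b B.+ b′) ∼ a ⊗ b ⊕ a ⊗ b′
    ⊗-balanced  : ∀ q a b → (q A.· a) ⊗ b ∼ a ⊗ (q B.· b)

  -- scaleBy a b x is the product (a ⊗ b) x.
  scaleBy : A.Carrier → B.Carrier → Tensor → Tensor
  scaleBy a b (c ⊗ d) = (a A.* c) ⊗ (b B.* d)
  scaleBy a b 𝟘       = 𝟘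
  scaleBy a b (x ⊕ y) = scaleBy a b x ⊕ scaleBy a b y
  scaleBy a b (⊖ x)   = ⊖ scaleBy a b x

  _⊛_ : Tensor → Tensor → Tensor
  (a ⊗ b) ⊛ y = scaleBy a b y
  𝟘       ⊛ y = 𝟘
  (x ⊕ z) ⊛ y = (x ⊛ y) ⊕ (z ⊛ y)
  (⊖ x)   ⊛ y = ⊖ (x ⊛ y)

  tensorGroup : AbelianGroup 0ℓ 0ℓ
  tensorGroup = record
    { Carrier = Tensor
    ; _≈_     = _∼_
    ; _∙_     = _⊕_
    ; ε       = 𝟘
    ; _⁻¹     = ⊖_
    ; isAbelianGroup = record
      { isGroup = record
        { isMonoid = record
          { isSemigroup = record
            { isMagma = record
              { isEquivalence = record { refl = ∼-refl ; sym = ∼-sym ; trans = ∼-trans }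
              ; ∙-cong = ⊕-cong
              }
            ; assoc = ⊕-assoc
            }
          ; identity = ⊕-identityˡ , λ x → ∼-trans (⊕-comm x 𝟘) (⊕-identityˡ x)
          }
        ; inverse = ⊖-inverseˡ , λ x → ∼-trans (⊕-comm x (⊖ x)) (⊖-inverseˡ x)
        ; ⁻¹-cong = ⊖-cong
        }
      ; comm = ⊕-comm
      }
    }

  open AbelianGroup tensorGroup using (setoid; commutativeSemigroup; group; isAbelianGroup)
  open CommutativeSemigroupProperties commutativeSemigroup using (interchange)
  open AbelianGroupProperties tensorGroup using (⁻¹-∙-comm)
  open GroupProperties group using (ε⁻¹≈ε; inverseˡ-unique)
  open SetoidReasoning setoid

  scaleBy-cong : ∀ {a a′ b b′} → a A.≈ a′ → b B.≈ b′ → ∀ y → scaleBy a b y ∼ scaleBy a′ b′ y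
  scaleBy-cong p q (c ⊗ d) = ⊗-cong (A.*-congʳ p) (B.*-congʳ q)
  scaleBy-cong p q 𝟘       = ∼-refl
  scaleBy-cong p q (x ⊕ y) = ⊕-cong (scaleBy-cong p q x) (scaleBy-cong p q y)
  scaleBy-cong p q (⊖ x)   = ⊖-cong (scaleBy-cong p q x)

  scaleBy-∼ : ∀ a b {x y} → x ∼ y → scaleBy a b x ∼ scaleBy a b y
  scaleBy-∼ a b ∼-refl              = ∼-refl
  scaleBy-∼ a b (∼-sym p)           = ∼-sym (scaleBy-∼ a b p)
  scaleBy-∼ a b (∼-trans p q)       = ∼-trans (scaleBy-∼ a b p) (scaleBy-∼ a b q)
  scaleBy-∼ a b (⊗-cong p q)        = ⊗-cong (A.*-congˡ p) (B.*-congˡ q)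
  scaleBy-∼ a b (⊕-cong p q)        = ⊕-cong (scaleBy-∼ a b p) (scaleBy-∼ a b q)
  scaleBy-∼ a b (⊖-cong p)          = ⊖-cong (scaleBy-∼ a b p)
  scaleBy-∼ a b (⊕-assoc x y z)     = ⊕-assoc _ _ _
  scaleBy-∼ a b (⊕-comm x y)        = ⊕-comm _ _
  scaleBy-∼ a b (⊕-identityˡ x)     = ⊕-identityˡ _
  scaleBy-∼ a b (⊖-inverseˡ x)      = ⊖-inverseˡ _
  scaleBy-∼ a b (⊗-+ˡ c c′ d)       = ∼-trans (⊗-cong (A.distribˡ a c c′) B.refl) (⊗-+ˡ _ _ _)
  scaleBy-∼ a b (⊗-+ʳ c d d′)       = ∼-trans (⊗-cong A.refl (B.distribˡ b d d′)) (⊗-+ʳ _ _ _)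
  scaleBy-∼ a b (⊗-balanced q c d)  = begin
    (a A.* (q A.· c)) ⊗ (b B.* d) ≈⟨ ⊗-cong (x∙yz≈y∙xzᴬ a (A.ι q) c) B.refl ⟩
    (q A.· (a A.* c)) ⊗ (b B.* d) ≈⟨ ⊗-balanced q _ _ ⟩
    (a A.* c) ⊗ (q B.· (b B.* d)) ≈⟨ ⊗-cong A.refl (x∙yz≈y∙xzᴮ (B.ι q) b d) ⟩
    (a A.* c) ⊗ (b B.* (q B.· d)) ∎
    where
    open CommutativeSemigroupProperties A.*-commutativeSemigroup using () renaming (x∙yz≈y∙xz to x∙yz≈y∙xzᴬ)
    open CommutativeSemigroupProperties B.*-commutativeSemigroup using () renaming (x∙yz≈y∙xz to x∙yz≈y∙xzᴮ)

  scaleBy-+ˡ : ∀ a a′ b y → scaleBy (a A.+ a′) b y ∼ scaleBy a b y ⊕ scaleBy a′ b y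
  scaleBy-+ˡ a a′ b (c ⊗ d) = ∼-trans (⊗-cong (A.distribʳ c a a′) B.refl) (⊗-+ˡ _ _ _)
  scaleBy-+ˡ a a′ b 𝟘       = ∼-sym (⊕-identityˡ 𝟘)
  scaleBy-+ˡ a a′ b (x ⊕ y) = ∼-trans (⊕-cong (scaleBy-+ˡ a a′ b x) (scaleBy-+ˡ a a′ b y)) (interchange _ _ _ _)
  scaleBy-+ˡ a a′ b (⊖ x)   = ∼-trans (⊖-cong (scaleBy-+ˡ a a′ b x)) (∼-sym (⁻¹-∙-comm _ _))

  scaleBy-+ʳ : ∀ a b b′ y → scaleBy a (b B.+ b′) y ∼ scaleBy a b y ⊕ scaleBy a b′ y
  scaleBy-+ʳ a b b′ (c ⊗ d) = ∼-trans (⊗-cong A.refl (B.distribʳ d b b′)) (⊗-+ʳ _ _ _)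
  scaleBy-+ʳ a b b′ 𝟘       = ∼-sym (⊕-identityˡ 𝟘)
  scaleBy-+ʳ a b b′ (x ⊕ y) = ∼-trans (⊕-cong (scaleBy-+ʳ a b b′ x) (scaleBy-+ʳ a b b′ y)) (interchange _ _ _ _)
  scaleBy-+ʳ a b b′ (⊖ x)   = ∼-trans (⊖-cong (scaleBy-+ʳ a b b′ x)) (∼-sym (⁻¹-∙-comm _ _))

  scaleBy-balanced : ∀ q a b y → scaleBy (q A.· a) b y ∼ scaleBy a (q B.· b) y
  scaleBy-balanced q a b (c ⊗ d) = begin
    ((q A.· a) A.* c) ⊗ (b B.* d) ≈⟨ ⊗-cong (A.*-assoc (A.ι q) a c) B.refl ⟩
    (q A.· (a A.* c)) ⊗ (b B.* d) ≈⟨ ⊗-balanced q _ _ ⟩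
    (a A.* c) ⊗ (q B.· (b B.* d)) ≈⟨ ⊗-cong A.refl (B.*-assoc (B.ι q) b d) ⟨
    (a A.* c) ⊗ ((q B.· b) B.* d) ∎
  scaleBy-balanced q a b 𝟘       = ∼-refl
  scaleBy-balanced q a b (x ⊕ y) = ⊕-cong (scaleBy-balanced q a b x) (scaleBy-balanced q a b y)
  scaleBy-balanced q a b (⊖ x)   = ⊖-cong (scaleBy-balanced q a b x)

  ⊛-congʳ : ∀ {x x′} → x ∼ x′ → ∀ y → x ⊛ y ∼ x′ ⊛ y
  ⊛-congʳ ∼-refl             y = ∼-refl
  ⊛-congʳ (∼-sym p)          y = ∼-sym (⊛-congʳ p y)
  ⊛-congʳ (∼-trans p q)      y = ∼-trans (⊛-congʳ p y) (⊛-congʳ q y)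
  ⊛-congʳ (⊗-cong p q)       y = scaleBy-cong p q y
  ⊛-congʳ (⊕-cong p q)       y = ⊕-cong (⊛-congʳ p y) (⊛-congʳ q y)
  ⊛-congʳ (⊖-cong p)         y = ⊖-cong (⊛-congʳ p y)
  ⊛-congʳ (⊕-assoc _ _ _)    y = ⊕-assoc _ _ _
  ⊛-congʳ (⊕-comm _ _)       y = ⊕-comm _ _
  ⊛-congʳ (⊕-identityˡ _)    y = ⊕-identityˡ _
  ⊛-congʳ (⊖-inverseˡ _)     y = ⊖-inverseˡ _
  ⊛-congʳ (⊗-+ˡ a a′ b)      y = scaleBy-+ˡ a a′ b y
  ⊛-congʳ (⊗-+ʳ a b b′)      y = scaleBy-+ʳ a b b′ y
  ⊛-congʳ (⊗-balanced q a b) y = scaleBy-balanced q a b y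

  ⊛-congˡ : ∀ x {y y′} → y ∼ y′ → x ⊛ y ∼ x ⊛ y′
  ⊛-congˡ (a ⊗ b) p = scaleBy-∼ a b p
  ⊛-congˡ 𝟘       p = ∼-refl
  ⊛-congˡ (x ⊕ z) p = ⊕-cong (⊛-congˡ x p) (⊛-congˡ z p)
  ⊛-congˡ (⊖ x)   p = ⊖-cong (⊛-congˡ x p)

  ⊛-distribˡ : ∀ x y z → x ⊛ (y ⊕ z) ∼ (x ⊛ y) ⊕ (x ⊛ z)
  ⊛-distribˡ (a ⊗ b) y z = ∼-refl
  ⊛-distribˡ 𝟘       y z = ∼-sym (⊕-identityˡ 𝟘)
  ⊛-distribˡ (x ⊕ w) y z = ∼-trans (⊕-cong (⊛-distribˡ x y z) (⊛-distribˡ w y z)) (interchange _ _ _ _)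
  ⊛-distribˡ (⊖ x)   y z = ∼-trans (⊖-cong (⊛-distribˡ x y z)) (∼-sym (⁻¹-∙-comm _ _))

  ⊛-zeroʳ : ∀ x → x ⊛ 𝟘 ∼ 𝟘
  ⊛-zeroʳ (a ⊗ b) = ∼-refl
  ⊛-zeroʳ 𝟘       = ∼-refl
  ⊛-zeroʳ (x ⊕ y) = ∼-trans (⊕-cong (⊛-zeroʳ x) (⊛-zeroʳ y)) (⊕-identityˡ 𝟘)
  ⊛-zeroʳ (⊖ x)   = ∼-trans (⊖-cong (⊛-zeroʳ x)) ε⁻¹≈ε

  ⊛-negʳ : ∀ x y → x ⊛ (⊖ y) ∼ ⊖ (x ⊛ y)
  ⊛-negʳ x y = inverseˡ-unique _ _
    (∼-trans (∼-sym (⊛-distribˡ x (⊖ y) y)) (∼-trans (⊛-congˡ x (⊖-inverseˡ y)) (⊛-zeroʳ x)))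

  scaleBy-comm : ∀ a b y → scaleBy a b y ∼ y ⊛ (a ⊗ b)
  scaleBy-comm a b (c ⊗ d) = ⊗-cong (A.*-comm a c) (B.*-comm b d)
  scaleBy-comm a b 𝟘       = ∼-refl
  scaleBy-comm a b (x ⊕ y) = ⊕-cong (scaleBy-comm a b x) (scaleBy-comm a b y)
  scaleBy-comm a b (⊖ x)   = ⊖-cong (scaleBy-comm a b x)

  ⊛-comm : ∀ x y → x ⊛ y ∼ y ⊛ x
  ⊛-comm (a ⊗ b) y = scaleBy-comm a b y
  ⊛-comm 𝟘       y = ∼-sym (⊛-zeroʳ y)
  ⊛-comm (x ⊕ z) y = ∼-trans (⊕-cong (⊛-comm x y) (⊛-comm z y)) (∼-sym (⊛-distribˡ y x z))
  ⊛-comm (⊖ x)   y = ∼-trans (⊖-cong (⊛-comm x y)) (∼-sym (⊛-negʳ y x))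

  scaleBy-* : ∀ a b c d z → scaleBy (a A.* c) (b B.* d) z ∼ scaleBy a b (scaleBy c d z)
  scaleBy-* a b c d (e ⊗ f) = ⊗-cong (A.*-assoc a c e) (B.*-assoc b d f)
  scaleBy-* a b c d 𝟘       = ∼-refl
  scaleBy-* a b c d (x ⊕ y) = ⊕-cong (scaleBy-* a b c d x) (scaleBy-* a b c d y)
  scaleBy-* a b c d (⊖ x)   = ⊖-cong (scaleBy-* a b c d x)

  scaleBy-assoc : ∀ a b y z → scaleBy a b y ⊛ z ∼ scaleBy a b (y ⊛ z)
  scaleBy-assoc a b (c ⊗ d) z = scaleBy-* a b c d z
  scaleBy-assoc a b 𝟘       z = ∼-refl
  scaleBy-assoc a b (x ⊕ y) z = ⊕-cong (scaleBy-assoc a b x z) (scaleBy-assoc a b y z)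
  scaleBy-assoc a b (⊖ x)   z = ⊖-cong (scaleBy-assoc a b x z)

  ⊛-assoc : ∀ x y z → (x ⊛ y) ⊛ z ∼ x ⊛ (y ⊛ z)
  ⊛-assoc (a ⊗ b) y z = scaleBy-assoc a b y z
  ⊛-assoc 𝟘       y z = ∼-refl
  ⊛-assoc (x ⊕ w) y z = ⊕-cong (⊛-assoc x y z) (⊛-assoc w y z)
  ⊛-assoc (⊖ x)   y z = ⊖-cong (⊛-assoc x y z)

  ⊛-identityˡ : ∀ y → (A.1# ⊗ B.1#) ⊛ y ∼ y
  ⊛-identityˡ (c ⊗ d) = ⊗-cong (A.*-identityˡ c) (B.*-identityˡ d)
  ⊛-identityˡ 𝟘       = ∼-refl
  ⊛-identityˡ (x ⊕ y) = ⊕-cong (⊛-identityˡ x) (⊛-identityˡ y)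
  ⊛-identityˡ (⊖ x)   = ⊖-cong (⊛-identityˡ x)

  tensorRing : CommutativeRing 0ℓ 0ℓ
  tensorRing = record
    { Carrier = Tensor
    ; _≈_     = _∼_
    ; _+_     = _⊕_
    ; _*_     = _⊛_
    ; -_      = ⊖_
    ; 0#      = 𝟘
    ; 1#      = A.1# ⊗ B.1#
    ; isCommutativeRing = record
      { isRing = record
        { +-isAbelianGroup = isAbelianGroup
        ; *-cong     = λ {x} {x′} {y} {y′} p q → ∼-trans (⊛-congʳ p y) (⊛-congˡ x′ q)
        ; *-assoc    = ⊛-assoc
        ; *-identity = ⊛-identityˡ , λ x → ∼-trans (⊛-comm x _) (⊛-identityˡ x)
        ; distrib    = ⊛-distribˡ , λ x y z → ∼-refl
        }
      ; *-comm = ⊛-comm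
      }
    }

  tensorProduct : ℚ-Algebra
  tensorProduct = record
    { commutativeRing = tensorRing
    ; ι               = λ q → A.ι q ⊗ B.1#
    ; ι-homo          = ringHomomorphism ℚ-ring tensorRing (λ q → A.ι q ⊗ B.1#)
        (λ { ≡.refl → ∼-refl })
        (λ p q → ∼-trans (⊗-cong (A.ι-+ p q) B.refl) (⊗-+ˡ _ _ _))
        (λ p q → ⊗-cong (A.ι-* p q) (B.sym (B.*-identityˡ B.1#)))
        (⊗-cong A.ι-1 B.refl)
    }

record IsDerivation (A : ℚ-Algebra) (d : ℚ-Algebra.Carrier A → ℚ-Algebra.Carrier A) : Set where
  open ℚ-Algebra A
  field
    d-cong  : ∀ {x y} → x ≈ y → d x ≈ d y
    d-+     : ∀ x y → d (x + y) ≈ d x + d y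
    d-·     : ∀ q x → d (q · x) ≈ q · d x
    leibniz : ∀ x y → d (x * y) ≈ d x * y + x * d y

-- The derivations ∂/∂p_k and ∂/∂p̃_k (k = i + 1).  If A is the polynomial
-- algebra in the p_k and p̃_k, there is exactly one such family.
record PartialDerivatives (A : ℚ-Algebra) (p p̃ : ℕ → ℚ-Algebra.Carrier A) : Set where
  open ℚ-Algebra A
  field
    ∂p ∂p̃       : ℕ → Carrier → Carrier
    ∂p-derivation : ∀ i → IsDerivation A (∂p i)
    ∂p̃-derivation : ∀ i → IsDerivation A (∂p̃ i)
    ∂p-p        : ∀ i j → ∂p i (p j) ≈ (if i ℕ.≡ᵇ j then 1# else 0#)
    ∂p-p̃        : ∀ i j → ∂p i (p̃ j) ≈ 0#
    ∂p̃-p        : ∀ i j → ∂p̃ i (p j) ≈ 0#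
    ∂p̃-p̃        : ∀ i j → ∂p̃ i (p̃ j) ≈ (if i ℕ.≡ᵇ j then 1# else 0#)

module NewtonDerivations (A : ℚ-Algebra) where

  open ℚ-Algebra A
  open Antidiagonal commutativeRing

  module Operators
    (s : ℕ → Carrier → Carrier)
    (s-cong : ∀ n {f g} → f ≈ g → s n f ≈ s n g)
    (s-+ : ∀ n f g → s n (f + g) ≈ s n f + s n g)
    (s-0 : ∀ f → s 0 f ≈ f)
    (s-* : ∀ n f g → s n (f * g) ≈ antidiagonal n (λ a b → s a f * s b g))
    (s-ι : ∀ n q → s (suc n) (ι q) ≈ 0#)
    (p : ℕ → Carrier)
    (s-p : ∀ n j → s (suc n) (p j) ≈ (if n ℕ.≡ᵇ j then 1# else 0#))
    where

    open Newton.Operators commutativeRing s s-cong s-+ s-0 s-*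
    open SemiringMult semiring using (×-congʳ) renaming (_×_ to infixr 8 _⋆_)
    open SetoidReasoning setoid

    fromℕ : ℕ → ℚ
    fromℕ zero    = 0ℚ
    fromℕ (suc k) = 1ℚ ℚ.+ fromℕ k

    fromℕ-nonNegative : ∀ k → ℚ.NonNegative (fromℕ k)
    fromℕ-nonNegative zero    = _
    fromℕ-nonNegative (suc k) = ℚ.pos⇒nonNeg (fromℕ (suc k)) {{ℚ.pos+nonNeg⇒pos 1ℚ (fromℕ k) {{fromℕ-nonNegative k}}}}

    fromℕ-nonZero : ∀ k → ℚ.NonZero (fromℕ (suc k))
    fromℕ-nonZero k = ℚ.pos⇒nonZero (fromℕ (suc k)) {{ℚ.pos+nonNeg⇒pos 1ℚ (fromℕ k) {{fromℕ-nonNegative k}}}}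

    1/suc : ℕ → ℚ
    1/suc n = (ℚ.1/ fromℕ (suc n)) {{fromℕ-nonZero n}}

    ∂ : ℕ → Carrier → Carrier
    ∂ n f = 1/suc n · D n f

    ⋆-0 : ∀ k → k ⋆ 0# ≈ 0#
    ⋆-0 zero    = refl
    ⋆-0 (suc k) = trans (+-identityˡ _) (⋆-0 k)

    D-ι : ∀ n q → D n (ι q) ≈ 0#
    D-ι n q = trans
      (D-leading (ι q) (λ i a → trans (D-cong i (s-ι a q)) (D-0 i)) n)
      (trans (×-congʳ (suc n) (s-ι n q)) (⋆-0 (suc n)))

    D-p : ∀ n j → D n (p j) ≈ suc n ⋆ (if n ℕ.≡ᵇ j then 1# else 0#)
    D-p n j = trans (D-leading (p j) (λ i a → trans (D-cong i (s-p a j)) (D-if i (a ℕ.≡ᵇ j))) n) (×-congʳ (suc n) (s-p n j))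
      where
      D-if : ∀ i b → D i (if b then 1# else 0#) ≈ 0#
      D-if i true  = trans (D-cong i (sym ι-1)) (D-ι i 1ℚ)
      D-if i false = D-0 i

    reciprocal : ∀ n x → 1/suc n · (suc n ⋆ x) ≈ x
    reciprocal n x = begin
      r · (suc n ⋆ x)               ≈⟨ *-congˡ (fromℕ-⋆ (suc n) x) ⟨
      r · (fromℕ (suc n) · x)       ≈⟨ *-assoc _ _ _ ⟨
      (ι r * ι (fromℕ (suc n))) * x ≈⟨ *-congʳ (ι-* r (fromℕ (suc n))) ⟨
      (r ℚ.* fromℕ (suc n)) · x     ≈⟨ reflexive (≡.cong (_· x) (ℚ.*-inverseˡ (fromℕ (suc n)) {{fromℕ-nonZero n}})) ⟩
      1ℚ · x                        ≈⟨ *-congʳ ι-1 ⟩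
      1# * x                        ≈⟨ *-identityˡ x ⟩
      x                             ∎
      where
      r : ℚ
      r = 1/suc n

      fromℕ-⋆ : ∀ k x → fromℕ k · x ≈ k ⋆ x
      fromℕ-⋆ zero    x = trans (*-congʳ ι-0) (zeroˡ x)
      fromℕ-⋆ (suc k) x = trans (*-congʳ (ι-+ 1ℚ (fromℕ k))) (trans (distribʳ x _ _) (+-cong (trans (*-congʳ ι-1) (*-identityˡ x)) (fromℕ-⋆ k x)))

    ∂-derivation : ∀ n → IsDerivation A (∂ n)
    ∂-derivation n = record
      { d-cong  = λ eq → *-congˡ (D-cong n eq)
      ; d-+     = λ f g → trans (*-congˡ (D-+ n f g)) (distribˡ _ _ _)
      ; d-·     = λ q f → trans (*-congˡ (D-· q f)) (x∙yz≈y∙xz _ _ _)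
      ; leibniz = λ f g → trans (*-congˡ (leibniz n f g)) (trans (distribˡ _ _ _)
                    (+-cong (sym (*-assoc _ _ _)) (x∙yz≈y∙xz _ _ _)))
      }
      where
      open CommutativeSemigroupProperties *-commutativeSemigroup using (x∙yz≈y∙xz)
      D-· : ∀ q f → D n (q · f) ≈ q · D n f
      D-· q f = trans (leibniz n (ι q) f) (trans (+-congʳ (trans (*-congʳ (D-ι n q)) (zeroˡ f))) (+-identityˡ _))

    ∂-p : ∀ n j → ∂ n (p j) ≈ (if n ℕ.≡ᵇ j then 1# else 0#)
    ∂-p n j = trans (*-congˡ (D-p n j)) (reciprocal n _)

derivation-1 : ∀ A {d} → IsDerivation A d → let open ℚ-Algebra A in d 1# ≈ 0#
derivation-1 A {d} δ = identityʳ-unique (d 1#) (d 1#) (begin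
  d 1# + d 1#           ≈⟨ +-cong (*-identityʳ (d 1#)) (*-identityˡ (d 1#)) ⟨
  d 1# * 1# + 1# * d 1# ≈⟨ leibniz 1# 1# ⟨
  d (1# * 1#)           ≈⟨ d-cong (*-identityˡ 1#) ⟩
  d 1#                  ∎)
  where
  open ℚ-Algebra A
  open IsDerivation δ
  open GroupProperties +-group using (identityʳ-unique)
  open SetoidReasoning setoid

module TensorDerivations (A B : ℚ-Algebra) where
  open TensorProduct A B
  open ℚ-Algebra tensorProduct using (setoid; +-commutativeSemigroup; +-abelianGroup; +-group; _·_; *-cong; +-cong; distribˡ; distribʳ; +-identityʳ)
  open CommutativeSemigroupProperties +-commutativeSemigroup using (interchange)
  open AbelianGroupProperties +-abelianGroup using (⁻¹-∙-comm)
  open GroupProperties +-group using (ε⁻¹≈ε; identityʳ-unique)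
  open SetoidReasoning setoid

  ι⊗-· : ∀ q a b → q · (a ⊗ b) ∼ (q A.· a) ⊗ b
  ι⊗-· q a b = ⊗-cong A.refl (B.*-identityˡ b)

  ι⊗-·′ : ∀ q a b → q · (a ⊗ b) ∼ a ⊗ (q B.· b)
  ι⊗-·′ q a b = ∼-trans (ι⊗-· q a b) (⊗-balanced q a b)

  module Extend
    (d : A.Carrier → B.Carrier → Tensor)
    (d-cong : ∀ {a a′ b b′} → a A.≈ a′ → b B.≈ b′ → d a b ∼ d a′ b′)
    (d-+ˡ : ∀ a a′ b → d (a A.+ a′) b ∼ d a b ⊕ d a′ b)
    (d-+ʳ : ∀ a b b′ → d a (b B.+ b′) ∼ d a b ⊕ d a b′)
    (d-·ˡ : ∀ q a b → d (q A.· a) b ∼ q · d a b)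
    (d-·ʳ : ∀ q a b → d a (q B.· b) ∼ q · d a b)
    (d-* : ∀ a b a′ b′ → d (a A.* a′) (b B.* b′) ∼ (d a b ⊛ a′ ⊗ b′) ⊕ (a ⊗ b ⊛ d a′ b′))
    where

    extend⊗ : Tensor → Tensor
    extend⊗ (a ⊗ b) = d a b
    extend⊗ 𝟘       = 𝟘
    extend⊗ (x ⊕ y) = extend⊗ x ⊕ extend⊗ y
    extend⊗ (⊖ x)   = ⊖ extend⊗ x

    extend⊗-cong : ∀ {x y} → x ∼ y → extend⊗ x ∼ extend⊗ y
    extend⊗-cong ∼-refl             = ∼-refl
    extend⊗-cong (∼-sym p)          = ∼-sym (extend⊗-cong p)
    extend⊗-cong (∼-trans p q)      = ∼-trans (extend⊗-cong p) (extend⊗-cong q)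
    extend⊗-cong (⊗-cong p q)       = d-cong p q
    extend⊗-cong (⊕-cong p q)       = ⊕-cong (extend⊗-cong p) (extend⊗-cong q)
    extend⊗-cong (⊖-cong p)         = ⊖-cong (extend⊗-cong p)
    extend⊗-cong (⊕-assoc _ _ _)    = ⊕-assoc _ _ _
    extend⊗-cong (⊕-comm _ _)       = ⊕-comm _ _
    extend⊗-cong (⊕-identityˡ _)    = ⊕-identityˡ _
    extend⊗-cong (⊖-inverseˡ _)     = ⊖-inverseˡ _
    extend⊗-cong (⊗-+ˡ a a′ b)      = d-+ˡ a a′ b
    extend⊗-cong (⊗-+ʳ a b b′)      = d-+ʳ a b b′
    extend⊗-cong (⊗-balanced q a b) = ∼-trans (d-·ˡ q a b) (∼-sym (d-·ʳ q a b))

    extend⊗-· : ∀ q x → extend⊗ (q · x) ∼ q · extend⊗ x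
    extend⊗-· q (a ⊗ b) = ∼-trans (d-cong A.refl (B.*-identityˡ b)) (d-·ˡ q a b)
    extend⊗-· q 𝟘       = ∼-refl
    extend⊗-· q (x ⊕ y) = ⊕-cong (extend⊗-· q x) (extend⊗-· q y)
    extend⊗-· q (⊖ x)   = ⊖-cong (extend⊗-· q x)

    leibniz : ∀ x y → extend⊗ (x ⊛ y) ∼ (extend⊗ x ⊛ y) ⊕ (x ⊛ extend⊗ y)
    leibniz (a ⊗ b) (c ⊗ e) = d-* a b c e
    leibniz (a ⊗ b) 𝟘       = ∼-sym (∼-trans (+-identityʳ (d a b ⊛ 𝟘)) (⊛-zeroʳ (d a b)))
    leibniz (a ⊗ b) (x ⊕ y) = ∼-trans (⊕-cong (leibniz (a ⊗ b) x) (leibniz (a ⊗ b) y))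
      (∼-trans (interchange _ _ _ _) (⊕-cong (∼-sym (⊛-distribˡ (d a b) x y)) ∼-refl))
    leibniz (a ⊗ b) (⊖ x)   = ∼-trans (⊖-cong (leibniz (a ⊗ b) x))
      (∼-trans (∼-sym (⁻¹-∙-comm _ _)) (⊕-cong (∼-sym (⊛-negʳ (d a b) x)) ∼-refl))
    leibniz 𝟘       y = ∼-sym (⊕-identityˡ 𝟘)
    leibniz (x ⊕ z) y = ∼-trans (⊕-cong (leibniz x y) (leibniz z y)) (interchange _ _ _ _)
    leibniz (⊖ x)   y = ∼-trans (⊖-cong (leibniz x y)) (∼-sym (⁻¹-∙-comm _ _))

    isDerivation : IsDerivation tensorProduct extend⊗
    isDerivation = record
      { d-cong = extend⊗-cong ; d-+ = λ _ _ → ∼-refl ; d-· = extend⊗-· ; leibniz = leibniz }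

  module Left {d : A.Carrier → A.Carrier} (δ : IsDerivation A d) where
    open IsDerivation δ
    open Extend (λ a b → d a ⊗ b)
      (λ p q → ⊗-cong (d-cong p) q)
      (λ a a′ b → ∼-trans (⊗-cong (d-+ a a′) B.refl) (⊗-+ˡ _ _ _))
      (λ a b b′ → ⊗-+ʳ _ _ _)
      (λ q a b → ∼-trans (⊗-cong (d-· q a) B.refl) (∼-sym (ι⊗-· q (d a) b)))
      (λ q a b → ∼-sym (ι⊗-·′ q (d a) b))
      (λ a b a′ b′ → ∼-trans (⊗-cong (leibniz a a′) B.refl) (⊗-+ˡ _ _ _))
      public using (extend⊗; isDerivation)

  module Right {d : B.Carrier → B.Carrier} (δ : IsDerivation B d) where
    open IsDerivation δ
    open Extend (λ a b → a ⊗ d b)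
      (λ p q → ⊗-cong p (d-cong q))
      (λ a a′ b → ⊗-+ˡ _ _ _)
      (λ a b b′ → ∼-trans (⊗-cong A.refl (d-+ b b′)) (⊗-+ʳ _ _ _))
      (λ q a b → ∼-sym (ι⊗-· q a (d b)))
      (λ q a b → ∼-trans (⊗-cong A.refl (d-· q b)) (∼-sym (ι⊗-·′ q a (d b))))
      (λ a b a′ b′ → ∼-trans (⊗-cong A.refl (leibniz b b′)) (⊗-+ʳ _ _ _))
      public using (extend⊗; isDerivation)

  ⊗-zeroˡ : ∀ b → A.0# ⊗ b ∼ 𝟘
  ⊗-zeroˡ b = identityʳ-unique _ _ (∼-trans (∼-sym (⊗-+ˡ A.0# A.0# b)) (⊗-cong (A.+-identityˡ A.0#) B.refl))

  ⊗-zeroʳ : ∀ a → a ⊗ B.0# ∼ 𝟘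
  ⊗-zeroʳ a = identityʳ-unique _ _ (∼-trans (∼-sym (⊗-+ʳ a B.0# B.0#)) (⊗-cong A.refl (B.+-identityˡ B.0#)))

  tensorPartialDerivatives : (p : ℕ → A.Carrier) (q : ℕ → B.Carrier)
    (dᴬ : ℕ → A.Carrier → A.Carrier) (dᴮ : ℕ → B.Carrier → B.Carrier) →
    (∀ i → IsDerivation A (dᴬ i)) → (∀ i j → dᴬ i (p j) A.≈ (if i ℕ.≡ᵇ j then A.1# else A.0#)) →
    (∀ i → IsDerivation B (dᴮ i)) → (∀ i j → dᴮ i (q j) B.≈ (if i ℕ.≡ᵇ j then B.1# else B.0#)) →
    PartialDerivatives tensorProduct (λ j → p j ⊗ B.1#) (λ j → A.1# ⊗ q j)
  tensorPartialDerivatives p q dᴬ dᴮ δᴬ δᴬ-p δᴮ δᴮ-q = record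
    { ∂p            = λ i → Left.extend⊗ (δᴬ i)
    ; ∂p̃            = λ i → Right.extend⊗ (δᴮ i)
    ; ∂p-derivation = λ i → Left.isDerivation (δᴬ i)
    ; ∂p̃-derivation = λ i → Right.isDerivation (δᴮ i)
    ; ∂p-p          = λ i j → ∼-trans (⊗-cong (δᴬ-p i j) B.refl) (ifˡ (i ℕ.≡ᵇ j))
    ; ∂p-p̃          = λ i j → ∼-trans (⊗-cong (derivation-1 A (δᴬ i)) B.refl) (⊗-zeroˡ (q j))
    ; ∂p̃-p          = λ i j → ∼-trans (⊗-cong A.refl (derivation-1 B (δᴮ i))) (⊗-zeroʳ (p j))
    ; ∂p̃-p̃          = λ i j → ∼-trans (⊗-cong A.refl (δᴮ-q i j)) (ifʳ (i ℕ.≡ᵇ j))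
    }
    where
    ifˡ : ∀ b → (if b then A.1# else A.0#) ⊗ B.1# ∼ (if b then A.1# ⊗ B.1# else 𝟘)
    ifˡ true  = ∼-refl
    ifˡ false = ⊗-zeroˡ B.1#
    ifʳ : ∀ b → A.1# ⊗ (if b then B.1# else B.0#) ∼ (if b then A.1# ⊗ B.1# else 𝟘)
    ifʳ true  = ∼-refl
    ifʳ false = ⊗-zeroʳ A.1#

infix 8 _/!_
_/!_ : ℕ → ℕ → ℚ
c /! i = (+ c ℚ./ i !) {{i ℕ.!≢0}}

laguerre : (A : ℚ-Algebra) → let open ℚ-Algebra A in ℕ → ℕ → Carrier → Carrier
laguerre A n α t = ∑[ i ≤ n ] (((n ℕ.+ α) C (n ∸ toℕ i)) /! toℕ i · (- t) ^ toℕ i)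
  where open ℚ-Algebra A

-- p j and p̃ j stand for p_k and p̃_k with k = j + 1.
module BD-polynomial (A : ℚ-Algebra) (p p̃ : ℕ → ℚ-Algebra.Carrier A) where

  open ℚ-Algebra A

  -- F j a b is the factor for k = j + 1, when π and ρ have a and b k-cycles.
  F : ℕ → ℕ → ℕ → Carrier
  F j a b with b ℕ.≤? a
  ... | yes _ = (+ (suc j ℕ.^ b ℕ.* b !) ℚ./ 1) · (laguerre A b (a ∸ b) (- ((+ 1 ℚ./ suc j) · (p j * p̃ j))) * p j ^ (a ∸ b))
  ... | no  _ = (+ (suc j ℕ.^ a ℕ.* a !) ℚ./ 1) · (laguerre A a (b ∸ a) (- ((+ 1 ℚ./ suc j) · (p j * p̃ j))) * p̃ j ^ (b ∸ a))

  -- A k-cycle of π or ρ has k ≤ m + n, so F is 1 at all larger k.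
  BD : Partition → Partition → Carrier
  BD λ′ μ = (1 /! m) · ∑[ x < m ! ] ((1 /! n) · ∑[ y < n ! ]
      ((χ λ′ (perm m x) ℚ.* χ μ (perm n y)) ·
        ∏[ j < m ℕ.+ n ] F (toℕ j) (cycles (perm m x) (suc (toℕ j))) (cycles (perm n y) (suc (toℕ j)))))
    where
    m n : ℕ
    m = ∣ λ′ ∣
    n = ∣ μ ∣

module Δ (A : ℚ-Algebra) (∂p ∂p̃ : ℕ → ℚ-Algebra.Carrier A → ℚ-Algebra.Carrier A) where

  open ℚ-Algebra A

  Δ-factor : ℕ → ℕ → Carrier → Carrier
  Δ-factor I j f = ∑[ i ≤ I ] ((suc j ℕ.^ toℕ i) /! toℕ i · iterate (∂p j ∘ ∂p̃ j) f (toℕ i))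

  Δ-truncated : ℕ → ℕ → Carrier → Carrier
  Δ-truncated zero    I f = f
  Δ-truncated (suc K) I f = Δ-factor I K (Δ-truncated K I f)

  -- Δ f = g.  Only finitely many terms of the product of sums contribute:
  -- all sufficiently long truncations have the same value g.
  infix 4 Δ_≐_
  Δ_≐_ : Carrier → Carrier → Set
  Δ f ≐ g = ∃ λ N → ∀ K I → N ≤ K → N ≤ I → Δ-truncated K I f ≈ g

-- ℚ[[p₁, p₂, …, p̃₁, p̃₂, …]], as the power series in the p̃ₖ over ℚ[[p₁, p₂, …]].
V : ℚ-Algebra
V = powerSeries (powerSeries rationals)

module V where
  module Inner = PowerSeries ℚ-ring
  module Outer = PowerSeries Inner.powerSeriesRing

  open ℚ-Algebra V public using (Carrier; _*_)

  p p̃ : ℕ → Carrier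
  p j = Outer.const (Inner.var j)
  p̃ j = Outer.var j

  ∂p ∂p̃ : ℕ → Carrier → Carrier
  ∂p j f = Outer.series (λ es → Inner.∂var j (Outer.coeff f es))
    (λ es → Inner.∂var-cong j (Outer.coeff f (es ∷ʳ 0)) (Outer.coeff f es) (Outer.pad f es))
  ∂p̃ = Outer.∂var

  open BD-polynomial V p p̃ public using (BD)
  open Δ V ∂p ∂p̃ public

Λ⟨X,Y⟩ : ℚ-Algebra
Λ⟨X,Y⟩ = TensorProduct.tensorProduct symmetricFunctions symmetricFunctions

module Λ⟨X,Y⟩ where
  open TensorProduct symmetricFunctions symmetricFunctions using (_⊗_)
  open ℚ-Algebra symmetricFunctions using (1#)
  open ℚ-Algebra Λ⟨X,Y⟩ public using (Carrier; _*_)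

  𝐩 𝐩̃ : ℕ → Carrier
  𝐩 j = powerSum j ⊗ 1#
  𝐩̃ j = 1# ⊗ powerSum j

  open BD-polynomial Λ⟨X,Y⟩ 𝐩 𝐩̃ public using (BD)

  infix 4 Δ[_]_≐_
  Δ[_]_≐_ : PartialDerivatives Λ⟨X,Y⟩ 𝐩 𝐩̃ → Carrier → Carrier → Set
  Δ[ ∂ ] f ≐ g = Δ f ≐ g
    where open Δ Λ⟨X,Y⟩ (PartialDerivatives.∂p ∂) (PartialDerivatives.∂p̃ ∂)

  partialDerivatives : PartialDerivatives Λ⟨X,Y⟩ 𝐩 𝐩̃
  partialDerivatives = tensorPartialDerivatives powerSum powerSum ∂ ∂ ∂-derivation ∂-p ∂-derivation ∂-p
    where
    open TensorDerivations symmetricFunctions symmetricFunctions using (tensorPartialDerivatives)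

    slice-powerSum : ∀ n j es → coeff (toSeries (slice (suc n) (powerSum j))) es ≡
                                coeff (toSeries (if n ℕ.≡ᵇ j then constant 1ℚ else ℚ-Algebra.0# symmetricFunctions)) es
    slice-powerSum n j es with n ℕ.≡ᵇ j
    ... | true  = ≡.refl
    ... | false = ≡.refl

    open NewtonDerivations.Operators symmetricFunctions slice (λ n eq es → eq (n ∷ es)) (λ n f g es → ≡.refl)
      slice-0 slice-* (λ n q es → ≡.refl) powerSum slice-powerSum using (∂; ∂-derivation; ∂-p)

{-# OPTIONS --safe #-}

-- Only the action of the derivations on the p_k and p̃_k matters, in any ℚ-algebra.  As BD^{λ∅} is a
-- combination of products ∏ p_k^{π(k)} and BD^{∅μ} one of ∏ p̃_k^{ρ(k)}, by
-- linearity of Δ it is enough to compute Δ(∏_k p_k^{a_k} p̃_k^{b_k}).  The k-th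
-- factor of Δ only sees the k-th factor of this product, since all the others are
-- constants for ∂_{p_k} and ∂_{p̃_k}, and
--   ∑ᵢ (k^i / i!) (∂_p ∂_p̃)^i p^a p̃^b = F_k(a, b)
-- is the expansion of the Laguerre polynomial, read backwards (i ↦ min(a, b) - i).
module Submission where

open import Defs
open import Data.Product.Base using (_×_)

open import Algebra.Bundles using (CommutativeRing)
import Algebra.Properties.CommutativeMonoid.Mult as CommutativeMonoidMult
import Algebra.Properties.CommutativeSemigroup as CommutativeSemigroupProperties
import Algebra.Properties.CommutativeSemiring.Exp as CommutativeSemiringExp
import Algebra.Properties.Group as GroupProperties
import Algebra.Properties.Ring as RingProperties
import Algebra.Properties.Semiring.Exp as SemiringExp
import Algebra.Properties.Semiring.Mult as SemiringMult
import Algebra.Properties.Semiring.Sum as SemiringSum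
import Algebra.Solver.Ring.NaturalCoefficients.Default as NaturalCoefficients
open import Data.Bool.Base as Bool using (Bool; true; false; if_then_else_)
open import Data.Empty using (⊥-elim)
open import Data.Fin.Base as Fin using (Fin; zero; suc; toℕ; fromℕ<)
open import Data.Fin.Permutation using (Permutation′; _⟨$⟩ʳ_)
import Data.Fin.Properties as Fin
open import Data.Integer.Base as ℤ using (+_)
import Data.Integer.Properties as ℤ
open import Data.List.Base as List using ([]; _∷_; _∷ʳ_)
import Data.List.Properties as List
import Data.List.Relation.Unary.All as All
open import Data.Nat.Base as ℕ using (ℕ; zero; suc; _<_; _≤_; _∸_; _!)
open import Data.Nat.Combinatorics using (_C_; nCk≡n!/k![n-k]!; k![n∸k]!∣n!)
import Data.Nat.DivMod as ℕ
open import Data.Nat.GeneralisedArithmetic using (iterate)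
import Data.Nat.Properties as ℕ
open import Data.Product.Base using (∃; _,_)
open import Data.Rational.Base as ℚ using (ℚ; 1ℚ)
import Data.Rational.Properties as ℚ
import Data.Rational.Unnormalised.Base as ℚᵘ
import Data.Rational.Unnormalised.Properties as ℚᵘ
open import Data.Unit.Base using (tt)
open import Function.Base using (_∘_)
open import Function.Bundles using (Injection)
open import Function.Definitions using (Injective)
open import Function.Properties.Inverse using (↔⇒↣)
open import Level using (0ℓ)
import Relation.Binary.Reasoning.Setoid as SetoidReasoning
open import Relation.Binary.PropositionalEquality as ≡ using (_≡_; _≢_)
open import Relation.Nullary using (¬_; yes; no)

-- Cycle numbers and rational scalars

-- Δ is not multiplicative, and on all of `V` its infinite sums have no value, so the computation
-- runs on the truncations `Δ-truncated K I`, which act on every element and are linear over the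
-- elements killed by the derivations involved. This linearity replaces "depends on the other
-- variables only", which has no meaning in an algebra known only through derivations. The factors
-- of Δ act one after another, so the induction carries a cofactor c that collects the factors not
-- yet reached. For one k, let b ≤ a, α = a - b and i + s = b. Then (∂_p ∂_p̃)^i p^(b+α) p̃^b =
-- (b+α)!/(s+α)! · b!/s! · p^(s+α) p̃^s, where (b+α)!/((s+α)! i!) is the binomial coefficient at
-- degree s of the Laguerre polynomial, and the remaining k^i b!/s! is k^b b! (1/k)^s / s!. That
-- F_k(a, 0) and F_k(0, b) are plain powers is the case min(a, b) = 0 of the same identity, where
-- only i = 0 survives.

module _ {X : Set} (f : X → X) where

  iterate-+ : ∀ x m n → iterate f x (m ℕ.+ n) ≡ iterate f (iterate f x m) n
  iterate-+ x zero    n = ≡.refl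
  iterate-+ x (suc m) n = iterate-+ (f x) m n

  iterate-injective : Injective _≡_ _≡_ f → ∀ n {x y} → iterate f x n ≡ iterate f y n → x ≡ y
  iterate-injective inj zero    eq = eq
  iterate-injective inj (suc n) eq = inj (iterate-injective inj n eq)

-- By pigeonhole two of the m + 1 iterates with exponents 0, ..., m agree, say at a < b. Injectivity
-- cancels the first a steps, which leaves the return time b - a ≤ m.
iterate-returns : ∀ {m} (π : Permutation′ m) i → ∃ λ d → suc d ≤ m × iterate (π ⟨$⟩ʳ_) i (suc d) ≡ i
iterate-returns {m} π i with Fin.pigeonhole (ℕ.n<1+n m) (λ a → iterate (π ⟨$⟩ʳ_) i (toℕ a))
... | a , b , a<b , eq with ℕ.m≤n⇒∃[o]m+o≡n a<b
...   | d , a+d≡b = d , d<m , ≡.sym (iterate-injective (π ⟨$⟩ʳ_) (Injection.injective (↔⇒↣ π)) (toℕ a) (begin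
  iterate (π ⟨$⟩ʳ_) i (toℕ a)                            ≡⟨ eq ⟩
  iterate (π ⟨$⟩ʳ_) i (toℕ b)                            ≡⟨ ≡.cong (iterate (π ⟨$⟩ʳ_) i) b≡d+a ⟩
  iterate (π ⟨$⟩ʳ_) i (suc d ℕ.+ toℕ a)                  ≡⟨ iterate-+ (π ⟨$⟩ʳ_) i (suc d) (toℕ a) ⟩
  iterate (π ⟨$⟩ʳ_) (iterate (π ⟨$⟩ʳ_) i (suc d)) (toℕ a) ∎))
  where
  open ≡.≡-Reasoning
  b≡d+a : toℕ b ≡ suc d ℕ.+ toℕ a
  b≡d+a = ≡.trans (≡.sym a+d≡b) (≡.cong suc (ℕ.+-comm (toℕ a) d))
  d<m : suc d ≤ m
  d<m = ℕ.≤-trans (ℕ.m≤m+n (suc d) (toℕ a)) (≡.subst (_≤ m) b≡d+a (ℕ.≤-pred (Fin.toℕ<n b)))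

cycles≤ : ∀ {m} (π : Permutation′ m) k → cycles π k ≤ m
cycles≤ {m} π k = ≡.subst (cycles π k ≤_) (List.length-tabulate {n = m} (λ i → i)) (List.length-filter _ (List.allFin m))

-- A point counted by `cycles π k` lies strictly below its iterates with exponents 1, ..., k - 1. As
-- every point returns to itself within m < k steps, this would give i < i.
cycles≡0 : ∀ {m} (π : Permutation′ m) {k} → m < k → cycles π k ≡ 0
cycles≡0 {m} π {k} m<k = ≡.cong List.length (List.filter-none _ (All.universal noCycle (List.allFin m)))
  where
  noCycle : ∀ i → ¬ (iterate (π ⟨$⟩ʳ_) i k ≡ i × (∀ (l : Fin (ℕ.pred k)) → i Fin.< iterate (π ⟨$⟩ʳ_) i (suc (toℕ l))))
  noCycle i (_ , least) with iterate-returns π i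
  ... | d , d<m , eq = Fin.<-irrefl ≡.refl (≡.subst (i Fin.<_)
    (≡.trans (≡.cong (λ n → iterate (π ⟨$⟩ʳ_) i (suc n)) (Fin.toℕ-fromℕ< d<k-1)) eq) (least (fromℕ< d<k-1)))
    where
    d<k-1 : d < ℕ.pred k
    d<k-1 = ℕ.<⇒≤pred (ℕ.≤-<-trans d<m m<k)

-- The product (r+1)⋯(r+i) = (i+r)!/r!, the coefficient that appears when x^(i+r) is differentiated
-- i times.
rising : ℕ → ℕ → ℕ
rising zero    r = 1
rising (suc i) r = suc (i ℕ.+ r) ℕ.* rising i r

rising-! : ∀ i r → rising i r ℕ.* r ! ≡ (i ℕ.+ r) !
rising-! zero    r = ℕ.*-identityˡ (r !)
rising-! (suc i) r = ≡.trans (ℕ.*-assoc (suc (i ℕ.+ r)) (rising i r) (r !)) (≡.cong (suc (i ℕ.+ r) ℕ.*_) (rising-! i r))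

-- Both sides times r! are (i+r)!. This is how the 1/i! of the exponential series and one of the two
-- derivative coefficients combine into a binomial coefficient.
rising-C : ∀ i r → ((i ℕ.+ r) C i) ℕ.* i ! ≡ rising i r
rising-C i r = ℕ.*-cancelʳ-≡ _ _ (r !) {{r ℕ.!≢0}} (begin
  ((i ℕ.+ r) C i) ℕ.* i ! ℕ.* r !                     ≡⟨ ℕ.*-assoc (((i ℕ.+ r) C i)) (i !) (r !) ⟩
  ((i ℕ.+ r) C i) ℕ.* (i ! ℕ.* r !)                   ≡⟨ ≡.cong (λ s → ((i ℕ.+ r) C i) ℕ.* (i ! ℕ.* s !)) (ℕ.m+n∸m≡n i r) ⟨
  ((i ℕ.+ r) C i) ℕ.* (i ! ℕ.* (i ℕ.+ r ∸ i) !)       ≡⟨ ≡.cong (ℕ._* (i ! ℕ.* (i ℕ.+ r ∸ i) !)) (nCk≡n!/k![n-k]! (ℕ.m≤m+n i r)) ⟩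
  ((i ℕ.+ r) ! ℕ./ (i ! ℕ.* (i ℕ.+ r ∸ i) !)) {{_}} ℕ.* (i ! ℕ.* (i ℕ.+ r ∸ i) !)
    ≡⟨ ℕ.m/n*n≡m {{i ℕ.!* (i ℕ.+ r ∸ i) !≢0}} (k![n∸k]!∣n! (ℕ.m≤m+n i r)) ⟩
  (i ℕ.+ r) !                                       ≡⟨ rising-! i r ⟨
  rising i r ℕ.* r !                                ∎)
  where open ≡.≡-Reasoning

⟦_⟧ : ℕ → ℚ
⟦ n ⟧ = + n ℚ./ 1

/-* : ∀ a b c d .{{_ : ℕ.NonZero b}} .{{_ : ℕ.NonZero d}} →
      (+ a ℚ./ b) ℚ.* (+ c ℚ./ d) ≡ (+ (a ℕ.* c) ℚ./ (b ℕ.* d)) {{ℕ.m*n≢0 b d}}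
/-* a (suc b) c (suc d) = ℚ.toℚᵘ-injective (begin
  ℚ.toℚᵘ ((+ a ℚ./ suc b) ℚ.* (+ c ℚ./ suc d))           ≈⟨ ℚ.toℚᵘ-homo-* (+ a ℚ./ suc b) (+ c ℚ./ suc d) ⟩
  ℚ.toℚᵘ (+ a ℚ./ suc b) ℚᵘ.* ℚ.toℚᵘ (+ c ℚ./ suc d)     ≈⟨ ℚᵘ.*-cong (ℚ.toℚᵘ-fromℚᵘ (ℚᵘ.mkℚᵘ (+ a) b)) (ℚ.toℚᵘ-fromℚᵘ (ℚᵘ.mkℚᵘ (+ c) d)) ⟩
  ℚᵘ.mkℚᵘ (+ a) b ℚᵘ.* ℚᵘ.mkℚᵘ (+ c) d                   ≡⟨ ≡.cong (ℚᵘ._/ (suc b ℕ.* suc d)) (ℤ.pos-* a c) ⟨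
  (+ (a ℕ.* c)) ℚᵘ./ (suc b ℕ.* suc d)                   ≈⟨ ℚ.toℚᵘ-fromℚᵘ _ ⟨
  ℚ.toℚᵘ (+ (a ℕ.* c) ℚ./ (suc b ℕ.* suc d))             ∎)
  where open ℚᵘ.≃-Reasoning

⟦⟧-* : ∀ m n → ⟦ m ℕ.* n ⟧ ≡ ⟦ m ⟧ ℚ.* ⟦ n ⟧
⟦⟧-* m n = ≡.sym (/-* m 1 n 1)

⟦⟧-suc : ∀ n → ⟦ suc n ⟧ ≡ 1ℚ ℚ.+ ⟦ n ⟧
⟦⟧-suc n = ℚ.toℚᵘ-injective (begin
  ℚ.toℚᵘ ⟦ suc n ⟧                          ≈⟨ ℚ.toℚᵘ-fromℚᵘ (ℚᵘ.mkℚᵘ (+ suc n) 0) ⟩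
  ℚᵘ.mkℚᵘ (+ suc n) 0                       ≡⟨ ≡.cong (λ x → ℚᵘ.mkℚᵘ x 0) (≡.cong (λ k → + suc k) (≡.sym (ℕ.*-identityʳ n))) ⟩
  ℚᵘ.mkℚᵘ (+ suc (n ℕ.* 1)) 0               ≡⟨ ≡.cong (λ x → ℚᵘ.mkℚᵘ (+ 1 ℤ.+ x) 0) (ℤ.pos-* n 1) ⟩
  ℚᵘ.1ℚᵘ ℚᵘ.+ ℚᵘ.mkℚᵘ (+ n) 0               ≈⟨ ℚᵘ.+-congʳ ℚᵘ.1ℚᵘ (ℚ.toℚᵘ-fromℚᵘ (ℚᵘ.mkℚᵘ (+ n) 0)) ⟨
  ℚᵘ.1ℚᵘ ℚᵘ.+ ℚ.toℚᵘ ⟦ n ⟧                  ≈⟨ ℚ.toℚᵘ-homo-+ 1ℚ ⟦ n ⟧ ⟨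
  ℚ.toℚᵘ (1ℚ ℚ.+ ⟦ n ⟧)                     ∎)
  where open ℚᵘ.≃-Reasoning

/-cancel : ∀ c d .{{_ : ℕ.NonZero d}} → (+ c ℚ./ d) ℚ.* ⟦ d ⟧ ≡ ⟦ c ⟧
/-cancel c (suc d) = ≡.trans (/-* c (suc d) (suc d) 1)
  (ℚ.fromℚᵘ-cong {ℚᵘ.mkℚᵘ (+ (c ℕ.* suc d)) (d ℕ.* 1)} {ℚᵘ.mkℚᵘ (+ c) 0} (ℚᵘ.*≡* (begin
    + (c ℕ.* suc d) ℤ.* + 1       ≡⟨ ℤ.*-identityʳ (+ (c ℕ.* suc d)) ⟩
    + (c ℕ.* suc d)               ≡⟨ ℤ.pos-* c (suc d) ⟩
    + c ℤ.* + suc d               ≡⟨ ≡.cong (λ e → + c ℤ.* + suc e) (ℕ.*-identityʳ d) ⟨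
    + c ℤ.* + suc (d ℕ.* 1)       ∎)))
  where open ≡.≡-Reasoning

-- Action of Δ in a ℚ-algebra with partial derivatives

module Scalars (A : ℚ-Algebra) where

  open ℚ-Algebra A hiding (zero)
  open SetoidReasoning setoid

  κ : ℕ → Carrier
  κ n = ι ⟦ n ⟧

  κ-* : ∀ m n → κ (m ℕ.* n) ≈ κ m * κ n
  κ-* m n = trans (reflexive (≡.cong ι (⟦⟧-* m n))) (ι-* ⟦ m ⟧ ⟦ n ⟧)

  κ-suc : ∀ n → κ (suc n) ≈ 1# + κ n
  κ-suc n = trans (reflexive (≡.cong ι (⟦⟧-suc n))) (trans (ι-+ 1ℚ ⟦ n ⟧) (+-congʳ ι-1))

  κ-/ : ∀ c d .{{_ : ℕ.NonZero d}} → ι (+ c ℚ./ d) * κ d ≈ κ c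
  κ-/ c d = trans (sym (ι-* (+ c ℚ./ d) ⟦ d ⟧)) (reflexive (≡.cong ι (/-cancel c d)))

  κ-/! : ∀ c i → ι (c /! i) * κ (i !) ≈ κ c
  κ-/! c i = κ-/ c (i !) {{i ℕ.!≢0}}

  -- Serves to cancel the powers of 1/k in the argument of the Laguerre polynomial against part of
  -- its prefactor k^b.
  κ-^ : ∀ k .{{_ : ℕ.NonZero k}} s → κ (k ℕ.^ s) * ι (+ 1 ℚ./ k) ^ s ≈ 1#
  κ-^ k zero    = trans (*-identityʳ _) ι-1
  κ-^ k (suc s) = begin
    κ (k ℕ.* k ℕ.^ s) * (v * v ^ s)   ≈⟨ *-congʳ (κ-* k (k ℕ.^ s)) ⟩
    (κ k * κ (k ℕ.^ s)) * (v * v ^ s) ≈⟨ interchange _ _ _ _ ⟩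
    (κ k * v) * (κ (k ℕ.^ s) * v ^ s) ≈⟨ *-cong (trans (*-comm _ _) (κ-/ 1 k)) (κ-^ k s) ⟩
    κ 1 * 1#                          ≈⟨ *-identityʳ _ ⟩
    κ 1                               ≈⟨ ι-1 ⟩
    1#                                ∎
    where
    open CommutativeSemigroupProperties *-commutativeSemigroup using (interchange)
    v : Carrier
    v = ι (+ 1 ℚ./ k)

  ·-assoc : ∀ p q x → (p ℚ.* q) · x ≈ p · (q · x)
  ·-assoc p q x = trans (*-congʳ (ι-* p q)) (*-assoc _ _ _)

-- Finite sums and products

module Sums (R : CommutativeRing 0ℓ 0ℓ) where

  open CommutativeRing R hiding (zero)
  open SemiringSum semiring using (sum-syntax; sum⁺-syntax; sum-cong-≋; sum-replicate-zero)
  open Antidiagonal R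

  -- Replaces the subtraction n ∸ i by a second index tied to the first by a sum: matching on that
  -- equation then removes n, and reversing the summation is `antidiagonal-flip`.
  ∑-antidiagonal : ∀ n h → ∑[ i ≤ n ] h (toℕ i) (n ∸ toℕ i) ≈ antidiagonal n h
  ∑-antidiagonal zero    h = +-identityʳ _
  ∑-antidiagonal (suc n) h = +-congˡ (∑-antidiagonal n (λ a b → h (suc a) b))

  ∑-0 : ∀ n (f : Fin n → Carrier) → (∀ i → f i ≈ 0#) → ∑[ i < n ] f i ≈ 0#
  ∑-0 n f f≈0 = trans (sum-cong-≋ f≈0) (sum-replicate-zero n)

  ∑-truncate : ∀ {n I} (f : ℕ → Carrier) → n ≤ I → (∀ i → n < i → f i ≈ 0#) → ∑[ i ≤ I ] f (toℕ i) ≈ antidiagonal n (λ i _ → f i)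
  ∑-truncate {zero}  {I} f _ f≈0 =
    trans (+-congˡ (∑-0 I (λ i → f (suc (toℕ i))) (λ i → f≈0 (suc (toℕ i)) (ℕ.s≤s ℕ.z≤n)))) (+-identityʳ _)
  ∑-truncate {suc n} {suc I} f (ℕ.s≤s n≤I) f≈0 =
    +-congˡ (∑-truncate (f ∘ suc) n≤I (λ i n<i → f≈0 (suc i) (ℕ.s≤s n<i)))

module Products (A : ℚ-Algebra) where

  open ℚ-Algebra A hiding (zero)
  open CommutativeSemigroupProperties *-commutativeSemigroup using (interchange)

  -- Splits off the last factor and leaves the other indices unshifted, in step with the recursion
  -- of `Δ-truncated`, whereas `∏` splits off the first.
  Π : ℕ → (ℕ → Carrier) → Carrier
  Π zero    f = 1#
  Π (suc n) f = Π n f * f n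

  Π-cong : ∀ n {f g} → (∀ j → f j ≈ g j) → Π n f ≈ Π n g
  Π-cong zero    f≈g = refl
  Π-cong (suc n) f≈g = *-cong (Π-cong n f≈g) (f≈g n)

  Π-* : ∀ n f g → Π n f * Π n g ≈ Π n (λ j → f j * g j)
  Π-* zero    f g = *-identityˡ 1#
  Π-* (suc n) f g = trans (interchange _ _ _ _) (*-congʳ (Π-* n f g))

  Π-extend : ∀ {m n} f → m ≤ n → (∀ j → m ≤ j → f j ≈ 1#) → Π n f ≈ Π m f
  Π-extend {m} {n} f m≤n f≈1 = trans (reflexive (≡.cong (λ k → Π k f) (≡.sym (ℕ.m∸n+n≡m m≤n)))) (extend (n ∸ m))
    where
    extend : ∀ o → Π (o ℕ.+ m) f ≈ Π m f
    extend zero    = refl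
    extend (suc o) = trans (*-cong (extend o) (f≈1 (o ℕ.+ m) (ℕ.m≤n+m m o))) (*-identityʳ _)

  Π-head : ∀ n f → Π (suc n) f ≈ f 0 * Π n (f ∘ suc)
  Π-head zero    f = *-comm 1# (f 0)
  Π-head (suc n) f = trans (*-congʳ (Π-head n f)) (*-assoc _ _ _)

  ∏≈Π : ∀ n f → ∏[ j < n ] f (toℕ j) ≈ Π n f
  ∏≈Π zero    f = refl
  ∏≈Π (suc n) f = trans (*-congˡ (∏≈Π n (f ∘ suc))) (sym (Π-head n f))

-- Derivations and the elements they kill

module Derivation (A : ℚ-Algebra) {d} (δ : IsDerivation A d) where

  open ℚ-Algebra A hiding (zero)
  open IsDerivation δ
  open GroupProperties +-group using (identityʳ-unique)
  open Scalars A
  open SetoidReasoning setoid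

  d-0 : d 0# ≈ 0#
  d-0 = identityʳ-unique (d 0#) (d 0#) (trans (sym (d-+ 0# 0#)) (d-cong (+-identityˡ 0#)))

  d-1 : d 1# ≈ 0#
  d-1 = derivation-1 A δ

  d-ι : ∀ q → d (ι q) ≈ 0#
  d-ι q = trans (d-cong (sym (*-identityʳ (ι q)))) (trans (d-· q 1#) (trans (*-congˡ d-1) (zeroʳ (ι q))))

  d-constant-* : ∀ {c} → d c ≈ 0# → ∀ x → d (c * x) ≈ c * d x
  d-constant-* {c} dc≈0 x = trans (leibniz c x) (trans (+-congʳ (trans (*-congʳ dc≈0) (zeroˡ x))) (+-identityˡ _))

  kernel-+ : ∀ {x y} → d x ≈ 0# → d y ≈ 0# → d (x + y) ≈ 0#
  kernel-+ dx≈0 dy≈0 = trans (d-+ _ _) (trans (+-cong dx≈0 dy≈0) (+-identityˡ 0#))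

  kernel-* : ∀ {x y} → d x ≈ 0# → d y ≈ 0# → d (x * y) ≈ 0#
  kernel-* {x} dx≈0 dy≈0 = trans (d-constant-* dx≈0 _) (trans (*-congˡ dy≈0) (zeroʳ x))

  kernel-neg : ∀ {x} → d x ≈ 0# → d (- x) ≈ 0#
  kernel-neg {x} dx≈0 = begin
    d (- x)        ≈⟨ +-identityʳ _ ⟨
    d (- x) + 0#   ≈⟨ +-congˡ dx≈0 ⟨
    d (- x) + d x  ≈⟨ d-+ (- x) x ⟨
    d (- x + x)    ≈⟨ d-cong (-‿inverseˡ x) ⟩
    d 0#           ≈⟨ d-0 ⟩
    0#             ∎

  kernel-^ : ∀ {x} → d x ≈ 0# → ∀ n → d (x ^ n) ≈ 0#
  kernel-^ dx≈0 zero    = d-1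
  kernel-^ dx≈0 (suc n) = kernel-* dx≈0 (kernel-^ dx≈0 n)

  kernel-∑ : ∀ n (f : Fin n → Carrier) → (∀ i → d (f i) ≈ 0#) → d (∑[ i < n ] f i) ≈ 0#
  kernel-∑ zero    f df≈0 = d-0
  kernel-∑ (suc n) f df≈0 = kernel-+ (df≈0 zero) (kernel-∑ n (f ∘ suc) (df≈0 ∘ suc))

  kernel-laguerre : ∀ n α {t} → d t ≈ 0# → d (laguerre A n α t) ≈ 0#
  kernel-laguerre n α dt≈0 = kernel-∑ (suc n) _ (λ i → kernel-* (d-ι (((n ℕ.+ α) C (n ∸ toℕ i)) /! toℕ i)) (kernel-^ (kernel-neg dt≈0) (toℕ i)))

  d-^ : ∀ x n → d (x ^ suc n) ≈ κ (suc n) * (x ^ n * d x)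
  d-^ x zero = begin
    d (x * 1#)           ≈⟨ d-cong (*-identityʳ x) ⟩
    d x                  ≈⟨ *-identityˡ (d x) ⟨
    1# * d x             ≈⟨ *-identityˡ _ ⟨
    1# * (1# * d x)      ≈⟨ *-congʳ ι-1 ⟨
    κ 1 * (1# * d x)     ∎
  d-^ x (suc n) = begin
    d (x * x ^ suc n)                                  ≈⟨ leibniz x (x ^ suc n) ⟩
    d x * x ^ suc n + x * d (x ^ suc n)                ≈⟨ +-congˡ (*-congˡ (d-^ x n)) ⟩
    d x * (x * x ^ n) + x * (κ (suc n) * (x ^ n * d x))
      ≈⟨ solve 4 (λ x y z k → z :* (x :* y) :+ x :* (k :* (y :* z)) := (x :* y) :* z :+ k :* ((x :* y) :* z)) refl x (x ^ n) (d x) (κ (suc n)) ⟩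
    x ^ suc n * d x + κ (suc n) * (x ^ suc n * d x)    ≈⟨ +-congʳ (*-identityˡ _) ⟨
    1# * (x ^ suc n * d x) + κ (suc n) * (x ^ suc n * d x) ≈⟨ distribʳ _ 1# _ ⟨
    (1# + κ (suc n)) * (x ^ suc n * d x)               ≈⟨ *-congʳ (κ-suc (suc n)) ⟨
    κ (suc (suc n)) * (x ^ suc n * d x)                ∎
    where open NaturalCoefficients commutativeSemiring

-- T plays the role of ∂_x ∂_y.  Up to a swap of the variables, F has the shape
-- k^b b! L_b^(α)(- x y / k) x^α, which is obtained from x^(b+α) y^b.
module Laguerre (A : ℚ-Algebra) (x y : ℚ-Algebra.Carrier A) (T : ℚ-Algebra.Carrier A → ℚ-Algebra.Carrier A) where

  open ℚ-Algebra A
  open Scalars A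
  open Antidiagonal commutativeRing
  open Sums commutativeRing
  open SemiringExp semiring using (^-congˡ; ^-homo-*)
  open CommutativeSemiringExp commutativeSemiring using (^-distrib-*)
  open NaturalCoefficients commutativeSemiring using (solve; _:*_; _:=_)
  open SetoidReasoning setoid

  -- Stated through monomials alone, so that one operator can be used with either order of the two
  -- variables. `T-zero` concerns y ^ 0 because in x^(s+α) y^s the exponent of y is the first to run
  -- out.
  record IsMixedPartial : Set where
    field
      T-cong : ∀ {f g} → f ≈ g → T f ≈ T g
      T-·    : ∀ q f → T (q · f) ≈ q · T f
      T-0    : T 0# ≈ 0#
      T-zero : ∀ r → T (x ^ r * y ^ 0) ≈ 0#
      T-suc  : ∀ r s → T (x ^ suc r * y ^ suc s) ≈ (⟦ suc r ⟧ ℚ.* ⟦ suc s ⟧) · (x ^ r * y ^ s)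

  module _ (T-mixed : IsMixedPartial) where

    open IsMixedPartial T-mixed

    iterate-cong : ∀ i {f g} → f ≈ g → iterate T f i ≈ iterate T g i
    iterate-cong zero    f≈g = f≈g
    iterate-cong (suc i) f≈g = iterate-cong i (T-cong f≈g)

    iterate-· : ∀ i q f → iterate T (q · f) i ≈ q · iterate T f i
    iterate-· zero    q f = refl
    iterate-· (suc i) q f = trans (iterate-cong i (T-· q f)) (iterate-· i q (T f))

    iterate-0 : ∀ i → iterate T 0# i ≈ 0#
    iterate-0 zero    = refl
    iterate-0 (suc i) = trans (iterate-cong i T-0) (iterate-0 i)

    -- Each application of T lowers both exponents by one, so s of them use up y and the next one
    -- gives 0. Hence the exponential series stops at i = b.
    iterate-vanishes : ∀ α {s i} → s < i → iterate T (x ^ (s ℕ.+ α) * y ^ s) i ≈ 0#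
    iterate-vanishes α {zero}  {suc i} _           = trans (iterate-cong i (T-zero α)) (iterate-0 i)
    iterate-vanishes α {suc s} {suc i} (ℕ.s≤s s<i) = trans (iterate-cong i (T-suc (s ℕ.+ α) s))
      (trans (iterate-· i (⟦ suc (s ℕ.+ α) ⟧ ℚ.* ⟦ suc s ⟧) _) (trans (*-congˡ (iterate-vanishes α s<i)) (zeroʳ _)))

    iterate-monomial : ∀ i r s → iterate T (x ^ (i ℕ.+ r) * y ^ (i ℕ.+ s)) i ≈ (κ (rising i r) * κ (rising i s)) * (x ^ r * y ^ s)
    iterate-monomial zero    r s = sym (trans (*-congʳ (trans (*-cong ι-1 ι-1) (*-identityˡ 1#))) (*-identityˡ _))
    iterate-monomial (suc i) r s = begin
      iterate T (T (x ^ suc (i ℕ.+ r) * y ^ suc (i ℕ.+ s))) i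
        ≈⟨ iterate-cong i (T-suc (i ℕ.+ r) (i ℕ.+ s)) ⟩
      iterate T ((⟦ suc (i ℕ.+ r) ⟧ ℚ.* ⟦ suc (i ℕ.+ s) ⟧) · (x ^ (i ℕ.+ r) * y ^ (i ℕ.+ s))) i
        ≈⟨ iterate-· i (⟦ suc (i ℕ.+ r) ⟧ ℚ.* ⟦ suc (i ℕ.+ s) ⟧) _ ⟩
      (⟦ suc (i ℕ.+ r) ⟧ ℚ.* ⟦ suc (i ℕ.+ s) ⟧) · iterate T (x ^ (i ℕ.+ r) * y ^ (i ℕ.+ s)) i
        ≈⟨ *-cong (ι-* ⟦ suc (i ℕ.+ r) ⟧ ⟦ suc (i ℕ.+ s) ⟧) (iterate-monomial i r s) ⟩
      (κ (suc (i ℕ.+ r)) * κ (suc (i ℕ.+ s))) * ((κ (rising i r) * κ (rising i s)) * (x ^ r * y ^ s))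
        ≈⟨ solve 5 (λ a b c e m → (a :* b) :* ((c :* e) :* m) := ((a :* c) :* (b :* e)) :* m) refl _ _ _ _ _ ⟩
      ((κ (suc (i ℕ.+ r)) * κ (rising i r)) * (κ (suc (i ℕ.+ s)) * κ (rising i s))) * (x ^ r * y ^ s)
        ≈⟨ *-congʳ (*-cong (κ-* (suc (i ℕ.+ r)) (rising i r)) (κ-* (suc (i ℕ.+ s)) (rising i s))) ⟨
      (κ (rising (suc i) r) * κ (rising (suc i) s)) * (x ^ r * y ^ s) ∎

    module _ (k : ℕ) .{{_ : ℕ.NonZero k}} (α : ℕ) where

      -- The common value, for i + s = b, of the i-th term of the exponential and the term of degree
      -- s of the Laguerre side; `rising i s` is b!/s!.
      term : ℕ → ℕ → Carrier
      term i s = (κ (((i ℕ.+ s) ℕ.+ α) C i) * (κ (k ℕ.^ i) * κ (rising i s))) * (x ^ (s ℕ.+ α) * y ^ s)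

      exponential-term : ∀ i s →
        ((k ℕ.^ i) /! i) · iterate T (x ^ ((i ℕ.+ s) ℕ.+ α) * y ^ (i ℕ.+ s)) i ≈ term i s
      exponential-term i s = begin
        ι ((k ℕ.^ i) /! i) * iterate T (x ^ ((i ℕ.+ s) ℕ.+ α) * y ^ (i ℕ.+ s)) i
          ≈⟨ *-congˡ (reflexive (≡.cong (λ e → iterate T (x ^ e * y ^ (i ℕ.+ s)) i) (ℕ.+-assoc i s α))) ⟩
        ι ((k ℕ.^ i) /! i) * iterate T (x ^ (i ℕ.+ (s ℕ.+ α)) * y ^ (i ℕ.+ s)) i
          ≈⟨ *-congˡ (iterate-monomial i (s ℕ.+ α) s) ⟩
        ι ((k ℕ.^ i) /! i) * ((κ (rising i (s ℕ.+ α)) * κ (rising i s)) * (x ^ (s ℕ.+ α) * y ^ s))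
          ≈⟨ *-congˡ (*-congʳ (*-congʳ (trans (reflexive (≡.cong κ (≡.sym rising≡))) (κ-* (((i ℕ.+ s) ℕ.+ α) C i) (i !))))) ⟩
        ι ((k ℕ.^ i) /! i) * (((c * κ (i !)) * κ (rising i s)) * (x ^ (s ℕ.+ α) * y ^ s))
          ≈⟨ solve 5 (λ q c f r m → q :* (((c :* f) :* r) :* m) := (c :* ((q :* f) :* r)) :* m) refl _ _ _ _ _ ⟩
        (c * ((ι ((k ℕ.^ i) /! i) * κ (i !)) * κ (rising i s))) * (x ^ (s ℕ.+ α) * y ^ s)
          ≈⟨ *-congʳ (*-congˡ (*-congʳ (κ-/! (k ℕ.^ i) i))) ⟩
        term i s ∎
        where
        c : Carrier
        c = κ (((i ℕ.+ s) ℕ.+ α) C i)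
        rising≡ : (((i ℕ.+ s) ℕ.+ α) C i) ℕ.* i ! ≡ rising i (s ℕ.+ α)
        rising≡ = ≡.trans (≡.cong (λ n → (n C i) ℕ.* i !) (ℕ.+-assoc i s α)) (rising-C i (s ℕ.+ α))

      t : Carrier
      t = - ((+ 1 ℚ./ k) · (x * y))

      -- In the prefactor, k^(i+s) is k^i k^s, whose k^s absorbs the (1/k)^s of the argument, and
      -- (i+s)! is `rising i s` times s!, which cancels the denominator. The factor x^α joins the
      -- x^s of (x y)^s.
      laguerre-term : ∀ i s →
        (κ (k ℕ.^ (i ℕ.+ s) ℕ.* (i ℕ.+ s) !) * x ^ α) * ((((i ℕ.+ s) ℕ.+ α) C i) /! s · (- t) ^ s) ≈ term i s
      laguerre-term i s = begin
        (κ (k ℕ.^ (i ℕ.+ s) ℕ.* (i ℕ.+ s) !) * x ^ α) * (ι (c /! s) * (- t) ^ s)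
          ≈⟨ *-cong (*-congʳ scalar) (*-congˡ power) ⟩
        (((κ (k ℕ.^ i) * κ (k ℕ.^ s)) * (κ (rising i s) * κ (s !))) * x ^ α) * (ι (c /! s) * (ι (+ 1 ℚ./ k) ^ s * (x ^ s * y ^ s)))
          ≈⟨ solve 9 (λ kⁱ kˢ r s! xα c vˢ xˢ yˢ →
               (((kⁱ :* kˢ) :* (r :* s!)) :* xα) :* (c :* (vˢ :* (xˢ :* yˢ))) :=
               (kˢ :* vˢ) :* (((c :* s!) :* (kⁱ :* r)) :* ((xˢ :* xα) :* yˢ)))
             refl _ _ _ _ _ _ _ _ _ ⟩
        (κ (k ℕ.^ s) * ι (+ 1 ℚ./ k) ^ s) * (((ι (c /! s) * κ (s !)) * (κ (k ℕ.^ i) * κ (rising i s))) * ((x ^ s * x ^ α) * y ^ s))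
          ≈⟨ *-cong (κ-^ k s) (*-cong (*-congʳ (κ-/! c s)) (*-congʳ (sym (^-homo-* x s α)))) ⟩
        1# * term i s
          ≈⟨ *-identityˡ _ ⟩
        term i s ∎
        where
        c : ℕ
        c = ((i ℕ.+ s) ℕ.+ α) C i
        scalar : κ (k ℕ.^ (i ℕ.+ s) ℕ.* (i ℕ.+ s) !) ≈ (κ (k ℕ.^ i) * κ (k ℕ.^ s)) * (κ (rising i s) * κ (s !))
        scalar = trans (κ-* (k ℕ.^ (i ℕ.+ s)) ((i ℕ.+ s) !)) (*-cong
          (trans (reflexive (≡.cong κ (ℕ.^-distribˡ-+-* k i s))) (κ-* (k ℕ.^ i) (k ℕ.^ s)))
          (trans (reflexive (≡.cong κ (≡.sym (rising-! i s)))) (κ-* (rising i s) (s !))))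
        power : (- t) ^ s ≈ ι (+ 1 ℚ./ k) ^ s * (x ^ s * y ^ s)
        power = trans (^-congˡ s (RingProperties.-‿involutive ring _))
          (trans (^-distrib-* _ (x * y) s) (*-congˡ (^-distrib-* x y s)))

      exponential≈laguerre : ∀ {b I} → b ≤ I →
        ∑[ i ≤ I ] ((k ℕ.^ toℕ i) /! toℕ i · iterate T (x ^ (b ℕ.+ α) * y ^ b) (toℕ i)) ≈
        (+ (k ℕ.^ b ℕ.* b !) ℚ./ 1) · (laguerre A b α t * x ^ α)
      exponential≈laguerre {b} {I} b≤I = begin
        ∑[ i ≤ I ] ((k ℕ.^ toℕ i) /! toℕ i · iterate T (x ^ (b ℕ.+ α) * y ^ b) (toℕ i))
          ≈⟨ ∑-truncate (λ i → (k ℕ.^ i) /! i · iterate T (x ^ (b ℕ.+ α) * y ^ b) i) b≤I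
               (λ i b<i → trans (*-congˡ (iterate-vanishes α b<i)) (zeroʳ _)) ⟩
        antidiagonal b (λ i _ → (k ℕ.^ i) /! i · iterate T (x ^ (b ℕ.+ α) * y ^ b) i)
          -- Matching on i + s ≡ b puts i + s in place of b, the form in which both term lemmas are
          -- stated.
          ≈⟨ antidiagonal-cong b (λ { i s ≡.refl → exponential-term i s }) ⟩
        antidiagonal b term
          ≈⟨ antidiagonal-cong b (λ { i s ≡.refl → laguerre-term i s }) ⟨
        antidiagonal b (λ i s → (κ (k ℕ.^ b ℕ.* b !) * x ^ α) * (((b ℕ.+ α) C i) /! s · (- t) ^ s))
          ≈⟨ antidiagonal-*ˡ b _ _ ⟨
        (κ (k ℕ.^ b ℕ.* b !) * x ^ α) * antidiagonal b (λ i s → ((b ℕ.+ α) C i) /! s · (- t) ^ s)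
          -- `laguerre` is summed by the degree s, while the exponential was summed by i = b - s.
          ≈⟨ *-congˡ (antidiagonal-flip b _) ⟩
        (κ (k ℕ.^ b ℕ.* b !) * x ^ α) * antidiagonal b (λ s i → ((b ℕ.+ α) C i) /! s · (- t) ^ s)
          ≈⟨ *-congˡ (∑-antidiagonal b _) ⟨
        (κ (k ℕ.^ b ℕ.* b !) * x ^ α) * laguerre A b α t
          ≈⟨ trans (*-assoc _ _ _) (*-congˡ (*-comm _ _)) ⟩
        κ (k ℕ.^ b ℕ.* b !) * (laguerre A b α t * x ^ α) ∎

≡ᵇ-refl : ∀ n → (n ℕ.≡ᵇ n) ≡ true
≡ᵇ-refl zero    = ≡.refl
≡ᵇ-refl (suc n) = ≡ᵇ-refl n

≢⇒≡ᵇ-false : ∀ {m n} → m ≢ n → (m ℕ.≡ᵇ n) ≡ false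
≢⇒≡ᵇ-false {m} {n} m≢n with m ℕ.≡ᵇ n in eq
... | false = ≡.refl
... | true  = ⊥-elim (m≢n (ℕ.≡ᵇ⇒≡ m n (≡.subst Bool.T (≡.sym eq) tt)))

module ΔTheorem (A : ℚ-Algebra) {p p̃ : ℕ → ℚ-Algebra.Carrier A} (𝜕 : PartialDerivatives A p p̃) where

  open ℚ-Algebra A hiding (zero)
  open PartialDerivatives 𝜕
  open BD-polynomial A p p̃
  open Δ A ∂p ∂p̃
  open Scalars A
  open Products A
  open SemiringSum semiring using (sum-cong-≋; *-distribˡ-sum; *-distribʳ-sum)
  open SemiringExp semiring using (^-congˡ)
  open CommutativeSemigroupProperties *-commutativeSemigroup using (x∙yz≈y∙xz; interchange)
  open CommutativeSemigroupProperties +-commutativeSemigroup using () renaming (interchange to +-interchange)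
  open SetoidReasoning setoid

  -- Constants for the derivations of one index

  module ∂  j = Derivation A (∂p-derivation j)
  module ∂̃ j = Derivation A (∂p̃-derivation j)
  module δ  j = IsDerivation (∂p-derivation j)
  module δ̃ j = IsDerivation (∂p̃-derivation j)

  record Constant (j : ℕ) (c : Carrier) : Set where
    field
      ∂p≈0 : ∂p j c ≈ 0#
      ∂p̃≈0 : ∂p̃ j c ≈ 0#

  open Constant

  constant-ι : ∀ j q → Constant j (ι q)
  constant-ι j q = record { ∂p≈0 = ∂.d-ι j q ; ∂p̃≈0 = ∂̃.d-ι j q }

  constant-1 : ∀ j → Constant j 1#
  constant-1 j = record { ∂p≈0 = ∂.d-1 j ; ∂p̃≈0 = ∂̃.d-1 j }

  constant-* : ∀ {j x y} → Constant j x → Constant j y → Constant j (x * y)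
  constant-* {j} cx cy = record
    { ∂p≈0 = ∂.kernel-* j (∂p≈0 cx) (∂p≈0 cy) ; ∂p̃≈0 = ∂̃.kernel-* j (∂p̃≈0 cx) (∂p̃≈0 cy) }

  constant-^ : ∀ {j x} → Constant j x → ∀ n → Constant j (x ^ n)
  constant-^ {j} cx n = record { ∂p≈0 = ∂.kernel-^ j (∂p≈0 cx) n ; ∂p̃≈0 = ∂̃.kernel-^ j (∂p̃≈0 cx) n }

  constant-neg : ∀ {j x} → Constant j x → Constant j (- x)
  constant-neg {j} cx = record { ∂p≈0 = ∂.kernel-neg j (∂p≈0 cx) ; ∂p̃≈0 = ∂̃.kernel-neg j (∂p̃≈0 cx) }

  constant-laguerre : ∀ {j t} n α → Constant j t → Constant j (laguerre A n α t)
  constant-laguerre {j} n α ct = record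
    { ∂p≈0 = ∂.kernel-laguerre j n α (∂p≈0 ct) ; ∂p̃≈0 = ∂̃.kernel-laguerre j n α (∂p̃≈0 ct) }

  constant-Π : ∀ {j} n f → (∀ i → i < n → Constant j (f i)) → Constant j (Π n f)
  constant-Π {j} zero    f cf = constant-1 j
  constant-Π     (suc n) f cf = constant-* (constant-Π n f (λ i i<n → cf i (ℕ.m<n⇒m<1+n i<n))) (cf n (ℕ.n<1+n n))

  constant-p : ∀ {i j} → i ≢ j → Constant i (p j)
  constant-p {i} {j} i≢j = record
    { ∂p≈0 = trans (∂p-p i j) (reflexive (≡.cong (if_then 1# else 0#) (≢⇒≡ᵇ-false i≢j)))
    ; ∂p̃≈0 = ∂p̃-p i j
    }

  constant-p̃ : ∀ {i j} → i ≢ j → Constant i (p̃ j)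
  constant-p̃ {i} {j} i≢j = record
    { ∂p≈0 = ∂p-p̃ i j
    ; ∂p̃≈0 = trans (∂p̃-p̃ i j) (reflexive (≡.cong (if_then 1# else 0#) (≢⇒≡ᵇ-false i≢j)))
    }

  monomial : ℕ → ℕ → ℕ → Carrier
  monomial j a b = p j ^ a * p̃ j ^ b

  constant-monomial : ∀ {i j} → i ≢ j → ∀ a b → Constant i (monomial j a b)
  constant-monomial i≢j a b = constant-* (constant-^ (constant-p i≢j) a) (constant-^ (constant-p̃ i≢j) b)

  constant-F : ∀ {i j} → i ≢ j → ∀ a b → Constant i (F j a b)
  constant-F {i} {j} i≢j a b with b ℕ.≤? a
  ... | yes _ = constant-* (constant-ι i (+ (suc j ℕ.^ b ℕ.* b !) ℚ./ 1)) (constant-*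
    (constant-laguerre b (a ∸ b) (constant-neg (constant-* (constant-ι i (+ 1 ℚ./ suc j)) (constant-* (constant-p i≢j) (constant-p̃ i≢j)))))
    (constant-^ (constant-p i≢j) (a ∸ b)))
  ... | no  _ = constant-* (constant-ι i (+ (suc j ℕ.^ a ℕ.* a !) ℚ./ 1)) (constant-*
    (constant-laguerre a (b ∸ a) (constant-neg (constant-* (constant-ι i (+ 1 ℚ./ suc j)) (constant-* (constant-p i≢j) (constant-p̃ i≢j)))))
    (constant-^ (constant-p̃ i≢j) (b ∸ a)))

  -- Operators linear over constants

  record IsLinearOver (S : Carrier → Set) (T : Carrier → Carrier) : Set where
    field
      T-cong : ∀ {x y} → x ≈ y → T x ≈ T y
      T-+    : ∀ x y → T (x + y) ≈ T x + T y
      T-*    : ∀ {c} → S c → ∀ x → T (c * x) ≈ c * T x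

    open GroupProperties +-group using (identityʳ-unique)

    T-0 : T 0# ≈ 0#
    T-0 = identityʳ-unique (T 0#) (T 0#) (trans (sym (T-+ 0# 0#)) (T-cong (+-identityˡ 0#)))

    T-∑ : ∀ n (f : Fin n → Carrier) → T (∑[ i < n ] f i) ≈ ∑[ i < n ] T (f i)
    T-∑ zero    f = T-0
    T-∑ (suc n) f = trans (T-+ _ _) (+-congˡ (T-∑ n (f ∘ suc)))

  open IsLinearOver

  linear-id : ∀ {S} → IsLinearOver S (λ x → x)
  linear-id = record { T-cong = λ eq → eq ; T-+ = λ _ _ → refl ; T-* = λ _ _ → refl }

  linear-∘ : ∀ {S U T} → IsLinearOver S U → IsLinearOver S T → IsLinearOver S (U ∘ T)
  linear-∘ U-lin T-lin = record
    { T-cong = T-cong U-lin ∘ T-cong T-lin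
    ; T-+    = λ x y → trans (T-cong U-lin (T-+ T-lin x y)) (T-+ U-lin _ _)
    ; T-*    = λ c x → trans (T-cong U-lin (T-* T-lin c x)) (T-* U-lin c _)
    }

  linear-iterate : ∀ {S T} → IsLinearOver S T → ∀ i → IsLinearOver S (λ x → iterate T x i)
  linear-iterate T-lin zero    = linear-id
  linear-iterate T-lin (suc i) = linear-∘ (linear-iterate T-lin i) T-lin

  linear-scale : ∀ {S T} s → IsLinearOver S T → IsLinearOver S (λ x → s * T x)
  linear-scale s T-lin = record
    { T-cong = λ eq → *-congˡ (T-cong T-lin eq)
    ; T-+    = λ x y → trans (*-congˡ (T-+ T-lin x y)) (distribˡ s _ _)
    ; T-*    = λ c x → trans (*-congˡ (T-* T-lin c x)) (x∙yz≈y∙xz s _ _)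
    }

  linear-∑ : ∀ {S} n (T : Fin n → Carrier → Carrier) → (∀ i → IsLinearOver S (T i)) → IsLinearOver S (λ x → ∑[ i < n ] T i x)
  linear-∑ zero    T T-lin = record
    { T-cong = λ _ → refl ; T-+ = λ _ _ → sym (+-identityˡ 0#) ; T-* = λ {c} _ _ → sym (zeroʳ c) }
  linear-∑ (suc n) T T-lin = let tail-lin = linear-∑ n (T ∘ suc) (T-lin ∘ suc) in record
    { T-cong = λ eq → +-cong (T-cong (T-lin zero) eq) (T-cong tail-lin eq)
    ; T-+    = λ x y → trans (+-cong (T-+ (T-lin zero) x y) (T-+ tail-lin x y)) (+-interchange _ _ _ _)
    ; T-*    = λ {c} Sc x → trans (+-cong (T-* (T-lin zero) Sc x) (T-* tail-lin Sc x)) (sym (distribˡ c _ _))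
    }

  ∂p∂p̃ : ℕ → Carrier → Carrier
  ∂p∂p̃ j = ∂p j ∘ ∂p̃ j

  ∂p∂p̃-linear : ∀ j → IsLinearOver (Constant j) (∂p∂p̃ j)
  ∂p∂p̃-linear j = linear-∘
    record { T-cong = δ.d-cong j ; T-+ = δ.d-+ j ; T-* = λ c → ∂.d-constant-* j (∂p≈0 c) }
    record { T-cong = δ̃.d-cong j ; T-+ = δ̃.d-+ j ; T-* = λ c → ∂̃.d-constant-* j (∂p̃≈0 c) }

  Δ-factor-linear : ∀ I j → IsLinearOver (Constant j) (Δ-factor I j)
  Δ-factor-linear I j = linear-∑ (suc I) (λ i f → (suc j ℕ.^ toℕ i) /! toℕ i · iterate (∂p∂p̃ j) f (toℕ i))
    (λ i → linear-scale _ (linear-iterate (∂p∂p̃-linear j) (toℕ i)))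

  -- Each factor is linear over the constants of its own index only, so a composite of them is
  -- linear over elements that are constant for all indices at once. The rational scalars are such
  -- elements.
  Δ-truncated-linear : ∀ K I → IsLinearOver (λ c → ∀ j → Constant j c) (Δ-truncated K I)
  Δ-truncated-linear zero    I = linear-id
  Δ-truncated-linear (suc K) I = linear-∘
    record { T-cong = T-cong factor ; T-+ = T-+ factor ; T-* = λ c → T-* factor (c K) }
    (Δ-truncated-linear K I)
    where
    factor : IsLinearOver (Constant K) (Δ-factor I K)
    factor = Δ-factor-linear I K

  -- One factor of Δ on monomials in one pair of variables

  ∂p-p≈1 : ∀ j → ∂p j (p j) ≈ 1#
  ∂p-p≈1 j = trans (∂p-p j j) (reflexive (≡.cong (if_then 1# else 0#) (≡ᵇ-refl j)))

  ∂p̃-p̃≈1 : ∀ j → ∂p̃ j (p̃ j) ≈ 1#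
  ∂p̃-p̃≈1 j = trans (∂p̃-p̃ j j) (reflexive (≡.cong (if_then 1# else 0#) (≡ᵇ-refl j)))

  ∂p̃-monomial : ∀ j a b → ∂p̃ j (monomial j a (suc b)) ≈ κ (suc b) * monomial j a b
  ∂p̃-monomial j a b = begin
    ∂p̃ j (p j ^ a * p̃ j ^ suc b)                     ≈⟨ ∂̃.d-constant-* j (∂̃.kernel-^ j (∂p̃-p j j) a) _ ⟩
    p j ^ a * ∂p̃ j (p̃ j ^ suc b)                     ≈⟨ *-congˡ (∂̃.d-^ j (p̃ j) b) ⟩
    p j ^ a * (κ (suc b) * (p̃ j ^ b * ∂p̃ j (p̃ j)))   ≈⟨ *-congˡ (*-congˡ (trans (*-congˡ (∂p̃-p̃≈1 j)) (*-identityʳ _))) ⟩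
    p j ^ a * (κ (suc b) * p̃ j ^ b)                  ≈⟨ x∙yz≈y∙xz _ _ _ ⟩
    κ (suc b) * monomial j a b                       ∎

  ∂p-monomial : ∀ j a b → ∂p j (monomial j (suc a) b) ≈ κ (suc a) * monomial j a b
  ∂p-monomial j a b = begin
    ∂p j (p j ^ suc a * p̃ j ^ b)                     ≈⟨ δ.d-cong j (*-comm _ _) ⟩
    ∂p j (p̃ j ^ b * p j ^ suc a)                     ≈⟨ ∂.d-constant-* j (∂.kernel-^ j (∂p-p̃ j j) b) _ ⟩
    p̃ j ^ b * ∂p j (p j ^ suc a)                     ≈⟨ *-congˡ (∂.d-^ j (p j) a) ⟩
    p̃ j ^ b * (κ (suc a) * (p j ^ a * ∂p j (p j)))   ≈⟨ *-congˡ (*-congˡ (trans (*-congˡ (∂p-p≈1 j)) (*-identityʳ _))) ⟩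
    p̃ j ^ b * (κ (suc a) * p j ^ a)                  ≈⟨ trans (*-comm _ _) (*-assoc _ _ _) ⟩
    κ (suc a) * monomial j a b                       ∎

  ∂p∂p̃-monomial : ∀ j a b →
    ∂p∂p̃ j (monomial j (suc a) (suc b)) ≈ (⟦ suc a ⟧ ℚ.* ⟦ suc b ⟧) · monomial j a b
  ∂p∂p̃-monomial j a b = begin
    ∂p j (∂p̃ j (monomial j (suc a) (suc b)))         ≈⟨ δ.d-cong j (∂p̃-monomial j (suc a) b) ⟩
    ∂p j (κ (suc b) * monomial j (suc a) b)          ≈⟨ δ.d-· j ⟦ suc b ⟧ _ ⟩
    κ (suc b) * ∂p j (monomial j (suc a) b)          ≈⟨ *-congˡ (∂p-monomial j a b) ⟩
    κ (suc b) * (κ (suc a) * monomial j a b)         ≈⟨ x∙yz≈y∙xz _ _ _ ⟩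
    κ (suc a) * (κ (suc b) * monomial j a b)         ≈⟨ ·-assoc ⟦ suc a ⟧ ⟦ suc b ⟧ _ ⟨
    (⟦ suc a ⟧ ℚ.* ⟦ suc b ⟧) · monomial j a b       ∎

  ∂p∂p̃-p^ : ∀ j a → ∂p∂p̃ j (monomial j a 0) ≈ 0#
  ∂p∂p̃-p^ j a = trans (δ.d-cong j (∂̃.kernel-* j (∂̃.kernel-^ j (∂p̃-p j j) a) (∂̃.d-1 j))) (∂.d-0 j)

  -- ∂_p̃ leaves a multiple of a power of p̃, which ∂_p kills. This supplies `T-zero` when the
  -- variables exchange roles.
  ∂p∂p̃-p̃^ : ∀ j b → ∂p∂p̃ j (monomial j 0 b) ≈ 0#
  ∂p∂p̃-p̃^ j zero    = ∂p∂p̃-p^ j 0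
  ∂p∂p̃-p̃^ j (suc b) = trans (δ.d-cong j (∂p̃-monomial j 0 b))
    (∂.kernel-* j (∂.d-ι j ⟦ suc b ⟧) (∂.kernel-* j (∂.d-1 j) (∂.kernel-^ j (∂p-p̃ j j) b)))

  laguerre-cong : ∀ n α {s t} → s ≈ t → laguerre A n α s ≈ laguerre A n α t
  laguerre-cong n α s≈t = sum-cong-≋ {suc n} (λ i → *-congˡ {ι (((n ℕ.+ α) C (n ∸ toℕ i)) /! toℕ i)} (^-congˡ (toℕ i) (-‿cong s≈t)))

  -- The variable with the larger exponent takes the part of x in `Laguerre`. For a < b this is p̃,
  -- and afterwards the product p̃ p in the Laguerre argument is commuted back.
  Δ-factor-monomial : ∀ I j a b → a ℕ.⊓ b ≤ I → Δ-factor I j (monomial j a b) ≈ F j a b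
  Δ-factor-monomial I j a b a⊓b≤I with b ℕ.≤? a
  ... | yes b≤a = begin
    Δ-factor I j (monomial j a b)
      ≈⟨ reflexive (≡.cong (λ e → Δ-factor I j (monomial j e b)) (≡.sym (ℕ.m+[n∸m]≡n b≤a))) ⟩
    Δ-factor I j (monomial j (b ℕ.+ (a ∸ b)) b)
      ≈⟨ exponential≈laguerre mixed (suc j) (a ∸ b) (≡.subst (_≤ I) (ℕ.m≥n⇒m⊓n≡n b≤a) a⊓b≤I) ⟩
    (+ (suc j ℕ.^ b ℕ.* b !) ℚ./ 1) · (laguerre A b (a ∸ b) (- ((+ 1 ℚ./ suc j) · (p j * p̃ j))) * p j ^ (a ∸ b)) ∎
    where
    open Laguerre A (p j) (p̃ j) (∂p∂p̃ j)
    mixed : IsMixedPartial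
    mixed = record
      { T-cong = T-cong (∂p∂p̃-linear j)
      ; T-·    = λ q → T-* (∂p∂p̃-linear j) (constant-ι j q)
      ; T-0    = T-0 (∂p∂p̃-linear j)
      ; T-zero = ∂p∂p̃-p^ j
      ; T-suc  = ∂p∂p̃-monomial j
      }
  ... | no  b≰a = begin
    Δ-factor I j (monomial j a b)
      ≈⟨ reflexive (≡.cong (λ e → Δ-factor I j (monomial j a e)) (≡.sym (ℕ.m+[n∸m]≡n a≤b))) ⟩
    Δ-factor I j (monomial j a (a ℕ.+ (b ∸ a)))
      ≈⟨ T-cong (Δ-factor-linear I j) (*-comm _ _) ⟩
    Δ-factor I j (p̃ j ^ (a ℕ.+ (b ∸ a)) * p j ^ a)
      ≈⟨ exponential≈laguerre mixed (suc j) (b ∸ a) (≡.subst (_≤ I) (ℕ.m≤n⇒m⊓n≡m a≤b) a⊓b≤I) ⟩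
    (+ (suc j ℕ.^ a ℕ.* a !) ℚ./ 1) · (laguerre A a (b ∸ a) (- ((+ 1 ℚ./ suc j) · (p̃ j * p j))) * p̃ j ^ (b ∸ a))
      ≈⟨ *-congˡ (*-congʳ (laguerre-cong a (b ∸ a) (-‿cong (*-congˡ (*-comm (p̃ j) (p j)))))) ⟩
    (+ (suc j ℕ.^ a ℕ.* a !) ℚ./ 1) · (laguerre A a (b ∸ a) (- ((+ 1 ℚ./ suc j) · (p j * p̃ j))) * p̃ j ^ (b ∸ a)) ∎
    where
    a≤b : a ≤ b
    a≤b = ℕ.<⇒≤ (ℕ.≰⇒> b≰a)
    open Laguerre A (p̃ j) (p j) (∂p∂p̃ j)
    mixed : IsMixedPartial
    mixed = record
      { T-cong = T-cong (∂p∂p̃-linear j)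
      ; T-·    = λ q → T-* (∂p∂p̃-linear j) (constant-ι j q)
      ; T-0    = T-0 (∂p∂p̃-linear j)
      ; T-zero = λ b → trans (T-cong (∂p∂p̃-linear j) (*-comm _ _)) (∂p∂p̃-p̃^ j b)
      ; T-suc  = λ b a → trans (T-cong (∂p∂p̃-linear j) (*-comm _ _)) (trans (∂p∂p̃-monomial j a b)
          (*-cong (reflexive (≡.cong ι (ℚ.*-comm ⟦ suc a ⟧ ⟦ suc b ⟧))) (*-comm _ _)))
      }

  -- The bound on I in `Δ-factor-monomial` allows I = 0, and the factor of Δ cut off there is the
  -- identity. So no Laguerre polynomial has to be evaluated.
  F-monomial : ∀ j a b → a ℕ.⊓ b ≡ 0 → F j a b ≈ monomial j a b
  F-monomial j a b a⊓b≡0 = begin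
    F j a b                             ≈⟨ Δ-factor-monomial 0 j a b (ℕ.≤-reflexive a⊓b≡0) ⟨
    ι (1 /! 0) * monomial j a b + 0#    ≈⟨ +-identityʳ _ ⟩
    ι (1 /! 0) * monomial j a b         ≈⟨ *-congʳ ι-1 ⟩
    1# * monomial j a b                 ≈⟨ *-identityˡ _ ⟩
    monomial j a b                      ∎

  -- Truncations of Δ on products over all indices and on their combinations

  module _ (I : ℕ) (a b : ℕ → ℕ) (a⊓b≤I : ∀ j → a j ℕ.⊓ b j ≤ I) where

    M G : ℕ → Carrier
    M j = monomial j (a j) (b j)
    G j = F j (a j) (b j)

    -- The factors of index ≥ K are constants for the derivations of index < K,
    -- and so are the factors that have already been transformed for ∂_K.
    Δ-truncated-Π : ∀ K c → (∀ j → j < K → Constant j c) → Δ-truncated K I (Π K M * c) ≈ Π K G * c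
    Δ-truncated-Π zero    c cc = refl
    Δ-truncated-Π (suc K) c cc = begin
      Δ-factor I K (Δ-truncated K I ((Π K M * M K) * c))
        ≈⟨ T-cong (Δ-factor-linear I K) (T-cong (Δ-truncated-linear K I) (*-assoc _ _ _)) ⟩
      Δ-factor I K (Δ-truncated K I (Π K M * (M K * c)))
        ≈⟨ T-cong (Δ-factor-linear I K) (Δ-truncated-Π K (M K * c) (λ j j<K →
             constant-* (constant-monomial (ℕ.<⇒≢ j<K) (a K) (b K)) (cc j (ℕ.m<n⇒m<1+n j<K)))) ⟩
      Δ-factor I K (Π K G * (M K * c))
        ≈⟨ T-cong (Δ-factor-linear I K) (rotate _ _ _) ⟩
      Δ-factor I K ((Π K G * c) * M K)
        ≈⟨ T-* (Δ-factor-linear I K) (constant-*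
             (constant-Π K G (λ j j<K → constant-F (≡.≢-sym (ℕ.<⇒≢ j<K)) (a j) (b j))) (cc K (ℕ.n<1+n K))) (M K) ⟩
      (Π K G * c) * Δ-factor I K (M K)
        ≈⟨ *-congˡ (Δ-factor-monomial I K (a K) (b K) (a⊓b≤I K)) ⟩
      (Π K G * c) * G K
        ≈⟨ rotate _ _ _ ⟨
      Π K G * (G K * c)
        ≈⟨ *-assoc _ _ _ ⟨
      (Π K G * G K) * c ∎
      where
      rotate : ∀ x y z → x * (y * z) ≈ (x * z) * y
      rotate x y z = trans (*-congˡ (*-comm y z)) (sym (*-assoc x z y))

  -- As F j 0 0 = 1, all three products can be padded to the length K of the truncation. There the
  -- two factors on the left merge into one product of monomials, to which `Δ-truncated-Π` applies
  -- with cofactor 1.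
  Δ-truncated-monomials : ∀ K I {m n} a b →
    (∀ j → a j ≤ m) → (∀ j → m ≤ j → a j ≡ 0) → (∀ j → n ≤ j → b j ≡ 0) →
    m ℕ.+ n ≤ K → m ℕ.+ n ≤ I →
    Δ-truncated K I (∏[ j < m ℕ.+ 0 ] F (toℕ j) (a (toℕ j)) 0 * ∏[ j < n ] F (toℕ j) 0 (b (toℕ j))) ≈
    ∏[ j < m ℕ.+ n ] F (toℕ j) (a (toℕ j)) (b (toℕ j))
  Δ-truncated-monomials K I {m} {n} a b a≤m a≡0 b≡0 m+n≤K m+n≤I = begin
    Δ-truncated K I (∏[ j < m ℕ.+ 0 ] F (toℕ j) (a (toℕ j)) 0 * ∏[ j < n ] F (toℕ j) 0 (b (toℕ j)))
      ≈⟨ T-cong (Δ-truncated-linear K I) (trans (*-cong left right) (trans (Π-* K _ _) (trans (Π-cong K split) (sym (*-identityʳ _))))) ⟩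
    Δ-truncated K I (Π K (λ j → monomial j (a j) (b j)) * 1#)
      ≈⟨ Δ-truncated-Π I a b a⊓b≤I K 1# (λ j _ → constant-1 j) ⟩
    Π K (λ j → F j (a j) (b j)) * 1#
      ≈⟨ *-identityʳ _ ⟩
    Π K (λ j → F j (a j) (b j))
      ≈⟨ Π-extend (λ j → F j (a j) (b j)) m+n≤K (λ j m+n≤j → F≈1 j (a≡0 j (ℕ.≤-trans (ℕ.m≤m+n m n) m+n≤j)) (b≡0 j (ℕ.≤-trans (ℕ.m≤n+m n m) m+n≤j))) ⟩
    Π (m ℕ.+ n) (λ j → F j (a j) (b j))
      ≈⟨ ∏≈Π (m ℕ.+ n) (λ j → F j (a j) (b j)) ⟨
    ∏[ j < m ℕ.+ n ] F (toℕ j) (a (toℕ j)) (b (toℕ j)) ∎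
    where
    a⊓b≤I : ∀ j → a j ℕ.⊓ b j ≤ I
    a⊓b≤I j = ℕ.≤-trans (ℕ.m⊓n≤m (a j) (b j)) (ℕ.≤-trans (a≤m j) (ℕ.≤-trans (ℕ.m≤m+n m n) m+n≤I))

    F≈1 : ∀ j {c d} → c ≡ 0 → d ≡ 0 → F j c d ≈ 1#
    F≈1 j ≡.refl ≡.refl = trans (F-monomial j 0 0 ≡.refl) (*-identityˡ 1#)

    left : ∏[ j < m ℕ.+ 0 ] F (toℕ j) (a (toℕ j)) 0 ≈ Π K (λ j → F j (a j) 0)
    left = trans (∏≈Π (m ℕ.+ 0) (λ j → F j (a j) 0))
      (sym (Π-extend (λ j → F j (a j) 0) (ℕ.≤-trans (ℕ.+-monoʳ-≤ m ℕ.z≤n) m+n≤K)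
        (λ j m≤j → F≈1 j (a≡0 j (ℕ.≤-trans (ℕ.m≤m+n m 0) m≤j)) ≡.refl)))

    right : ∏[ j < n ] F (toℕ j) 0 (b (toℕ j)) ≈ Π K (λ j → F j 0 (b j))
    right = trans (∏≈Π n (λ j → F j 0 (b j)))
      (sym (Π-extend (λ j → F j 0 (b j)) (ℕ.≤-trans (ℕ.m≤n+m n m) m+n≤K) (λ j n≤j → F≈1 j ≡.refl (b≡0 j n≤j))))

    split : ∀ j → F j (a j) 0 * F j 0 (b j) ≈ monomial j (a j) (b j)
    split j = *-cong (trans (F-monomial j (a j) 0 (ℕ.⊓-zeroʳ (a j))) (*-identityʳ _))
                     (trans (F-monomial j 0 (b j) ≡.refl) (*-identityˡ _))

  -- The product of two combinations is a double combination, and a truncation passes through its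
  -- sums and rational coefficients. The nesting of r and s on the right is that of `BD`.
  Δ-truncated-bilinear : ∀ K I r s {M N} (u : Fin M → ℚ) (v : Fin N → ℚ)
    (f : Fin M → Carrier) (g : Fin N → Carrier) (h : Fin M → Fin N → Carrier) →
    (∀ x y → Δ-truncated K I (f x * g y) ≈ h x y) →
    Δ-truncated K I ((r · ∑[ x < M ] (u x · f x)) * (s · ∑[ y < N ] (v y · g y))) ≈
    r · ∑[ x < M ] (s · ∑[ y < N ] ((u x ℚ.* v y) · h x y))
  Δ-truncated-bilinear K I r s {M} {N} u v f g h Tfg≈h = begin
    T ((r · ∑[ x < M ] (u x · f x)) * (s · ∑[ y < N ] (v y · g y)))
      ≈⟨ T-cong T-lin expand ⟩
    T (r · ∑[ x < M ] (s · ∑[ y < N ] ((u x ℚ.* v y) · (f x * g y))))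
      ≈⟨ T-· r _ ⟩
    r · T (∑[ x < M ] (s · ∑[ y < N ] ((u x ℚ.* v y) · (f x * g y))))
      ≈⟨ *-congˡ (trans (T-∑ T-lin M _) (sum-cong-≋ (λ x → trans (T-· s _) (*-congˡ
           (trans (T-∑ T-lin N _) (sum-cong-≋ (λ y → trans (T-· (u x ℚ.* v y) _) (*-congˡ (Tfg≈h x y))))))))) ⟩
    r · ∑[ x < M ] (s · ∑[ y < N ] ((u x ℚ.* v y) · h x y)) ∎
    where
    T : Carrier → Carrier
    T = Δ-truncated K I
    T-lin : IsLinearOver (λ c → ∀ j → Constant j c) T
    T-lin = Δ-truncated-linear K I
    T-· : ∀ q z → T (q · z) ≈ q · T z
    T-· q = T-* T-lin (λ j → constant-ι j q)

    expand-∑ : ∀ x → (u x · f x) * (s · ∑[ y < N ] (v y · g y)) ≈ s · ∑[ y < N ] ((u x ℚ.* v y) · (f x * g y))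
    expand-∑ x = begin
      (u x · f x) * (s · ∑[ y < N ] (v y · g y))         ≈⟨ x∙yz≈y∙xz _ _ _ ⟩
      s · ((u x · f x) * ∑[ y < N ] (v y · g y))         ≈⟨ *-congˡ (*-distribˡ-sum (u x · f x) (λ y → v y · g y)) ⟩
      s · ∑[ y < N ] ((u x · f x) * (v y · g y))         ≈⟨ *-congˡ (sum-cong-≋ (λ y → trans (interchange _ _ _ _) (*-congʳ (sym (ι-* (u x) (v y)))))) ⟩
      s · ∑[ y < N ] ((u x ℚ.* v y) · (f x * g y))       ∎

    expand : (r · ∑[ x < M ] (u x · f x)) * (s · ∑[ y < N ] (v y · g y)) ≈
             r · ∑[ x < M ] (s · ∑[ y < N ] ((u x ℚ.* v y) · (f x * g y)))
    expand = begin
      (r · ∑[ x < M ] (u x · f x)) * S      ≈⟨ *-assoc _ _ _ ⟩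
      r · (∑[ x < M ] (u x · f x) * S)      ≈⟨ *-congˡ (*-distribʳ-sum S (λ x → u x · f x)) ⟩
      r · ∑[ x < M ] ((u x · f x) * S)      ≈⟨ *-congˡ (sum-cong-≋ expand-∑) ⟩
      r · ∑[ x < M ] (s · ∑[ y < N ] ((u x ℚ.* v y) · (f x * g y))) ∎
      where
      S : Carrier
      S = s · ∑[ y < N ] (v y · g y)

  BD-∅ʳ : ∀ λ′ → BD λ′ ∅ ≈ (1 /! ∣ λ′ ∣) · ∑[ x < ∣ λ′ ∣ ! ] (χ λ′ (perm ∣ λ′ ∣ x) ·
    ∏[ j < ∣ λ′ ∣ ℕ.+ 0 ] F (toℕ j) (cycles (perm ∣ λ′ ∣ x) (suc (toℕ j))) 0)
  BD-∅ʳ λ′ = *-congˡ (sum-cong-≋ (λ x → begin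
    -- The sum over the trivial group of permutations of no points evaluates by computation: a
    -- single term, with 1/0! and the character of ∅ both equal to 1 and every cycle number 0.
    ι 1ℚ * (((χ λ′ (perm ∣ λ′ ∣ x) ℚ.* 1ℚ) · P x) + 0#)  ≈⟨ trans (*-congʳ ι-1) (*-identityˡ _) ⟩
    ((χ λ′ (perm ∣ λ′ ∣ x) ℚ.* 1ℚ) · P x) + 0#           ≈⟨ +-identityʳ _ ⟩
    (χ λ′ (perm ∣ λ′ ∣ x) ℚ.* 1ℚ) · P x                  ≈⟨ *-congʳ (reflexive (≡.cong ι (ℚ.*-identityʳ _))) ⟩
    χ λ′ (perm ∣ λ′ ∣ x) · P x                           ∎))
    where
    P : Fin (∣ λ′ ∣ !) → Carrier
    P x = ∏[ j < ∣ λ′ ∣ ℕ.+ 0 ] F (toℕ j) (cycles (perm ∣ λ′ ∣ x) (suc (toℕ j))) 0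

  BD-∅ˡ : ∀ μ → BD ∅ μ ≈ (1 /! ∣ μ ∣) · ∑[ y < ∣ μ ∣ ! ] (χ μ (perm ∣ μ ∣ y) ·
    ∏[ j < ∣ μ ∣ ] F (toℕ j) 0 (cycles (perm ∣ μ ∣ y) (suc (toℕ j))))
  BD-∅ˡ μ = begin
    ι 1ℚ * (((1 /! ∣ μ ∣) · ∑[ y < ∣ μ ∣ ! ] ((1ℚ ℚ.* χ μ (perm ∣ μ ∣ y)) · P y)) + 0#)
      ≈⟨ trans (*-congʳ ι-1) (trans (*-identityˡ _) (+-identityʳ _)) ⟩
    (1 /! ∣ μ ∣) · ∑[ y < ∣ μ ∣ ! ] ((1ℚ ℚ.* χ μ (perm ∣ μ ∣ y)) · P y)
      ≈⟨ *-congˡ (sum-cong-≋ (λ y → *-congʳ (reflexive (≡.cong ι (ℚ.*-identityˡ (χ μ (perm ∣ μ ∣ y))))))) ⟩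
    (1 /! ∣ μ ∣) · ∑[ y < ∣ μ ∣ ! ] (χ μ (perm ∣ μ ∣ y) · P y) ∎
    where
    P : Fin (∣ μ ∣ !) → Carrier
    P y = ∏[ j < ∣ μ ∣ ] F (toℕ j) 0 (cycles (perm ∣ μ ∣ y) (suc (toℕ j)))

  Δ-BD : ∀ λ′ μ → Δ (BD λ′ ∅ * BD ∅ μ) ≐ BD λ′ μ
  -- m + n serves both cut-offs: neither permutation has a cycle longer than this, and min(a, b) ≤ m
  -- bounds the order of differentiation.
  Δ-BD λ′ μ = m ℕ.+ n , λ K I m+n≤K m+n≤I → trans
    (T-cong (Δ-truncated-linear K I) (*-cong (BD-∅ʳ λ′) (BD-∅ˡ μ)))
    (Δ-truncated-bilinear K I (1 /! m) (1 /! n) (λ x → χ λ′ (perm m x)) (λ y → χ μ (perm n y))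
      (λ x → ∏[ j < m ℕ.+ 0 ] F (toℕ j) (cycles (perm m x) (suc (toℕ j))) 0)
      (λ y → ∏[ j < n ] F (toℕ j) 0 (cycles (perm n y) (suc (toℕ j))))
      (λ x y → ∏[ j < m ℕ.+ n ] F (toℕ j) (cycles (perm m x) (suc (toℕ j))) (cycles (perm n y) (suc (toℕ j))))
      (λ x y → Δ-truncated-monomials K I (λ j → cycles (perm m x) (suc j)) (λ j → cycles (perm n y) (suc j))
        (λ j → cycles≤ (perm m x) (suc j))
        (λ j m≤j → cycles≡0 (perm m x) (ℕ.s≤s m≤j))
        (λ j n≤j → cycles≡0 (perm n y) (ℕ.s≤s n≤j))
        m+n≤K m+n≤I))
    where
    m n : ℕ
    m = ∣ λ′ ∣
    n = ∣ μ ∣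

-- Partial derivatives of power series

-- Power series are formed over any commutative ring, so no scalars from ℚ appear here.
-- `isDerivation` recovers ℚ-linearity from the Leibniz rule once d kills the image of ℚ.
record IsRingDerivation (R : CommutativeRing 0ℓ 0ℓ) (d : CommutativeRing.Carrier R → CommutativeRing.Carrier R) : Set where
  open CommutativeRing R
  field
    d-cong  : ∀ {x y} → x ≈ y → d x ≈ d y
    d-+     : ∀ x y → d (x + y) ≈ d x + d y
    leibniz : ∀ x y → d (x * y) ≈ d x * y + x * d y

  open GroupProperties +-group using (identityʳ-unique)

  d-0 : d 0# ≈ 0#
  d-0 = identityʳ-unique (d 0#) (d 0#) (trans (sym (d-+ 0# 0#)) (d-cong (+-identityˡ 0#)))

  d-1 : d 1# ≈ 0#
  d-1 = identityʳ-unique (d 1#) (d 1#)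
    (trans (sym (+-cong (*-identityʳ (d 1#)) (*-identityˡ (d 1#)))) (trans (sym (leibniz 1# 1#)) (d-cong (*-identityˡ 1#))))

isDerivation : ∀ (A : ℚ-Algebra) {d} → let open ℚ-Algebra A in
  IsRingDerivation commutativeRing d → (∀ q → d (ι q) ≈ 0#) → IsDerivation A d
isDerivation A δ d-ι = record
  { d-cong  = d-cong
  ; d-+     = d-+
  ; d-·     = λ q x → trans (leibniz (ι q) x) (trans (+-congʳ (trans (*-congʳ (d-ι q)) (zeroˡ x))) (+-identityˡ _))
  ; leibniz = leibniz
  }
  where
  open ℚ-Algebra A
  open IsRingDerivation δ

module SeriesDerivations (R : CommutativeRing 0ℓ 0ℓ) where

  open CommutativeRing R hiding (zero)
  open Antidiagonal R
  open PowerSeries R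
  open SemiringMult semiring using (×-congʳ; ×-homo-+; ×-assoc-*) renaming (_×_ to infixr 8 _⋆_)
  open CommutativeMonoidMult +-commutativeMonoid using (×-distrib-+)
  open SetoidReasoning setoid

  ⋆-0 : ∀ k → k ⋆ 0# ≈ 0#
  ⋆-0 zero    = refl
  ⋆-0 (suc k) = trans (+-identityˡ _) (⋆-0 k)

  antidiagonal-⋆ : ∀ k n h → k ⋆ antidiagonal n h ≈ antidiagonal n (λ a b → k ⋆ h a b)
  antidiagonal-⋆ k zero    h = refl
  antidiagonal-⋆ k (suc n) h = trans (×-distrib-+ _ _ k) (+-congˡ (antidiagonal-⋆ k n _))

  -- (a + b) · h = a · h + b · h, and the terms with a = 0 resp. b = 0 drop out.
  antidiagonal-weighted : ∀ n h → suc n ⋆ antidiagonal (suc n) h ≈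
    antidiagonal n (λ a b → suc a ⋆ h (suc a) b) + antidiagonal n (λ a b → suc b ⋆ h a (suc b))
  antidiagonal-weighted n h = begin
    suc n ⋆ antidiagonal (suc n) h
      ≈⟨ antidiagonal-⋆ (suc n) (suc n) h ⟩
    antidiagonal (suc n) (λ a b → suc n ⋆ h a b)
      ≈⟨ antidiagonal-cong (suc n) (λ a b a+b≡n → trans (reflexive (≡.cong (_⋆ h a b) (≡.sym a+b≡n))) (×-homo-+ (h a b) a b)) ⟩
    antidiagonal (suc n) (λ a b → a ⋆ h a b + b ⋆ h a b)
      ≈⟨ antidiagonal-+ (suc n) (λ a b → a ⋆ h a b) (λ a b → b ⋆ h a b) ⟩
    antidiagonal (suc n) (λ a b → a ⋆ h a b) + antidiagonal (suc n) (λ a b → b ⋆ h a b)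
      ≈⟨ +-cong (+-identityˡ _) (trans (antidiagonal-last n (λ a b → b ⋆ h a b)) (+-identityʳ _)) ⟩
    antidiagonal n (λ a b → suc a ⋆ h (suc a) b) + antidiagonal n (λ a b → suc b ⋆ h a (suc b)) ∎

  mulC-⋆ˡ : ∀ k f g es → mulC (λ as → k ⋆ f as) g es ≈ k ⋆ mulC f g es
  mulC-⋆ˡ k f g []       = ×-assoc-* k _ _
  mulC-⋆ˡ k f g (e ∷ es) = trans (antidiagonal-cong e (λ a b _ → mulC-⋆ˡ k _ _ es)) (sym (antidiagonal-⋆ k e _))

  mulC-⋆ʳ : ∀ k f g es → mulC f (λ bs → k ⋆ g bs) es ≈ k ⋆ mulC f g es
  mulC-⋆ʳ k f g es = trans (mulC-comm f _ es) (trans (mulC-⋆ˡ k g f es) (×-congʳ k (mulC-comm g f es)))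

  ∂C : ℕ → Coefficients → Coefficients
  ∂C j f es = suc (exponent j es) ⋆ f (raise j es)

  -- Exponents in front of x_j are merely split between the two factors. At x_j itself the weight e
  -- + 1 = a + b is shared out between them. Padding enters when the exponent list ends at or before
  -- x_j, since `raise` lengthens it.
  ∂C-leibniz : ∀ j f g es → (∀ as → f (as ∷ʳ 0) ≈ f as) → (∀ bs → g (bs ∷ʳ 0) ≈ g bs) →
               ∂C j (mulC f g) es ≈ mulC (∂C j f) g es + mulC f (∂C j g) es
  ∂C-leibniz zero f g [] pf pg = begin
    (f (0 ∷ []) * g (1 ∷ []) + f (1 ∷ []) * g (0 ∷ [])) + 0#
      ≈⟨ +-identityʳ _ ⟩
    f (0 ∷ []) * g (1 ∷ []) + f (1 ∷ []) * g (0 ∷ [])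
      ≈⟨ +-comm _ _ ⟩
    f (1 ∷ []) * g (0 ∷ []) + f (0 ∷ []) * g (1 ∷ [])
      ≈⟨ +-cong (*-cong (sym (+-identityʳ _)) (pg [])) (*-cong (pf []) (sym (+-identityʳ _))) ⟩
    (f (1 ∷ []) + 0#) * g [] + f [] * (g (1 ∷ []) + 0#) ∎
  ∂C-leibniz zero f g (e ∷ es) pf pg = trans
    (antidiagonal-weighted e (λ a b → mulC (λ as → f (a ∷ as)) (λ bs → g (b ∷ bs)) es))
    (+-cong (antidiagonal-cong e (λ a b _ → sym (mulC-⋆ˡ (suc a) _ _ es)))
            (antidiagonal-cong e (λ a b _ → sym (mulC-⋆ʳ (suc b) _ _ es))))
  ∂C-leibniz (suc j) f g [] pf pg = trans
    (∂C-leibniz j (λ as → f (0 ∷ as)) (λ bs → g (0 ∷ bs)) [] (λ as → pf (0 ∷ as)) (λ bs → pg (0 ∷ bs)))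
    (+-cong (*-congˡ (pg [])) (*-congʳ (pf [])))
  ∂C-leibniz (suc j) f g (e ∷ es) pf pg = begin
    suc (exponent j es) ⋆ antidiagonal e (λ a b → mulC (λ as → f (a ∷ as)) (λ bs → g (b ∷ bs)) (raise j es))
      ≈⟨ antidiagonal-⋆ (suc (exponent j es)) e _ ⟩
    antidiagonal e (λ a b → ∂C j (mulC (λ as → f (a ∷ as)) (λ bs → g (b ∷ bs))) es)
      ≈⟨ antidiagonal-cong e (λ a b _ → ∂C-leibniz j _ _ es (λ as → pf (a ∷ as)) (λ bs → pg (b ∷ bs))) ⟩
    antidiagonal e (λ a b → mulC (∂C j (λ as → f (a ∷ as))) (λ bs → g (b ∷ bs)) es
                          + mulC (λ as → f (a ∷ as)) (∂C j (λ bs → g (b ∷ bs))) es)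
      ≈⟨ antidiagonal-+ e _ _ ⟩
    mulC (∂C (suc j) f) g (e ∷ es) + mulC f (∂C (suc j) g) (e ∷ es) ∎

  ∂var-derivation : ∀ j → IsRingDerivation powerSeriesRing (∂var j)
  ∂var-derivation j = record
    { d-cong  = λ {f} {g} → ∂var-cong j f g
    ; d-+     = λ f g es → ×-distrib-+ _ _ (suc (exponent j es))
    ; leibniz = λ f g es → ∂C-leibniz j (coeff f) (coeff g) es (pad f) (pad g)
    }

  constC-raise : ∀ j c es → constC c (raise j es) ≈ 0#
  constC-raise zero    c []           = refl
  constC-raise zero    c (_ ∷ _)      = refl
  constC-raise (suc j) c []           = constC-raise j c []
  constC-raise (suc j) c (zero  ∷ es) = constC-raise j c es
  constC-raise (suc j) c (suc _ ∷ es) = refl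

  ∂var-const : ∀ j c → ∂var j (const c) ≋ CommutativeRing.0# powerSeriesRing
  ∂var-const j c es = trans (×-congʳ (suc (exponent j es)) (constC-raise j c es)) (⋆-0 (suc (exponent j es)))

  indicator : Bool → Series
  indicator b = if b then CommutativeRing.1# powerSeriesRing else CommutativeRing.0# powerSeriesRing

  indicator-0∷ : ∀ b es → coeff (indicator b) (0 ∷ es) ≈ coeff (indicator b) es
  indicator-0∷ true  es = refl
  indicator-0∷ false es = refl

  indicator-suc∷ : ∀ b e es → coeff (indicator b) (suc e ∷ es) ≈ 0#
  indicator-suc∷ true  e es = refl
  indicator-suc∷ false e es = refl

  ∂var-var : ∀ i j → ∂var i (var j) ≋ indicator (i ℕ.≡ᵇ j)
  ∂var-var zero    zero    []                 = +-identityʳ _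
  ∂var-var zero    zero    (zero ∷ es)        = +-identityʳ _
  ∂var-var zero    zero    (suc e ∷ es)       = ⋆-0 (2 ℕ.+ e)
  ∂var-var zero    (suc j) []                 = ⋆-0 1
  ∂var-var zero    (suc j) (e ∷ es)           = ⋆-0 (suc e)
  ∂var-var (suc i) zero    []                 = ⋆-0 1
  ∂var-var (suc i) zero    (zero ∷ es)        = ⋆-0 (suc (exponent i es))
  ∂var-var (suc i) zero    (suc zero ∷ es)    = ∂var-const i 1# es
  ∂var-var (suc i) zero    (suc (suc _) ∷ es) = ⋆-0 (suc (exponent i es))
  ∂var-var (suc i) (suc j) []                 = ∂var-var i j []
  ∂var-var (suc i) (suc j) (zero ∷ es)        = trans (∂var-var i j es) (sym (indicator-0∷ (i ℕ.≡ᵇ j) es))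
  ∂var-var (suc i) (suc j) (suc e ∷ es)       = trans (⋆-0 (suc (exponent i es))) (sym (indicator-suc∷ (i ℕ.≡ᵇ j) e es))

  -- The source of ∂_p on `V`, where the p_k lie in the coefficient ring of the series in the p̃_k.
  -- Each coefficient of a product is a finite sum of products, so additivity and the Leibniz rule
  -- of d carry over.
  module Coefficientwise {d} (δ : IsRingDerivation R d) where

    open IsRingDerivation δ

    d-series : Series → Series
    d-series f = series (λ es → d (coeff f es)) (λ es → d-cong (pad f es))

    d-antidiagonal : ∀ n h → d (antidiagonal n h) ≈ antidiagonal n (λ a b → d (h a b))
    d-antidiagonal zero    h = refl
    d-antidiagonal (suc n) h = trans (d-+ _ _) (+-congˡ (d-antidiagonal n _))

    mulC-leibniz : ∀ f g es → d (mulC f g es) ≈ mulC (λ as → d (f as)) g es + mulC f (λ bs → d (g bs)) es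
    mulC-leibniz f g []       = leibniz (f []) (g [])
    mulC-leibniz f g (e ∷ es) = trans (d-antidiagonal e _)
      (trans (antidiagonal-cong e (λ a b _ → mulC-leibniz _ _ es)) (antidiagonal-+ e _ _))

    d-constC : ∀ c es → d (constC c es) ≈ constC (d c) es
    d-constC c []           = refl
    d-constC c (zero  ∷ es) = d-constC c es
    d-constC c (suc _ ∷ es) = d-0

    d-varC : ∀ j es → d (varC j es) ≈ 0#
    d-varC _       []                 = d-0
    d-varC zero    (zero ∷ es)        = d-0
    d-varC zero    (suc zero ∷ es)    = trans (d-constC 1# es) (trans (constC-cong d-1 es) (constC-0 es))
    d-varC zero    (suc (suc _) ∷ es) = d-0
    d-varC (suc j) (zero ∷ es)        = d-varC j es
    d-varC (suc j) (suc _ ∷ es)       = d-0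

    d-series-derivation : IsRingDerivation powerSeriesRing d-series
    d-series-derivation = record
      { d-cong  = λ f≋g es → d-cong (f≋g es)
      ; d-+     = λ f g es → d-+ (coeff f es) (coeff g es)
      ; leibniz = λ f g → mulC-leibniz (coeff f) (coeff g)
      }

V-partialDerivatives : PartialDerivatives V V.p V.p̃
V-partialDerivatives = record
  { ∂p            = V.∂p
  ; ∂p̃            = V.∂p̃
  ; ∂p-derivation = λ i → isDerivation V (Inner.derivation i) (λ q → trans {V.∂p i (ι q)} {V.Outer.const 0ᴵ} {0#}
                      (∂p-const i (V.Inner.const q) 0ᴵ (I.∂var-const i q)) V.Outer.constC-0)
  ; ∂p̃-derivation = λ i → isDerivation V (O.∂var-derivation i) (λ q → O.∂var-const i (V.Inner.const q))
  ; ∂p-p          = λ i j → trans {V.∂p i (V.p j)} {V.Outer.const (I.indicator (i ℕ.≡ᵇ j))} {O.indicator (i ℕ.≡ᵇ j)}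
                      (∂p-const i (V.Inner.var j) _ (I.∂var-var i j)) (const-indicator (i ℕ.≡ᵇ j))
  ; ∂p-p̃          = λ i j → Inner.C.d-varC i j
  ; ∂p̃-p          = λ i j → O.∂var-const i (V.Inner.var j)
  ; ∂p̃-p̃          = O.∂var-var
  }
  where
  open ℚ-Algebra V
  open CommutativeRing V.Inner.powerSeriesRing using () renaming (0# to 0ᴵ; trans to ≋-trans)
  module I = SeriesDerivations ℚ-ring
  module O = SeriesDerivations V.Inner.powerSeriesRing
  module Inner where
    module C i = O.Coefficientwise (I.∂var-derivation i)
    derivation : ∀ i → IsRingDerivation V.Outer.powerSeriesRing (V.∂p i)
    derivation i = C.d-series-derivation i

  ∂p-const : ∀ i c e → V.Inner.∂var i c V.Inner.≋ e → V.∂p i (V.Outer.const c) ≈ V.Outer.const e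
  ∂p-const i c e eq es = ≋-trans {V.∂p i (V.Outer.const c) .V.Outer.Series.coeff es} {V.Outer.constC (V.Inner.∂var i c) es} {V.Outer.constC e es} (Inner.C.d-constC i c es) (V.Outer.constC-cong {V.Inner.∂var i c} {e} eq es)

  const-indicator : ∀ b → V.Outer.const (I.indicator b) ≈ O.indicator b
  const-indicator true  = refl {V.Outer.const (I.indicator true)}
  const-indicator false = V.Outer.constC-0

theorem2 : (λ′ μ : Partition) →
    (V.Δ (V.BD λ′ ∅ V.* V.BD ∅ μ) ≐ V.BD λ′ μ) ×
    ((∂ : PartialDerivatives Λ⟨X,Y⟩ Λ⟨X,Y⟩.𝐩 Λ⟨X,Y⟩.𝐩̃) →
    Λ⟨X,Y⟩.Δ[ ∂ ] (Λ⟨X,Y⟩.BD λ′ ∅ Λ⟨X,Y⟩.* Λ⟨X,Y⟩.BD ∅ μ) ≐ Λ⟨X,Y⟩.BD λ′ μ)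
theorem2 λ′ μ = ΔTheorem.Δ-BD V V-partialDerivatives λ′ μ , λ ∂ → ΔTheorem.Δ-BD Λ⟨X,Y⟩ ∂ λ′ μ
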